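{- Let $G$ be a connected graph of order $n\geq 16$ and let $\mathcal{G}_1=\{K_{n-4}\vee 4K_1,\ K_{n-4}\vee(2K_1\cup K_2),\ K_{n-4}\vee(P_3\cup K_1),\ K_{n-4}\vee 2K_2,\ K_{n-4}\vee P_4,\ K_{n-4}\vee(K_3\cup K_1),\ K_{n-4}\vee C_4\}$. Then $m(-1)=n-5$ if and only if $G\in\mathcal{G}_1\cup\{K_{n-5}\vee C_5,\ K_{n-5}\vee(K_1\cup P_4),\ K_{n-5}\vee H_1\}$, where $H_1$ is the bull graph. In addition, each such $G$ is determined by its $\mathcal{A}$-spectrum.
   Context: $K_m,P_m,C_m$ are the complete graph, path, cycle on $m$ vertices; $kH$ is the disjoint union of $k$ copies of $H$; $\cup$ is disjoint union and $\vee$ is join. The bull graph $H_1$ has vertices $a,b,c,x,y$ and edges $ab,bc,ca,xa,yb$. For a connected graph $G$, $d(u,v)$ is the distance and $\varepsilon(v)=\max_u d(u,v)$ the eccentricity. The eccentricity matrix $\mathcal{A}(G)$ is indexed by $V(G)$ with $(u,v)$-entry $d(u,v)$ if $d(u,v)=\min\{\varepsilon(u),\varepsilon(v)\}$ and $0$ otherwise; its $\mathcal{A}$-spectrum is the multiset of its eigenvalues. $m(-1)$ is the multiplicity of $-1$ in the $\mathcal{A}$-spectrum. A graph $G$ is determined by its $\mathcal{A}$-spectrum if every connected graph with the same $\mathcal{A}$-spectrum is isomorphic to $G$. -}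

module Defs where

open import Data.Bool using (Bool; true; false; _∧_; _∨_; not; if_then_else_)
open import Data.Nat using (ℕ; zero; suc; _⊔_; _⊓_; _∸_; _+_)
import Data.Nat as ℕ
open import Data.Integer using (ℤ; +_; -_) renaming (_+_ to _+ℤ_; _*_ to _*ℤ_)
open import Data.Fin using (Fin; punchIn; splitAt; toℕ; #_) renaming (zero to fz; suc to fs)
import Data.Fin as F
open import Data.List using (List; []; _∷_; map; foldr; allFin)
open import Data.Bool.ListAction using (any)
open import Data.Product using (Σ; Σ-syntax; _×_; _,_)
open import Data.Sum using (_⊎_; inj₁; inj₂)
open import Relation.Nullary using (¬_)
open import Relation.Nullary.Decidable using (⌊_⌋)
open import Relation.Binary.PropositionalEquality using (_≡_)
open import Function.Bundles using (_↔_; Inverse)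

Adj : ℕ → Set
Adj n = Fin n → Fin n → Bool

IsSimple : ∀ {n} → Adj n → Set
IsSimple {n} G = (∀ u v → G u v ≡ G v u) × (∀ u → G u u ≡ false)

_==_ : ∀ {n} → Fin n → Fin n → Bool
u == v = ⌊ u F.≟ v ⌋

walkLe : ∀ {n} → Adj n → ℕ → Fin n → Fin n → Bool
walkLe G zero u v = u == v
walkLe {n} G (suc k) u v = walkLe G k u v ∨ any (λ w → walkLe G k u w ∧ G w v) (allFin n)

Connected : ∀ {n} → Adj n → Set
Connected {n} G = ∀ u v → walkLe G n u v ≡ true

-- least k < fuel with f k = true (fuel if none)
least : ℕ → (ℕ → Bool) → ℕ
least zero f = zero
least (suc fuel) f = if f zero then zero else suc (least fuel (λ k → f (suc k)))

-- distance d(u,v) (correct for connected graphs)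
dist : ∀ {n} → Adj n → Fin n → Fin n → ℕ
dist {n} G u v = least (suc n) (λ k → walkLe G k u v)

ecc : ∀ {n} → Adj n → Fin n → ℕ
ecc {n} G u = foldr _⊔_ 0 (map (dist G u) (allFin n))

eccMatrix : ∀ {n} → Adj n → Fin n → Fin n → ℕ
eccMatrix G u v =
  if ⌊ dist G u v ℕ.≟ (ecc G u ⊓ ecc G v) ⌋ then dist G u v else 0

-- Polynomials over ℤ as coefficient lists (lowest degree first)

Poly : Set
Poly = List ℤ

_+ₚ_ : Poly → Poly → Poly
[] +ₚ q = q
(a ∷ p) +ₚ [] = a ∷ p
(a ∷ p) +ₚ (b ∷ q) = (a +ℤ b) ∷ (p +ₚ q)

negₚ : Poly → Poly
negₚ = map -_

_*ₚ_ : Poly → Poly → Poly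
[] *ₚ q = []
(a ∷ p) *ₚ q = map (a *ℤ_) q +ₚ (+ 0 ∷ (p *ₚ q))

_^ₚ_ : Poly → ℕ → Poly
p ^ₚ zero = + 1 ∷ []
p ^ₚ suc k = p *ₚ (p ^ₚ k)

coeff : Poly → ℕ → ℤ
coeff [] i = + 0
coeff (a ∷ p) zero = a
coeff (a ∷ p) (suc i) = coeff p i

_≈ₚ_ : Poly → Poly → Set
p ≈ₚ q = ∀ i → coeff p i ≡ coeff q i

_∣ₚ_ : Poly → Poly → Set
p ∣ₚ q = Σ[ r ∈ Poly ] (q ≈ₚ (p *ₚ r))

alt : ℕ → Poly → Poly
alt zero p = p
alt (suc k) p = negₚ (alt k p)

sumₚ : List Poly → Poly
sumₚ = foldr _+ₚ_ []

det : ∀ n → (Fin n → Fin n → Poly) → Poly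
det zero M = + 1 ∷ []
det (suc n) M =
  sumₚ (map (λ j → alt (toℕ j) (M fz j *ₚ det n (λ i k → M (fs i) (punchIn j k))))
            (allFin (suc n)))

charPoly : ∀ {n} → (Fin n → Fin n → ℕ) → Poly
charPoly {n} A = det n (λ i j →
  if i == j then (- (+ A i j)) ∷ + 1 ∷ [] else (- (+ A i j)) ∷ [])

-- characteristic polynomial of the eccentricity matrix (encodes the A-spectrum)
eccCharPoly : ∀ {n} → Adj n → Poly
eccCharPoly G = charPoly (eccMatrix G)

MultMinusOne : ∀ {n} → Adj n → ℕ → Set
MultMinusOne G k =
  ((+ 1 ∷ + 1 ∷ []) ^ₚ k) ∣ₚ eccCharPoly G ×
  ¬ (((+ 1 ∷ + 1 ∷ []) ^ₚ suc k) ∣ₚ eccCharPoly G)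

Iso : ∀ {n m} → Adj n → Adj m → Set
Iso {n} {m} G H =
  Σ[ f ∈ Fin n ↔ Fin m ] (∀ u v → H (Inverse.to f u) (Inverse.to f v) ≡ G u v)

edgeIn : ∀ {r} → List (Fin r × Fin r) → Fin r → Fin r → Bool
edgeIn E u v = any (λ e → match e) E
  where
  match : _ → Bool
  match (a , b) = (a == u ∧ b == v) ∨ (a == v ∧ b == u)

fromEdges : ∀ {r} → List (Fin r × Fin r) → Adj r
fromEdges E u v = not (u == v) ∧ edgeIn E u v

joinK : ∀ {r} (k : ℕ) → Adj r → Adj (k + r)
joinK k H u v with splitAt k u | splitAt k v
... | inj₁ a | inj₁ b = not (a == b)
... | inj₂ a | inj₂ b = H a b
... | inj₁ _ | inj₂ _ = true
... | inj₂ _ | inj₁ _ = true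

fourK1 twoK1K2 P3K1 twoK2 P4 K3K1 C4 : Adj 4
fourK1 = fromEdges []
twoK1K2 = fromEdges ((# 0 , # 1) ∷ [])
P3K1 = fromEdges ((# 0 , # 1) ∷ (# 1 , # 2) ∷ [])
twoK2 = fromEdges ((# 0 , # 1) ∷ (# 2 , # 3) ∷ [])
P4 = fromEdges ((# 0 , # 1) ∷ (# 1 , # 2) ∷ (# 2 , # 3) ∷ [])
K3K1 = fromEdges ((# 0 , # 1) ∷ (# 1 , # 2) ∷ (# 0 , # 2) ∷ [])
C4 = fromEdges ((# 0 , # 1) ∷ (# 1 , # 2) ∷ (# 2 , # 3) ∷ (# 3 , # 0) ∷ [])

C5 K1P4 bull : Adj 5
C5 = fromEdges ((# 0 , # 1) ∷ (# 1 , # 2) ∷ (# 2 , # 3) ∷ (# 3 , # 4) ∷ (# 4 , # 0) ∷ [])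
K1P4 = fromEdges ((# 1 , # 2) ∷ (# 2 , # 3) ∷ (# 3 , # 4) ∷ [])
bull = fromEdges ((# 0 , # 1) ∷ (# 1 , # 2) ∷ (# 2 , # 0) ∷ (# 3 , # 0) ∷ (# 4 , # 1) ∷ [])

InFamily : ∀ n → Adj n → Set
InFamily n G =
  Iso G (joinK (n ∸ 4) fourK1) ⊎ Iso G (joinK (n ∸ 4) twoK1K2) ⊎
  Iso G (joinK (n ∸ 4) P3K1) ⊎ Iso G (joinK (n ∸ 4) twoK2) ⊎
  Iso G (joinK (n ∸ 4) P4) ⊎ Iso G (joinK (n ∸ 4) K3K1) ⊎
  Iso G (joinK (n ∸ 4) C4) ⊎
  Iso G (joinK (n ∸ 5) C5) ⊎ Iso G (joinK (n ∸ 5) K1P4) ⊎ Iso G (joinK (n ∸ 5) bull)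

DeterminedBySpectrum : ∀ {n} → Adj n → Set
DeterminedBySpectrum G =
  ∀ m (H : Adj m) → IsSimple H → Connected H →
  eccCharPoly H ≈ₚ eccCharPoly G → Iso H G

{-# OPTIONS --safe #-}

-- Let A be the eccentricity matrix and y = x + 1, so that the characteristic polynomial is det (y I - (A + I)).
-- For symmetric B, a zero of order m of det (y I - B) at y = 0 leaves a zero of order at least m - 1 after deleting
-- any vertex: with g the cofactors of the first row and ψ the substitution y ↦ - y, one has
-- 2 y Σ ψ(g u) g u = ψ(g 0) f - ψ(f) g 0, whose lowest coefficient on the left is a sum of squares.
-- Hence if m(-1) ≥ n - 5, every principal minor of A + I of order at least 6 vanishes.
--
-- If no vertex is dominating, A + I is the identity modulo e on the vertices of eccentricity e, so each eccentricity
-- occurs at most five times; a geodesic of length 6 yields an arrow matrix of determinant 1 - Σ a² ≠ 0 with a = 0 or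
-- a ≥ 3, so the diameter is at most 5; and the eccentricities 2 and 5 exclude each other. Thus n ≤ 15.
--
-- Otherwise G = K_k ∨ H with no vertex of H dominating H. A minor of order 7 that is odd bounds the order of H by 5,
-- and subtracting twin rows and columns gives det = y^(k-1) (D₁ + (k - 1) (D₁ - y D₀)), where D₀ and D₁ belong to
-- k = 0 and k = 1. The graphs H on four and five vertices are then checked exhaustively. For a fixed order the ten
-- polynomials are pairwise distinct, and the order is the degree.

module Submission where

open import Defs
open import Algebra.Bundles using (CommutativeRing)
import Algebra.Morphism.Construct.Identity as Identity
open import Algebra.Morphism.Structures using (module RingMorphisms)
open import Algebra.Structures using (IsCommutativeRing)
open import Data.Bool as Bool using (Bool; true; false; _∧_; _∨_; not; if_then_else_)
open import Data.Bool.ListAction using (any)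
open import Data.Bool.Properties using (∨-zeroʳ; ¬-not)
open import Data.Empty using (⊥; ⊥-elim)
open import Data.Fin as Fin using (Fin; punchIn; punchOut; toℕ) renaming (zero to fz; suc to fs)
open import Data.Fin.Permutation as Perm using (Permutation; _⟨$⟩ʳ_; _⟨$⟩ˡ_)
open import Data.Fin.Properties
  using ( any?; all?; ¬∀⟶∃¬; punchOut-injective; punchIn-punchOut; punchInᵢ≢i; punchIn-injective; injective⇒≤
        ; inject≤-injective; toℕ<n; toℕ-injective; ↑ʳ-injective
        ; splitAt-↑ˡ; splitAt-↑ʳ; splitAt⁻¹-↑ˡ; splitAt⁻¹-↑ʳ; join-splitAt; splitAt-join )
open import Data.Integer as ℤ using (ℤ; +_)
import Data.Integer.Properties as ℤₚ
import Algebra.Properties.AbelianGroup ℤₚ.+-0-abelianGroup as ℤ-group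
open import Data.List using (List; []; _∷_; map; foldr; tabulate; allFin; concatMap)
open import Data.List.Properties using (map-tabulate)
open import Data.Maybe as Maybe using (Maybe; just; nothing)
open import Data.Nat as ℕ using (ℕ; zero; suc; _≤_; _<_; z≤n; s≤s; _∸_; _⊔_; _⊓_)
open import Data.Nat.Divisibility using (_∣_; _∣?_; divides; ∣1⇒≡1)
open import Data.Nat.Properties as ℕₚ using ()
open import Data.Product using (Σ-syntax; ∃; _×_; _,_; proj₁; proj₂; uncurry)
open import Data.Sum as Sum using (_⊎_; inj₁; inj₂)
open import Data.Sum.Properties using (inj₁-injective)
open import Data.Unit using (⊤; tt)
open import Data.Vec as Vec using (Vec) renaming ([] to []ᵥ; _∷_ to _∷ᵥ_)
open import Data.Vec.Properties using (lookup∘tabulate)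
open import Function using (_∘_; id)
open import Function.Bundles using (_⇔_; mk⇔)
open import Function.Definitions using (Injective)
open import Relation.Binary.Bundles using (Setoid)
open import Relation.Binary.Definitions using (tri<; tri≈; tri>)
open import Relation.Binary.PropositionalEquality as ≡ using (_≡_; _≢_)
open import Relation.Binary.Structures using (IsEquivalence)
open import Relation.Nullary using (¬_; Dec; yes; no; contradiction)
open import Relation.Nullary.Decidable using (⌊_⌋; decidable-stable; from-no; toWitness; ¬?; _×-dec_)
open import Tactic.RingSolver using (solve-∀)
open import Tactic.RingSolver.Core.AlmostCommutativeRing using (AlmostCommutativeRing; fromCommutativeRing)

-- Determinants

-- The multiplicity is defined by divisibility of polynomials over ℤ, without eigenvectors or real
-- roots, so the loss of at most one factor per deleted vertex stands in for Cauchy interlacing. The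
-- sum of squares is the place where symmetry of the matrix does the work of a real spectrum: for
-- other matrices the order of vanishing says little about minors.
--
-- Once the multiplicity has become the vanishing of integer minors, every bound is obtained by
-- exhibiting a minor that cannot vanish, through a congruence when its entries are known only up to
-- multiples, or by evaluation when they are known.
--
-- The other obstacle is that n is unbounded while the final checks must be finite. The twin formula
-- removes it: each of the ten polynomials is y^(n-5) times a polynomial of degree five whose
-- coefficients are affine in n. A claim that some quantity is nonzero for all n ≥ 16 then reduces
-- to comparing the signs of two integers.

module Determinant {c ℓ} (R : CommutativeRing c ℓ) where
  open CommutativeRing R
  open import Algebra.Properties.Semiring.Sum semiring
  open import Algebra.Properties.Ring ring
  open import Relation.Binary.Reasoning.Setoid setoid
  open import Algebra.Properties.CommutativeSemigroup *-commutativeSemigroup using () renaming (x∙yz≈y∙xz to x*yz≈y*xz)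
  open import Algebra.Properties.CommutativeSemigroup +-commutativeSemigroup using () renaming (x∙yz≈y∙xz to x+yz≈y+xz)

  Row : ℕ → Set c
  Row n = Fin n → Carrier

  Matrix : ℕ → Set c
  Matrix n = Fin n → Row n

  infixr 5 _▹_
  _▹_ : ∀ {m n} → Row m → (Fin n → Row m) → Fin (suc n) → Row m
  (a ▹ M) fz     = a
  (a ▹ M) (fs i) = M i

  -- Signs act by iterated negation, as `alt` does, so that `determinant` over polynomials matches
  -- `det` clause by clause in `det≡determinant`.
  sgn : ℕ → Carrier → Carrier
  sgn zero    x = x
  sgn (suc k) x = - sgn k x

  minor : ∀ {n} → Matrix (suc n) → Fin (suc n) → Matrix n
  minor M j i k = M (fs i) (punchIn j k)

  determinant : ∀ n → Matrix n → Carrier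
  determinant zero    M = 1#
  determinant (suc n) M = sum λ j → sgn (toℕ j) (M fz j * determinant n (minor M j))

  _ᵀ : ∀ {n} → Matrix n → Matrix n
  (M ᵀ) i j = M j i

  sgn-cong : ∀ k {x y} → x ≈ y → sgn k x ≈ sgn k y
  sgn-cong zero    e = e
  sgn-cong (suc k) e = -‿cong (sgn-cong k e)

  sgn-* : ∀ k x y → sgn k (x * y) ≈ x * sgn k y
  sgn-* zero    x y = refl
  sgn-* (suc k) x y = trans (-‿cong (sgn-* k x y)) (-‿distribʳ-* x (sgn k y))

  sgn-*ˡ : ∀ k x y → sgn k (x * y) ≈ sgn k x * y
  sgn-*ˡ zero    x y = refl
  sgn-*ˡ (suc k) x y = trans (-‿cong (sgn-*ˡ k x y)) (-‿distribˡ-* (sgn k x) y)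

  sgn-+ : ∀ k x y → sgn k (x + y) ≈ sgn k x + sgn k y
  sgn-+ zero    x y = refl
  sgn-+ (suc k) x y = trans (-‿cong (sgn-+ k x y)) (sym (-‿+-comm (sgn k x) (sgn k y)))

  sgn-0 : ∀ k → sgn k 0# ≈ 0#
  sgn-0 zero    = refl
  sgn-0 (suc k) = trans (-‿cong (sgn-0 k)) -0#≈0#

  sgn-neg : ∀ k x → sgn k (- x) ≈ - sgn k x
  sgn-neg zero    x = refl
  sgn-neg (suc k) x = -‿cong (sgn-neg k x)

  sgn-comm : ∀ j k x → sgn j (sgn k x) ≈ sgn k (sgn j x)
  sgn-comm zero    k x = refl
  sgn-comm (suc j) k x = trans (-‿cong (sgn-comm j k x)) (sym (sgn-neg k (sgn j x)))

  sgn-involutive : ∀ k x → sgn k (sgn k x) ≈ x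
  sgn-involutive zero    x = refl
  sgn-involutive (suc k) x = begin
    - sgn k (- sgn k x) ≈⟨ -‿cong (sgn-neg k (sgn k x)) ⟩
    - - sgn k (sgn k x) ≈⟨ -‿involutive _ ⟩
    sgn k (sgn k x)     ≈⟨ sgn-involutive k x ⟩
    x                   ∎

  sgn-sum : ∀ k {n} (f : Row n) → sgn k (sum f) ≈ sum λ i → sgn k (f i)
  sgn-sum k {zero}  f = sgn-0 k
  sgn-sum k {suc n} f = trans (sgn-+ k (f fz) _) (+-congˡ (sgn-sum k (f ∘ fs)))

  sum-cong : ∀ {n} {f g : Row n} → (∀ i → f i ≈ g i) → sum f ≈ sum g
  sum-cong = sum-cong-≋

  sum-zero : ∀ {n} {f : Row n} → (∀ i → f i ≈ 0#) → sum f ≈ 0#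
  sum-zero {n} e = trans (sum-cong e) (sum-replicate-zero n)

  det-cong : ∀ n {M N : Matrix n} → (∀ i j → M i j ≈ N i j) → determinant n M ≈ determinant n N
  det-cong zero    e = refl
  det-cong (suc n) e = sum-cong λ j → sgn-cong (toℕ j)
    (*-cong (e fz j) (det-cong n λ i k → e (fs i) (punchIn j k)))

  -- Expanding along the first row and then the first column is a symmetric process.
  private
    module Transpose n
      (ih₀ : (M : Matrix n) → determinant n (M ᵀ) ≈ determinant n M)
      (ih₁ : (M : Matrix (suc n)) → determinant (suc n) (M ᵀ) ≈ determinant (suc n) M) where

      corner : Matrix (suc (suc n)) → Carrier
      corner M = M fz fz * determinant (suc n) (minor M fz)

      core : Matrix (suc (suc n)) → Fin (suc n) → Fin (suc n) → Matrix n
      core M j i a b = M (fs (punchIn i a)) (fs (punchIn j b))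

      inner : Matrix (suc (suc n)) → Fin (suc n) → Fin (suc n) → Carrier
      inner M j i = M (fs i) fz * determinant n (core M j i)

      cross : Matrix (suc (suc n)) → Fin (suc n) → Fin (suc n) → Carrier
      cross M j i = sgn (suc (toℕ j)) (sgn (toℕ i) (M fz (fs j) * inner M j i))

      expandMinor : ∀ M j → determinant (suc n) (minor M (fs j)) ≈ sum (λ i → sgn (toℕ i) (inner M j i))
      expandMinor M j = trans (sym (ih₁ (minor M (fs j))))
        (sum-cong {f = λ i → sgn (toℕ i) (M (fs i) fz * determinant n (core M j i ᵀ))} {g = λ i → sgn (toℕ i) (inner M j i)}
          λ i → sgn-cong (toℕ i) (*-congˡ (ih₀ (core M j i))))

      expand : ∀ M → determinant (suc (suc n)) M ≈ corner M + sum (λ j → sum (λ i → cross M j i))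
      expand M = +-congˡ (sum-cong λ j → begin
        sgn (suc (toℕ j)) (M fz (fs j) * determinant (suc n) (minor M (fs j)))
          ≈⟨ sgn-cong (suc (toℕ j)) (*-congˡ (expandMinor M j)) ⟩
        sgn (suc (toℕ j)) (M fz (fs j) * sum (λ i → sgn (toℕ i) (inner M j i)))
          ≈⟨ sgn-cong (suc (toℕ j)) (*-distribˡ-sum (M fz (fs j)) (λ i → sgn (toℕ i) (inner M j i))) ⟩
        sgn (suc (toℕ j)) (sum (λ i → M fz (fs j) * sgn (toℕ i) (inner M j i)))
          ≈⟨ sgn-cong (suc (toℕ j)) (sum-cong λ i → sgn-* (toℕ i) (M fz (fs j)) (inner M j i)) ⟨
        sgn (suc (toℕ j)) (sum (λ i → sgn (toℕ i) (M fz (fs j) * inner M j i)))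
          ≈⟨ sgn-sum (suc (toℕ j)) (λ i → sgn (toℕ i) (M fz (fs j) * inner M j i)) ⟩
        sum (λ i → cross M j i) ∎)

      flip : ∀ M i j → cross M j i ≈ cross (M ᵀ) i j
      flip M i j = begin
        - sgn (toℕ j) (sgn (toℕ i) (M fz (fs j) * (M (fs i) fz * determinant n (core M j i))))
          ≈⟨ -‿cong (sgn-comm (toℕ j) (toℕ i) _) ⟩
        - sgn (toℕ i) (sgn (toℕ j) (M fz (fs j) * (M (fs i) fz * determinant n (core M j i))))
          ≈⟨ -‿cong (sgn-cong (toℕ i) (sgn-cong (toℕ j) (x*yz≈y*xz _ _ _))) ⟩
        - sgn (toℕ i) (sgn (toℕ j) (M (fs i) fz * (M fz (fs j) * determinant n (core M j i))))
          ≈⟨ -‿cong (sgn-cong (toℕ i) (sgn-cong (toℕ j) (*-congˡ (*-congˡ (ih₀ (core M j i)))))) ⟨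
        cross (M ᵀ) i j ∎

      step : ∀ M → determinant (suc (suc n)) (M ᵀ) ≈ determinant (suc (suc n)) M
      step M = sym (begin
        determinant (suc (suc n)) M
          ≈⟨ expand M ⟩
        corner M + sum (λ j → sum (λ i → cross M j i))
          ≈⟨ +-cong (*-congˡ (sym (ih₁ (minor M fz)))) (∑-comm (cross M)) ⟩
        corner (M ᵀ) + sum (λ i → sum (λ j → cross M j i))
          ≈⟨ +-congˡ (sum-cong λ i → sum-cong λ j → flip M i j) ⟩
        corner (M ᵀ) + sum (λ i → sum (λ j → cross (M ᵀ) i j))
          ≈⟨ expand (M ᵀ) ⟨
        determinant (suc (suc n)) (M ᵀ) ∎)

  det-transpose : ∀ n (M : Matrix n) → determinant n (M ᵀ) ≈ determinant n M
  det-transpose zero          M = refl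
  det-transpose (suc zero)    M = refl
  det-transpose (suc (suc n)) M = Transpose.step n (det-transpose n) (det-transpose (suc n)) M

  -- The pairs (j , punchIn j k) enumerate the ordered pairs of distinct columns;
  -- (punchIn j k , coPunch j k) codes the reversed pair.
  coPunch : ∀ {n} → Fin (suc n) → Fin n → Fin n
  coPunch {suc n} fz     k      = fz
  coPunch         (fs j) fz     = j
  coPunch         (fs j) (fs k) = fs (coPunch j k)

  punchIn-coPunch : ∀ {n} (j : Fin (suc n)) (k : Fin n) → punchIn (punchIn j k) (coPunch j k) ≡ j
  punchIn-coPunch {suc n} fz     k      = ≡.refl
  punchIn-coPunch         (fs j) fz     = ≡.refl
  punchIn-coPunch         (fs j) (fs k) = ≡.cong fs (punchIn-coPunch j k)

  punchIn-punchIn-coPunch : ∀ {n} (j : Fin (suc (suc n))) (k : Fin (suc n)) (l : Fin n) →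
    punchIn (punchIn j k) (punchIn (coPunch j k) l) ≡ punchIn j (punchIn k l)
  punchIn-punchIn-coPunch fz     k      l      = ≡.refl
  punchIn-punchIn-coPunch (fs j) fz     l      = ≡.refl
  punchIn-punchIn-coPunch (fs j) (fs k) fz     = ≡.refl
  punchIn-punchIn-coPunch (fs j) (fs k) (fs l) = ≡.cong fs (punchIn-punchIn-coPunch j k l)

  sgn-coPunch : ∀ {n} (j : Fin (suc n)) (k : Fin n) x →
    sgn (toℕ (punchIn j k)) (sgn (toℕ (coPunch j k)) x) ≈ - sgn (toℕ j) (sgn (toℕ k) x)
  sgn-coPunch {suc n} fz     k      x = refl
  sgn-coPunch         (fs j) fz     x = sym (-‿involutive _)
  sgn-coPunch         (fs j) (fs k) x = begin
    - sgn (toℕ (punchIn j k)) (- sgn (toℕ (coPunch j k)) x) ≈⟨ -‿cong (sgn-neg (toℕ (punchIn j k)) _) ⟩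
    - - sgn (toℕ (punchIn j k)) (sgn (toℕ (coPunch j k)) x) ≈⟨ -‿cong (-‿cong (sgn-coPunch j k x)) ⟩
    - - - sgn (toℕ j) (sgn (toℕ k) x)                       ≈⟨ -‿cong (-‿cong (sgn-neg (toℕ j) _)) ⟨
    - - sgn (toℕ j) (- sgn (toℕ k) x)                       ∎

  private
    split : ∀ {n} (F : Fin (suc (suc n)) → Fin (suc n) → Carrier) →
      sum (λ j → sum (F j)) ≈
      sum (F fz) + (sum (λ j → F (fs j) fz) + sum (λ j → sum (λ k → F (fs j) (fs k))))
    split F = +-congˡ (∑-distrib-+ (λ j → F (fs j) fz) (λ j → sum (λ k → F (fs j) (fs k))))

  -- Reversal permutes the ordered pairs of distinct columns: the pairs starting with column 0 and
  -- those ending with it trade places, and the recursion treats the pairs that avoid it.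
  sum-coPunch : ∀ {n} (F : Fin (suc n) → Fin n → Carrier) →
    sum (λ j → sum (F j)) ≈ sum (λ j → sum (λ k → F (punchIn j k) (coPunch j k)))
  sum-coPunch {zero}  F = refl
  sum-coPunch {suc n} F = begin
    sum (λ j → sum (F j))
      ≈⟨ split F ⟩
    sum (F fz) + (sum (λ j → F (fs j) fz) + sum (λ j → sum (λ k → F (fs j) (fs k))))
      ≈⟨ x+yz≈y+xz _ _ _ ⟩
    sum (λ j → F (fs j) fz) + (sum (F fz) + sum (λ j → sum (λ k → F (fs j) (fs k))))
      ≈⟨ +-congˡ (+-congˡ (sum-coPunch λ j k → F (fs j) (fs k))) ⟩
    sum (λ j → F (fs j) fz) + (sum (F fz) + sum (λ j → sum (λ k → F (fs (punchIn j k)) (fs (coPunch j k)))))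
      ≈⟨ split (λ j k → F (punchIn j k) (coPunch j k)) ⟨
    sum (λ j → sum (λ k → F (punchIn j k) (coPunch j k))) ∎

  -- Proved by recursion rather than from x ≈ - x, since 2 need not be cancellable.
  sum-antisymmetric : ∀ {n} (F : Fin (suc n) → Fin n → Carrier) →
    (∀ j k → F j k ≈ - F (punchIn j k) (coPunch j k)) → sum (λ j → sum (F j)) ≈ 0#
  sum-antisymmetric {zero}  F anti = +-identityˡ 0#
  sum-antisymmetric {suc n} F anti = begin
    sum (λ j → sum (F j))
      ≈⟨ split F ⟩
    sum (F fz) + (sum (λ j → F (fs j) fz) + sum (λ j → sum (λ k → F (fs j) (fs k))))
      ≈⟨ +-congˡ (+-congˡ (sum-antisymmetric (λ j k → F (fs j) (fs k)) (λ j k → anti (fs j) (fs k)))) ⟩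
    sum (F fz) + (sum (λ j → F (fs j) fz) + 0#)
      ≈⟨ +-congˡ (+-identityʳ _) ⟩
    sum (F fz) + sum (λ j → F (fs j) fz)
      ≈⟨ +-congˡ (sum-cong λ j → anti (fs j) fz) ⟩
    sum (F fz) + sum (λ j → - F fz j)
      ≈⟨ ∑-distrib-+ (F fz) (λ j → - F fz j) ⟨
    sum (λ j → F fz j + - F fz j)
      ≈⟨ sum-zero (λ j → -‿inverseʳ (F fz j)) ⟩
    0# ∎

  private
    term : ∀ {n} → (Fin (suc (suc n)) → Row (suc (suc n))) → Fin (suc (suc n)) → Fin (suc n) → Carrier
    term {n} M j k = sgn (toℕ j) (sgn (toℕ k) (M fz j * (M (fs fz) (punchIn j k) *
                       determinant n λ a b → M (fs (fs a)) (punchIn j (punchIn k b)))))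

    expand₂ : ∀ n (M : Matrix (suc (suc n))) → determinant (suc (suc n)) M ≈ sum λ j → sum (term M j)
    expand₂ n M = sum-cong λ j → begin
      sgn (toℕ j) (M fz j * sum (λ k → sgn (toℕ k) (P j k)))
        ≈⟨ sgn-cong (toℕ j) (*-distribˡ-sum (M fz j) (λ k → sgn (toℕ k) (P j k))) ⟩
      sgn (toℕ j) (sum (λ k → M fz j * sgn (toℕ k) (P j k)))
        ≈⟨ sgn-cong (toℕ j) (sum-cong λ k → sgn-* (toℕ k) (M fz j) (P j k)) ⟨
      sgn (toℕ j) (sum (λ k → sgn (toℕ k) (M fz j * P j k)))
        ≈⟨ sgn-sum (toℕ j) (λ k → sgn (toℕ k) (M fz j * P j k)) ⟩
      sum (term M j) ∎
      where
      P : Fin (suc (suc n)) → Fin (suc n) → Carrier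
      P j k = M (fs fz) (punchIn j k) * determinant n (λ a b → M (fs (fs a)) (punchIn j (punchIn k b)))

    term-coPunch : ∀ {n} (M : Matrix (suc (suc n))) j k →
      term M (punchIn j k) (coPunch j k) ≈
      - term (M (fs fz) ▹ M fz ▹ λ i → M (fs (fs i))) j k
    term-coPunch {n} M j k = trans (sgn-coPunch j k _) (-‿cong (sgn-cong (toℕ j) (sgn-cong (toℕ k) (begin
      M fz (punchIn j k) * (M (fs fz) (punchIn (punchIn j k) (coPunch j k)) * D (punchIn j k) (coPunch j k))
        ≈⟨ *-congˡ (*-cong (reflexive (≡.cong (M (fs fz)) (punchIn-coPunch j k)))
             (det-cong n λ a b → reflexive (≡.cong (M (fs (fs a))) (punchIn-punchIn-coPunch j k b)))) ⟩
      M fz (punchIn j k) * (M (fs fz) j * D j k)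
        ≈⟨ x*yz≈y*xz _ _ _ ⟩
      M (fs fz) j * (M fz (punchIn j k) * D j k) ∎))))
      where
      D : Fin (suc (suc n)) → Fin (suc n) → Carrier
      D j k = determinant n λ a b → M (fs (fs a)) (punchIn j (punchIn k b))

  -- In the double expansion along the first two rows, exchanging these rows reverses the pair of
  -- chosen columns, which costs exactly one sign by `sgn-coPunch`.
  det-swap₀₁ : ∀ n (M : Matrix (suc (suc n))) →
    determinant (suc (suc n)) (M (fs fz) ▹ M fz ▹ λ i → M (fs (fs i))) ≈ - determinant (suc (suc n)) M
  det-swap₀₁ n M = begin
    determinant (suc (suc n)) M′                              ≈⟨ expand₂ n M′ ⟩
    sum (λ j → sum (term M′ j))                               ≈⟨ -‿involutive _ ⟨
    - - sum (λ j → sum (term M′ j))                           ≈⟨ -‿cong (sgn-sum 1 λ j → sum (term M′ j)) ⟩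
    - sum (λ j → - sum (term M′ j))                           ≈⟨ -‿cong (sum-cong λ j → sgn-sum 1 (term M′ j)) ⟩
    - sum (λ j → sum (λ k → - term M′ j k))                   ≈⟨ -‿cong (sum-cong λ j → sum-cong λ k → term-coPunch M j k) ⟨
    - sum (λ j → sum (λ k → term M (punchIn j k) (coPunch j k))) ≈⟨ -‿cong (sum-coPunch (term M)) ⟨
    - sum (λ j → sum (term M j))                              ≈⟨ -‿cong (expand₂ n M) ⟨
    - determinant (suc (suc n)) M                             ∎
    where
    M′ : Matrix (suc (suc n))
    M′ = M (fs fz) ▹ M fz ▹ λ i → M (fs (fs i))

  det-equal₀₁ : ∀ n (M : Matrix (suc (suc n))) → (∀ j → M fz j ≈ M (fs fz) j) →
    determinant (suc (suc n)) M ≈ 0#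
  det-equal₀₁ n M eq = trans (expand₂ n M) (sum-antisymmetric (term M) λ j k → begin
    term M j k                                             ≈⟨ sgn-cong (toℕ j) (sgn-cong (toℕ k)
                                                               (*-cong (eq j) (*-congʳ (sym (eq (punchIn j k)))))) ⟩
    term (M (fs fz) ▹ M fz ▹ λ i → M (fs (fs i))) j k      ≈⟨ -‿involutive _ ⟨
    - - term (M (fs fz) ▹ M fz ▹ λ i → M (fs (fs i))) j k  ≈⟨ -‿cong (term-coPunch M j k) ⟨
    - term M (punchIn j k) (coPunch j k)                   ∎)

  toFront : ∀ {n} → Fin (suc n) → Fin (suc n) → Fin (suc n)
  toFront p fz     = p
  toFront p (fs i) = punchIn p i

  -- The recursion brings the row to second place inside every minor, and one exchange brings it to
  -- first. A cycle is used instead of a transposition because it keeps the other rows in the order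
  -- of `punchIn p`, as the deletion of a vertex requires.
  det-toFront : ∀ n (p : Fin (suc n)) (M : Matrix (suc n)) →
    determinant (suc n) (M ∘ toFront p) ≈ sgn (toℕ p) (determinant (suc n) M)
  det-toFront n       fz     M = refl
  det-toFront (suc n) (fs p) M = begin
    determinant (suc (suc n)) (M ∘ toFront (fs p))
      ≈⟨ det-cong (suc (suc n)) {M ∘ toFront (fs p)} {N (fs fz) ▹ N fz ▹ λ i → N (fs (fs i))}
           (λ { fz j → refl ; (fs fz) j → refl ; (fs (fs i)) j → refl }) ⟩
    determinant (suc (suc n)) (N (fs fz) ▹ N fz ▹ λ i → N (fs (fs i)))
      ≈⟨ det-swap₀₁ n N ⟩
    - determinant (suc (suc n)) N
      ≈⟨ -‿cong (sum-cong {f = λ j → sgn (toℕ j) (M fz j * determinant (suc n) (minor M j ∘ toFront p))}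
                          λ j → sgn-cong (toℕ j) (*-congˡ (det-toFront n p (minor M j)))) ⟩
    - sum (λ j → sgn (toℕ j) (M fz j * sgn (toℕ p) (determinant (suc n) (minor M j))))
      ≈⟨ -‿cong (sum-cong λ j → sgn-cong (toℕ j) (sgn-* (toℕ p) (M fz j) (determinant (suc n) (minor M j)))) ⟨
    - sum (λ j → sgn (toℕ j) (sgn (toℕ p) (M fz j * determinant (suc n) (minor M j))))
      ≈⟨ -‿cong (sum-cong λ j → sgn-comm (toℕ j) (toℕ p) (M fz j * determinant (suc n) (minor M j))) ⟩
    - sum (λ j → sgn (toℕ p) (sgn (toℕ j) (M fz j * determinant (suc n) (minor M j))))
      ≈⟨ -‿cong (sgn-sum (toℕ p) λ j → sgn (toℕ j) (M fz j * determinant (suc n) (minor M j))) ⟨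
    - sgn (toℕ p) (determinant (suc (suc n)) M) ∎
    where
    N : Matrix (suc (suc n))
    N = M fz ▹ λ i → M (fs (toFront p i))

  det-equal₀ : ∀ n (M : Matrix (suc n)) i → (∀ j → M fz j ≈ M (fs i) j) → determinant (suc n) M ≈ 0#
  det-equal₀ (suc n) M i eq = begin
    determinant (suc (suc n)) M
      ≈⟨ sgn-involutive (toℕ (fs i)) _ ⟨
    sgn (toℕ (fs i)) (sgn (toℕ (fs i)) (determinant (suc (suc n)) M))
      ≈⟨ sgn-cong (toℕ (fs i)) (det-toFront (suc n) (fs i) M) ⟨
    sgn (toℕ (fs i)) (determinant (suc (suc n)) (M ∘ toFront (fs i)))
      ≈⟨ sgn-cong (toℕ (fs i)) (det-equal₀₁ n (M ∘ toFront (fs i)) (λ j → sym (eq j))) ⟩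
    sgn (toℕ (fs i)) 0#
      ≈⟨ sgn-0 (toℕ (fs i)) ⟩
    0# ∎

  cofactor : ∀ {n} → Matrix (suc n) → Row (suc n)
  cofactor {n} M j = sgn (toℕ j) (determinant n (minor M j))

  det-cofactor : ∀ n (M : Matrix (suc n)) → sum (λ j → M fz j * cofactor M j) ≈ determinant (suc n) M
  det-cofactor n M = sum-cong λ j → sym (sgn-* (toℕ j) (M fz j) (determinant n (minor M j)))

  -- The sum expands the matrix whose first row has been replaced by a copy of a later one; the
  -- cofactors of the first row do not see that change.
  cofactor-orthogonal : ∀ n (M : Matrix (suc n)) i → sum (λ j → M (fs i) j * cofactor M j) ≈ 0#
  cofactor-orthogonal n M i = trans (det-cofactor n (M (fs i) ▹ M ∘ fs)) (det-equal₀ n (M (fs i) ▹ M ∘ fs) i λ j → refl)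

  det-linear₀ : ∀ n (a b : Row (suc n)) c (M : Fin n → Row (suc n)) →
    determinant (suc n) ((λ j → a j + c * b j) ▹ M) ≈ determinant (suc n) (a ▹ M) + c * determinant (suc n) (b ▹ M)
  det-linear₀ n a b c M = begin
    sum (λ j → sgn (toℕ j) ((a j + c * b j) * D j))
      ≈⟨ sum-cong (λ j → sgn-cong (toℕ j) (expand (a j) c (b j) (D j))) ⟩
    sum (λ j → sgn (toℕ j) (a j * D j + c * (b j * D j)))
      ≈⟨ sum-cong (λ j → trans (sgn-+ (toℕ j) (a j * D j) (c * (b j * D j))) (+-congˡ (sgn-* (toℕ j) c (b j * D j)))) ⟩
    sum (λ j → sgn (toℕ j) (a j * D j) + c * sgn (toℕ j) (b j * D j))
      ≈⟨ ∑-distrib-+ (λ j → sgn (toℕ j) (a j * D j)) (λ j → c * sgn (toℕ j) (b j * D j)) ⟩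
    sum (λ j → sgn (toℕ j) (a j * D j)) + sum (λ j → c * sgn (toℕ j) (b j * D j))
      ≈⟨ +-congˡ (*-distribˡ-sum c (λ j → sgn (toℕ j) (b j * D j))) ⟨
    sum (λ j → sgn (toℕ j) (a j * D j)) + c * sum (λ j → sgn (toℕ j) (b j * D j)) ∎
    where
    D : Fin (suc n) → Carrier
    D j = determinant n λ i k → M i (punchIn j k)
    expand : ∀ a c b d → (a + c * b) * d ≈ a * d + c * (b * d)
    expand a c b d = trans (distribʳ d a (c * b)) (+-congˡ (*-assoc c b d))

  det-addRow : ∀ n c (M : Matrix (suc (suc n))) →
    determinant (suc (suc n)) ((λ j → M fz j + c * M (fs fz) j) ▹ M ∘ fs) ≈ determinant (suc (suc n)) M
  det-addRow n c M = begin
    determinant (suc (suc n)) ((λ j → M fz j + c * M (fs fz) j) ▹ M ∘ fs)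
      ≈⟨ det-linear₀ (suc n) (M fz) (M (fs fz)) c (M ∘ fs) ⟩
    determinant (suc (suc n)) M + c * determinant (suc (suc n)) (M (fs fz) ▹ M ∘ fs)
      ≈⟨ +-congˡ (trans (*-congˡ (det-equal₀₁ n (M (fs fz) ▹ M ∘ fs) λ j → refl)) (zeroʳ c)) ⟩
    determinant (suc (suc n)) M + 0#
      ≈⟨ +-identityʳ _ ⟩
    determinant (suc (suc n)) M ∎

  RowSign : ∀ n → (Fin n → Fin n) → ℕ → Set _
  RowSign n ρ k = ∀ M → determinant n (M ∘ ρ) ≈ sgn k (determinant n M)

  -- Rows and columns each contribute the same sign, so it cancels.
  det-conjugate : ∀ n {ρ k} → RowSign n ρ k → ∀ M → determinant n (λ i j → M (ρ i) (ρ j)) ≈ determinant n M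
  det-conjugate n {ρ} {k} rs M = begin
    determinant n (λ i j → M (ρ i) (ρ j))             ≈⟨ rs (λ i j → M i (ρ j)) ⟩
    sgn k (determinant n (λ i j → M i (ρ j)))         ≈⟨ sgn-cong k (det-transpose n (λ i j → M i (ρ j))) ⟨
    sgn k (determinant n (λ i j → M j (ρ i)))         ≈⟨ sgn-cong k (rs (M ᵀ)) ⟩
    sgn k (sgn k (determinant n (M ᵀ)))               ≈⟨ sgn-involutive k _ ⟩
    determinant n (M ᵀ)                               ≈⟨ det-transpose n M ⟩
    determinant n M                                   ∎

  -- The parity stays hidden in some exponent, because `det-conjugate` squares it. The permutation
  -- factors into the cycle that brings the image of 0 to the front and the remaining permutation,
  -- which acts inside the minors.
  permutation-sign : ∀ n (π : Permutation n n) → ∃ (RowSign n (π ⟨$⟩ʳ_))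
  permutation-sign zero    π = 0 , λ M → refl
  permutation-sign (suc n) π with permutation-sign n (Perm.remove fz π)
  ... | k , rs = k ℕ.+ toℕ p , λ M → begin
    determinant (suc n) (M ∘ (π ⟨$⟩ʳ_))
      ≈⟨ det-cong (suc n) {M ∘ (π ⟨$⟩ʳ_)} {M p ▹ λ i → M (punchIn p (Perm.remove fz π ⟨$⟩ʳ i))}
           (λ { fz j → refl ; (fs i) j → reflexive (≡.cong (λ a → M a j) (Perm.punchIn-permute π fz i)) }) ⟩
    determinant (suc n) (M p ▹ λ i → M (punchIn p (Perm.remove fz π ⟨$⟩ʳ i)))
      ≈⟨ sum-cong (λ j → trans (sgn-cong (toℕ j) (trans (*-congˡ (rs (minor (M ∘ toFront p) j)))
           (sym (sgn-* k (M p j) (determinant n (minor (M ∘ toFront p) j))))))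
           (sgn-comm (toℕ j) k (M p j * determinant n (minor (M ∘ toFront p) j)))) ⟩
    sum (λ j → sgn k (sgn (toℕ j) (M p j * determinant n (minor (M ∘ toFront p) j))))
      ≈⟨ sgn-sum k (λ j → sgn (toℕ j) (M p j * determinant n (minor (M ∘ toFront p) j))) ⟨
    sgn k (determinant (suc n) (M ∘ toFront p))
      ≈⟨ sgn-cong k (det-toFront n p M) ⟩
    sgn k (sgn (toℕ p) (determinant (suc n) M))
      ≈⟨ sgn-sgn k (toℕ p) _ ⟩
    sgn (k ℕ.+ toℕ p) (determinant (suc n) M) ∎
    where
    p = π ⟨$⟩ʳ fz
    sgn-sgn : ∀ j k x → sgn j (sgn k x) ≈ sgn (j ℕ.+ k) x
    sgn-sgn zero    k x = refl
    sgn-sgn (suc j) k x = -‿cong (sgn-sgn j k x)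

  det-permute : ∀ n (π : Permutation n n) (M : Matrix n) →
    determinant n (λ i j → M (π ⟨$⟩ʳ i) (π ⟨$⟩ʳ j)) ≈ determinant n M
  det-permute n π with k , rs ← permutation-sign n π = det-conjugate n {π ⟨$⟩ʳ_} {k} rs

  det-oneTerm : ∀ n (M : Matrix (suc n)) → (∀ j → M fz (fs j) ≈ 0#) →
    determinant (suc n) M ≈ M fz fz * determinant n (minor M fz)
  det-oneTerm n M z = trans (+-congˡ (sum-zero {n} {λ j → sgn (toℕ (fs j)) (M fz (fs j) * determinant n (minor M (fs j)))}
    λ j → trans (sgn-cong (toℕ (fs j)) (trans (*-congʳ (z j)) (zeroˡ _))) (sgn-0 (toℕ (fs j))))) (+-identityʳ _)

  det-twoTerm : ∀ n (M : Matrix (suc (suc n))) → (∀ j → M fz (fs (fs j)) ≈ 0#) →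
    determinant (suc (suc n)) M ≈
    M fz fz * determinant (suc n) (minor M fz) + - (M fz (fs fz) * determinant (suc n) (minor M (fs fz)))
  det-twoTerm n M z = +-congˡ (trans (+-congˡ (sum-zero {n} {λ j → sgn (toℕ (fs (fs j))) (M fz (fs (fs j)) * determinant (suc n) (minor M (fs (fs j))))}
    λ j → trans (sgn-cong (toℕ (fs (fs j))) (trans (*-congʳ (z j)) (zeroˡ _))) (sgn-0 (toℕ (fs (fs j)))))) (+-identityʳ _))

  -- Subtracting the second row and column from the first leaves only a 2 × 2 corner to expand.
  det-twins : ∀ n (M : Matrix (suc (suc n))) t →
    M fz fz - M (fs fz) fz ≈ t → M fz (fs fz) - M (fs fz) (fs fz) ≈ - t →
    (∀ j → M fz (fs (fs j)) ≈ M (fs fz) (fs (fs j))) → (∀ i → M (fs (fs i)) fz ≈ M (fs (fs i)) (fs fz)) →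
    M (fs fz) fz - M (fs fz) (fs fz) ≈ - t →
    determinant (suc (suc n)) M ≈
    (t + t) * determinant (suc n) (minor M fz) - t * (t * determinant n (λ i j → M (fs (fs i)) (fs (fs j))))
  det-twins n M t e₀₀ e₀₁ rows cols e₁₀ = begin
    determinant (suc (suc n)) M
      ≈⟨ det-addRow n (- 1#) M ⟨
    determinant (suc (suc n)) (a ▹ M ∘ fs)
      ≈⟨ det-transpose (suc (suc n)) (a ▹ M ∘ fs) ⟨
    determinant (suc (suc n)) ((a ▹ M ∘ fs) ᵀ)
      ≈⟨ det-addRow n (- 1#) ((a ▹ M ∘ fs) ᵀ) ⟨
    determinant (suc (suc n)) T
      ≈⟨ det-twoTerm n T (λ j → minus (cols j)) ⟩
    T fz fz * determinant (suc n) (minor T fz) + - (T fz (fs fz) * determinant (suc n) (minor T (fs fz)))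
      ≈⟨ +-cong (*-cong T₀₀ (det-transpose (suc n) (minor M fz))) (-‿cong (*-cong T₀₁ second)) ⟩
    (t + t) * determinant (suc n) (minor M fz) + - (- t * (- t * D))
      ≈⟨ +-congˡ (-‿cong (trans (*-congˡ (sym (-‿distribˡ-* t D))) (trans (sym (-‿distribˡ-* t _)) (trans (-‿cong (sym (-‿distribʳ-* t _))) (-‿involutive _))))) ⟩
    (t + t) * determinant (suc n) (minor M fz) + - (t * (t * D)) ∎
    where
    D : Carrier
    D = determinant n (λ i j → M (fs (fs i)) (fs (fs j)))
    a : Row (suc (suc n))
    a j = M fz j + - 1# * M (fs fz) j
    T : Matrix (suc (suc n))
    T = (λ j → ((a ▹ M ∘ fs) ᵀ) fz j + - 1# * ((a ▹ M ∘ fs) ᵀ) (fs fz) j) ▹ ((a ▹ M ∘ fs) ᵀ) ∘ fs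

    minus : ∀ {x y} → x ≈ y → x + - 1# * y ≈ 0#
    minus {x} {y} e = trans (+-cong e (-1*x≈-x y)) (-‿inverseʳ y)

    a₀ : a fz ≈ t
    a₀ = trans (+-congˡ (-1*x≈-x _)) e₀₀
    a₁ : a (fs fz) ≈ - t
    a₁ = trans (+-congˡ (-1*x≈-x _)) e₀₁

    T₀₀ : T fz fz ≈ t + t
    T₀₀ = +-cong a₀ (trans (*-congˡ a₁) (trans (-1*x≈-x _) (-‿involutive t)))
    T₀₁ : T fz (fs fz) ≈ - t
    T₀₁ = trans (+-congˡ (-1*x≈-x _)) e₁₀

    second : determinant (suc n) (minor T (fs fz)) ≈ - t * D
    second = begin
      determinant (suc n) (minor T (fs fz))             ≈⟨ det-transpose (suc n) (minor T (fs fz)) ⟨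
      determinant (suc n) (minor T (fs fz) ᵀ)           ≈⟨ det-oneTerm n (minor T (fs fz) ᵀ) (λ j → minus (rows j)) ⟩
      a (fs fz) * D                                     ≈⟨ *-congʳ a₁ ⟩
      - t * D                                           ∎

-- Polynomials over ℤ

-- A record copy of _≈ₚ_, whose sides Agda can infer.
infix 4 _≋_
record _≋_ (p q : Poly) : Set where
  constructor mk
  field at : p ≈ₚ q
open _≋_ public

≋-isEquivalence : IsEquivalence _≋_
≋-isEquivalence = record
  { refl  = mk λ _ → ≡.refl
  ; sym   = λ e → mk λ i → ≡.sym (at e i)
  ; trans = λ e f → mk λ i → ≡.trans (at e i) (at f i)
  }

coeff-zero : ∀ i → coeff (+ 0 ∷ []) i ≡ + 0
coeff-zero zero    = ≡.refl
coeff-zero (suc i) = ≡.refl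

coeff-+ : ∀ p q i → coeff (p +ₚ q) i ≡ coeff p i ℤ.+ coeff q i
coeff-+ []      q       i       = ≡.sym (ℤₚ.+-identityˡ _)
coeff-+ (a ∷ p) []      i       = ≡.sym (ℤₚ.+-identityʳ _)
coeff-+ (a ∷ p) (b ∷ q) zero    = ≡.refl
coeff-+ (a ∷ p) (b ∷ q) (suc i) = coeff-+ p q i

coeff-neg : ∀ p i → coeff (negₚ p) i ≡ ℤ.- coeff p i
coeff-neg []      i       = ≡.refl
coeff-neg (a ∷ p) zero    = ≡.refl
coeff-neg (a ∷ p) (suc i) = coeff-neg p i

coeff-scale : ∀ k p i → coeff (map (k ℤ.*_) p) i ≡ k ℤ.* coeff p i
coeff-scale k []      i       = ≡.sym (ℤₚ.*-zeroʳ k)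
coeff-scale k (a ∷ p) zero    = ≡.refl
coeff-scale k (a ∷ p) (suc i) = coeff-scale k p i

≋-setoid : Setoid _ _
≋-setoid = record { isEquivalence = ≋-isEquivalence }

private
  module PolyLaws where
    open IsEquivalence ≋-isEquivalence
    open import Relation.Binary.Reasoning.Setoid ≋-setoid

    infixl 22 _·_
    infix 21 x·_
    _·_ : ℤ → Poly → Poly
    k · p = map (k ℤ.*_) p

    x·_ : Poly → Poly
    x· p = + 0 ∷ p

    cons-cong : ∀ {a b p q} → a ≡ b → p ≋ q → (a ∷ p) ≋ (b ∷ q)
    cons-cong a≡b p≋q = mk λ { zero → a≡b ; (suc i) → at p≋q i }

    x·-0 : x· [] ≋ []
    x·-0 = mk λ { zero → ≡.refl ; (suc i) → ≡.refl }

    +-cong : ∀ {p p′ q q′} → p ≋ p′ → q ≋ q′ → (p +ₚ q) ≋ (p′ +ₚ q′)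
    +-cong {p} {p′} {q} {q′} e f = mk λ i →
      ≡.trans (coeff-+ p q i) (≡.trans (≡.cong₂ ℤ._+_ (at e i) (at f i)) (≡.sym (coeff-+ p′ q′ i)))

    +-congˡ : ∀ {p q q′} → q ≋ q′ → (p +ₚ q) ≋ (p +ₚ q′)
    +-congˡ {p} = +-cong {p} refl

    +-comm : ∀ p q → (p +ₚ q) ≋ (q +ₚ p)
    +-comm p q = mk λ i → ≡.trans (coeff-+ p q i) (≡.trans (ℤₚ.+-comm (coeff p i) _) (≡.sym (coeff-+ q p i)))

    +-assoc : ∀ p q r → ((p +ₚ q) +ₚ r) ≋ (p +ₚ (q +ₚ r))
    +-assoc p q r = mk λ i →
      ≡.trans (coeff-+ (p +ₚ q) r i) (≡.trans (≡.cong (ℤ._+ coeff r i) (coeff-+ p q i))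
      (≡.trans (ℤₚ.+-assoc (coeff p i) _ _) (≡.sym (≡.trans (coeff-+ p (q +ₚ r) i) (≡.cong (λ z → coeff p i ℤ.+ z) (coeff-+ q r i))))))

    +-identityʳ : ∀ p → (p +ₚ []) ≋ p
    +-identityʳ []      = refl
    +-identityʳ (a ∷ p) = refl

    +-swap : ∀ p q r → (p +ₚ (q +ₚ r)) ≋ (q +ₚ (p +ₚ r))
    +-swap p q r = trans (sym (+-assoc p q r)) (trans (+-cong {p +ₚ q} (+-comm p q) refl) (+-assoc q p r))

    +-interchange : ∀ p q r s → ((p +ₚ q) +ₚ (r +ₚ s)) ≋ ((p +ₚ r) +ₚ (q +ₚ s))
    +-interchange p q r s = trans (+-assoc p q (r +ₚ s))
      (trans (+-congˡ {p} (+-swap q r s)) (sym (+-assoc p r (q +ₚ s))))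

    neg-cong : ∀ {p q} → p ≋ q → negₚ p ≋ negₚ q
    neg-cong {p} {q} e = mk λ i → ≡.trans (coeff-neg p i) (≡.trans (≡.cong ℤ.-_ (at e i)) (≡.sym (coeff-neg q i)))

    neg-inverseˡ : ∀ p → (negₚ p +ₚ p) ≋ []
    neg-inverseˡ p = mk λ i →
      ≡.trans (coeff-+ (negₚ p) p i) (≡.trans (≡.cong (ℤ._+ coeff p i) (coeff-neg p i)) (ℤₚ.+-inverseˡ (coeff p i)))

    ·-cong : ∀ k {p q} → p ≋ q → k · p ≋ k · q
    ·-cong k {p} {q} e = mk λ i → ≡.trans (coeff-scale k p i) (≡.trans (≡.cong (k ℤ.*_) (at e i)) (≡.sym (coeff-scale k q i)))

    ·-+ : ∀ k p q → k · (p +ₚ q) ≋ (k · p +ₚ k · q)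
    ·-+ k p q = mk λ i → ≡.trans (coeff-scale k (p +ₚ q) i) (≡.trans (≡.cong (k ℤ.*_) (coeff-+ p q i))
      (≡.trans (ℤₚ.*-distribˡ-+ k (coeff p i) _) (≡.sym (≡.trans (coeff-+ (k · p) (k · q) i)
      (≡.cong₂ ℤ._+_ (coeff-scale k p i) (coeff-scale k q i))))))

    ·-· : ∀ j k p → j · (k · p) ≋ (j ℤ.* k) · p
    ·-· j k p = mk λ i → ≡.trans (coeff-scale j (k · p) i) (≡.trans (≡.cong (j ℤ.*_) (coeff-scale k p i))
      (≡.trans (≡.sym (ℤₚ.*-assoc j k (coeff p i))) (≡.sym (coeff-scale (j ℤ.* k) p i))))

    0· : ∀ p → (+ 0) · p ≋ []
    0· p = mk λ i → ≡.trans (coeff-scale (+ 0) p i) (ℤₚ.*-zeroˡ (coeff p i))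

    1· : ∀ p → (+ 1) · p ≋ p
    1· p = mk λ i → ≡.trans (coeff-scale (+ 1) p i) (ℤₚ.*-identityˡ (coeff p i))

    *-congˡ : ∀ p {q q′} → q ≋ q′ → (p *ₚ q) ≋ (p *ₚ q′)
    *-congˡ []      e = refl
    *-congˡ (a ∷ p) e = +-cong (·-cong a e) (cons-cong ≡.refl (*-congˡ p e))

    *-zeroʳ : ∀ p → (p *ₚ []) ≋ []
    *-zeroʳ []      = refl
    *-zeroʳ (a ∷ p) = trans (cons-cong ≡.refl (*-zeroʳ p)) x·-0

    *-consʳ : ∀ p b q → (p *ₚ (b ∷ q)) ≋ (b · p +ₚ x· (p *ₚ q))
    *-consʳ []      b q = sym x·-0
    *-consʳ (a ∷ p) b q = cons-cong (≡.cong (ℤ._+ + 0) (ℤₚ.*-comm a b)) (begin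
      a · q +ₚ (p *ₚ (b ∷ q))             ≈⟨ +-congˡ {a · q} (*-consʳ p b q) ⟩
      a · q +ₚ (b · p +ₚ x· (p *ₚ q))       ≈⟨ +-swap (a · q) (b · p) _ ⟩
      b · p +ₚ (a · q +ₚ x· (p *ₚ q))       ∎)

    *-comm : ∀ p q → (p *ₚ q) ≋ (q *ₚ p)
    *-comm []      q = sym (*-zeroʳ q)
    *-comm (a ∷ p) q = trans (+-congˡ {a · q} (cons-cong ≡.refl (*-comm p q))) (sym (*-consʳ q a p))

    *-distribˡ : ∀ p q r → (p *ₚ (q +ₚ r)) ≋ ((p *ₚ q) +ₚ (p *ₚ r))
    *-distribˡ []      q r = refl
    *-distribˡ (a ∷ p) q r = trans
      (+-cong (·-+ a q r) (cons-cong {+ 0} {+ 0 ℤ.+ + 0} ≡.refl (*-distribˡ p q r)))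
      (+-interchange (a · q) (a · r) (x· (p *ₚ q)) (x· (p *ₚ r)))

    *-cong : ∀ {p p′ q q′} → p ≋ p′ → q ≋ q′ → (p *ₚ q) ≋ (p′ *ₚ q′)
    *-cong {p} {p′} {q} {q′} e f =
      trans (*-congˡ p f) (trans (*-comm p q′) (trans (*-congˡ q′ e) (*-comm q′ p′)))

    *-distribʳ : ∀ p q r → ((q +ₚ r) *ₚ p) ≋ ((q *ₚ p) +ₚ (r *ₚ p))
    *-distribʳ p q r = trans (*-comm (q +ₚ r) p) (trans (*-distribˡ p q r) (+-cong (*-comm p q) (*-comm p r)))

    x·-* : ∀ p q → ((x· p) *ₚ q) ≋ (x· (p *ₚ q))
    x·-* p q = +-cong (0· q) refl

    ·-* : ∀ k p q → ((k · p) *ₚ q) ≋ k · (p *ₚ q)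
    ·-* k []      q = refl
    ·-* k (a ∷ p) q = trans
      (+-cong (sym (·-· k a q)) (cons-cong (≡.sym (ℤₚ.*-zeroʳ k)) (·-* k p q)))
      (sym (·-+ k (a · q) (x· (p *ₚ q))))

    *-assoc : ∀ p q r → ((p *ₚ q) *ₚ r) ≋ (p *ₚ (q *ₚ r))
    *-assoc []      q r = refl
    *-assoc (a ∷ p) q r = trans (*-distribʳ r (a · q) (x· (p *ₚ q)))
      (+-cong (·-* a q r) (trans (x·-* (p *ₚ q) r) (cons-cong ≡.refl (*-assoc p q r))))

    *-identityˡ : ∀ p → ((+ 1 ∷ []) *ₚ p) ≋ p
    *-identityˡ p = trans (+-cong (1· p) x·-0) (+-identityʳ p)

    isCommutativeRing : IsCommutativeRing _≋_ _+ₚ_ _*ₚ_ negₚ [] (+ 1 ∷ [])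
    isCommutativeRing = record
      { isRing = record
        { +-isAbelianGroup = record
          { isGroup = record
            { isMonoid = record
              { isSemigroup = record
                { isMagma = record { isEquivalence = ≋-isEquivalence ; ∙-cong = +-cong }
                ; assoc = +-assoc }
              ; identity = (λ p → refl) , +-identityʳ }
            ; inverse = neg-inverseˡ , λ p → trans (+-comm p (negₚ p)) (neg-inverseˡ p)
            ; ⁻¹-cong = neg-cong }
          ; comm = +-comm }
        ; *-cong = *-cong
        ; *-assoc = *-assoc
        ; *-identity = *-identityˡ , λ p → trans (*-comm p _) (*-identityˡ p)
        ; distrib = *-distribˡ , *-distribʳ }
      ; *-comm = *-comm }

polyRing : CommutativeRing _ _
polyRing = record { isCommutativeRing = PolyLaws.isCommutativeRing }

cons-≋ : ∀ a p → (a ∷ p) ≋ ((a ∷ []) +ₚ ((+ 0 ∷ + 1 ∷ []) *ₚ p))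
cons-≋ a p = begin
  a ∷ p                                        ≈⟨ cons-cong (≡.sym (ℤₚ.+-identityʳ a)) refl ⟩
  ((a ∷ []) +ₚ (x· p))                         ≈⟨ +-congˡ {a ∷ []} (cons-cong ≡.refl (*-identityˡ p)) ⟨
  ((a ∷ []) +ₚ (x· ((+ 1 ∷ []) *ₚ p)))         ≈⟨ +-congˡ {a ∷ []} (x·-* (+ 1 ∷ []) p) ⟨
  ((a ∷ []) +ₚ ((x· (+ 1 ∷ [])) *ₚ p))         ∎
  where
  open PolyLaws
  open IsEquivalence ≋-isEquivalence
  open import Relation.Binary.Reasoning.Setoid ≋-setoid

-- Ring homomorphisms and evaluation of polynomials

module RingHom {a b ℓ m} (R : CommutativeRing a ℓ) (S : CommutativeRing b m) where
  private
    module R = CommutativeRing R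
    module S = CommutativeRing S
    module Rᴰ = Determinant R
    module Sᴰ = Determinant S
  open RingMorphisms R.rawRing S.rawRing using (IsRingHomomorphism)
  open import Algebra.Properties.Semiring.Sum R.semiring using () renaming (sum to sumᴿ)
  open import Algebra.Properties.Semiring.Sum S.semiring using () renaming (sum to sumˢ)

  module Properties {φ : R.Carrier → S.Carrier} (hom : IsRingHomomorphism φ) where
    open IsRingHomomorphism hom

    sum-homo : ∀ {n} (f : Fin n → R.Carrier) → φ (sumᴿ f) S.≈ sumˢ (φ ∘ f)
    sum-homo {zero}  f = 0#-homo
    sum-homo {suc n} f = S.trans (+-homo _ _) (S.+-congˡ (sum-homo (f ∘ fs)))

    sgn-homo : ∀ k x → φ (Rᴰ.sgn k x) S.≈ Sᴰ.sgn k (φ x)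
    sgn-homo zero    x = S.refl
    sgn-homo (suc k) x = S.trans (-‿homo _) (S.-‿cong (sgn-homo k x))

    det-homo : ∀ n M → φ (Rᴰ.determinant n M) S.≈ Sᴰ.determinant n (λ i j → φ (M i j))
    det-homo zero    M = 1#-homo
    det-homo (suc n) M = S.trans
      (sum-homo (λ j → Rᴰ.sgn (toℕ j) (M fz j R.* Rᴰ.determinant n (Rᴰ.minor M j))))
      (Sᴰ.sum-cong λ j → S.trans (sgn-homo (toℕ j) (M fz j R.* Rᴰ.determinant n (Rᴰ.minor M j)))
        (Sᴰ.sgn-cong (toℕ j) (S.trans (*-homo _ _) (S.*-congˡ (det-homo n (Rᴰ.minor M j))))))

-- The target ring is arbitrary because evaluation serves twice: at -1 in ℤ it is the value at y =
-- 0, and at -2 - x among the polynomials it is the substitution y ↦ - y.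
module Evaluation {a ℓ} (R : CommutativeRing a ℓ) (ι : ℤ → CommutativeRing.Carrier R)
  (ι-hom : RingMorphisms.IsRingHomomorphism (CommutativeRing.rawRing ℤₚ.+-*-commutativeRing) (CommutativeRing.rawRing R) ι)
  (c : CommutativeRing.Carrier R) where
  open CommutativeRing R
  open RingMorphisms (CommutativeRing.rawRing ℤₚ.+-*-commutativeRing) rawRing using (IsRingHomomorphism)
  open IsRingHomomorphism ι-hom
  open import Algebra.Properties.Ring ring
  open import Algebra.Properties.CommutativeSemigroup +-commutativeSemigroup using (interchange)
  open import Algebra.Properties.CommutativeSemigroup *-commutativeSemigroup using (x∙yz≈y∙xz)
  open import Relation.Binary.Reasoning.Setoid setoid
  private module P = CommutativeRing polyRing

  eval : Poly → Carrier
  eval []      = 0#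
  eval (k ∷ p) = ι k + c * eval p

  eval-+ : ∀ p q → eval (p +ₚ q) ≈ eval p + eval q
  eval-+ []      q       = sym (+-identityˡ _)
  eval-+ (j ∷ p) []      = sym (+-identityʳ _)
  eval-+ (j ∷ p) (k ∷ q) = begin
    ι (j ℤ.+ k) + c * eval (p +ₚ q)              ≈⟨ +-cong (+-homo j k) (*-congˡ (eval-+ p q)) ⟩
    (ι j + ι k) + c * (eval p + eval q)          ≈⟨ +-congˡ (distribˡ c _ _) ⟩
    (ι j + ι k) + (c * eval p + c * eval q)      ≈⟨ interchange _ _ _ _ ⟩
    (ι j + c * eval p) + (ι k + c * eval q)      ∎

  eval-neg : ∀ p → eval (negₚ p) ≈ - eval p
  eval-neg []      = sym -0#≈0#
  eval-neg (k ∷ p) = begin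
    ι (ℤ.- k) + c * eval (negₚ p) ≈⟨ +-cong (-‿homo k) (*-congˡ (eval-neg p)) ⟩
    - ι k + c * - eval p          ≈⟨ +-congˡ (-‿distribʳ-* c _) ⟨
    - ι k + - (c * eval p)        ≈⟨ -‿+-comm _ _ ⟩
    - (ι k + c * eval p)          ∎

  eval-scale : ∀ k p → eval (map (k ℤ.*_) p) ≈ ι k * eval p
  eval-scale k []      = sym (zeroʳ _)
  eval-scale k (j ∷ p) = begin
    ι (k ℤ.* j) + c * eval (map (k ℤ.*_) p) ≈⟨ +-cong (*-homo k j) (*-congˡ (eval-scale k p)) ⟩
    ι k * ι j + c * (ι k * eval p)          ≈⟨ +-congˡ (x∙yz≈y∙xz c _ _) ⟩
    ι k * ι j + ι k * (c * eval p)          ≈⟨ distribˡ (ι k) _ _ ⟨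
    ι k * (ι j + c * eval p)                ∎

  eval-* : ∀ p q → eval (p *ₚ q) ≈ eval p * eval q
  eval-* []      q = sym (zeroˡ _)
  eval-* (k ∷ p) q = begin
    eval (map (k ℤ.*_) q +ₚ (+ 0 ∷ p *ₚ q))            ≈⟨ eval-+ (map (k ℤ.*_) q) _ ⟩
    eval (map (k ℤ.*_) q) + (ι (+ 0) + c * eval (p *ₚ q)) ≈⟨ +-cong (eval-scale k q)
                                                          (trans (+-congʳ 0#-homo) (+-identityˡ _)) ⟩
    ι k * eval q + c * eval (p *ₚ q)                   ≈⟨ +-congˡ (*-congˡ (eval-* p q)) ⟩
    ι k * eval q + c * (eval p * eval q)               ≈⟨ +-congˡ (*-assoc c _ _) ⟨
    ι k * eval q + c * eval p * eval q                 ≈⟨ distribʳ (eval q) _ _ ⟨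
    (ι k + c * eval p) * eval q                        ∎

  eval-zero : ∀ p → p ≋ [] → eval p ≈ 0#
  eval-zero []      e = refl
  eval-zero (k ∷ p) e = begin
    ι k + c * eval p   ≈⟨ +-cong (trans (⟦⟧-cong (at e 0)) 0#-homo) (*-congˡ (eval-zero p (mk λ i → at e (suc i)))) ⟩
    0# + c * 0#        ≈⟨ trans (+-identityˡ _) (zeroʳ c) ⟩
    0#                 ∎

  eval-cong : ∀ {p q} → p ≋ q → eval p ≈ eval q
  eval-cong {p} {q} e = x∙y⁻¹≈ε⇒x≈y (eval p) (eval q) (begin
    eval p + - eval q      ≈⟨ +-congˡ (eval-neg q) ⟨
    eval p + eval (negₚ q) ≈⟨ eval-+ p (negₚ q) ⟨
    eval (p +ₚ negₚ q)     ≈⟨ eval-zero (p +ₚ negₚ q) (P.trans (P.+-congʳ e) (P.-‿inverseʳ q)) ⟩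
    0#                     ∎)

  open RingMorphisms (CommutativeRing.rawRing polyRing) rawRing using () renaming (IsRingHomomorphism to IsPolyHomomorphism)
  eval-isRingHomomorphism : IsPolyHomomorphism eval
  eval-isRingHomomorphism = record
    { isSemiringHomomorphism = record
      { isNearSemiringHomomorphism = record
        { +-isMonoidHomomorphism = record
          { isMagmaHomomorphism = record
            { isRelHomomorphism = record { cong = eval-cong }
            ; homo = eval-+ }
          ; ε-homo = refl }
        ; *-homo = eval-* }
      ; 1#-homo = trans (+-cong 1#-homo (zeroʳ c)) (+-identityʳ 1#) }
    ; -‿homo = eval-neg }

ℤ-ring : CommutativeRing _ _
ℤ-ring = ℤₚ.+-*-commutativeRing

module Polyᴰ = Determinant polyRing
module ℤᴰ = Determinant ℤ-ring

zeroₚ? : ∀ p → Maybe ([] ≋ p)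
zeroₚ? []          = just (mk λ i → ≡.refl)
zeroₚ? (+ 0 ∷ p)   = Maybe.map (λ e → mk λ { zero → ≡.refl ; (suc i) → at e i }) (zeroₚ? p)
zeroₚ? (_ ∷ p)     = nothing

polySolverRing : AlmostCommutativeRing _ _
polySolverRing = fromCommutativeRing polyRing zeroₚ?

module P where
  open CommutativeRing polyRing public
  open import Algebra.Properties.Ring ring public
  open import Algebra.Properties.Semiring.Sum semiring public

module ≋-Reasoning where
  open import Relation.Binary.Reasoning.Setoid P.setoid public

y : Poly
y = + 1 ∷ + 1 ∷ []

alt≡sgn : ∀ k p → alt k p ≡ Polyᴰ.sgn k p
alt≡sgn zero    p = ≡.refl
alt≡sgn (suc k) p = ≡.cong negₚ (alt≡sgn k p)

sumₚ-tabulate : ∀ {n} {f g : Fin n → Poly} → (∀ i → f i ≡ g i) → sumₚ (tabulate f) ≡ P.sum g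
sumₚ-tabulate {zero}  e = ≡.refl
sumₚ-tabulate {suc n} e = ≡.cong₂ _+ₚ_ (e fz) (sumₚ-tabulate (e ∘ fs))

det≡determinant : ∀ n M → det n M ≡ Polyᴰ.determinant n M
det≡determinant zero    M = ≡.refl
det≡determinant (suc n) M = ≡.trans (≡.cong sumₚ (map-tabulate id term))
  (sumₚ-tabulate λ j → ≡.trans (alt≡sgn (toℕ j) _)
    (≡.cong (λ d → Polyᴰ.sgn (toℕ j) (M fz j *ₚ d)) (det≡determinant n (Polyᴰ.minor M j))))
  where
  term : Fin (suc n) → Poly
  term j = alt (toℕ j) (M fz j *ₚ det n (λ i k → M (fs i) (punchIn j k)))

^ₚ-+ : ∀ p a b → (p ^ₚ (a ℕ.+ b)) ≋ ((p ^ₚ a) *ₚ (p ^ₚ b))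
^ₚ-+ p zero    b = P.sym (P.*-identityˡ (p ^ₚ b))
^ₚ-+ p (suc a) b = P.trans (P.*-congˡ {p} (^ₚ-+ p a b)) (P.sym (P.*-assoc p (p ^ₚ a) (p ^ₚ b)))

coeff-linear* : ∀ a b p i → coeff ((a ∷ b ∷ []) *ₚ p) (suc i) ≡ a ℤ.* coeff p (suc i) ℤ.+ b ℤ.* coeff p i
coeff-linear* a b p i = ≡.trans (coeff-+ (map (a ℤ.*_) p) _ (suc i)) (≡.cong₂ ℤ._+_ (coeff-scale a p (suc i))
  (≡.trans (coeff-+ (map (b ℤ.*_) p) (+ 0 ∷ []) i) (≡.trans (≡.cong₂ ℤ._+_ (coeff-scale b p i) (coeff-zero i)) (ℤₚ.+-identityʳ _))))

coeff-y*-zero : ∀ p → coeff (y *ₚ p) 0 ≡ coeff p 0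
coeff-y*-zero p = ≡.trans (coeff-+ (map (+ 1 ℤ.*_) p) _ 0)
  (≡.trans (ℤₚ.+-identityʳ _) (≡.trans (coeff-scale (+ 1) p 0) (ℤₚ.*-identityˡ _)))

coeff-y*-suc : ∀ p i → coeff (y *ₚ p) (suc i) ≡ coeff p (suc i) ℤ.+ coeff p i
coeff-y*-suc p i = ≡.trans (coeff-linear* (+ 1) (+ 1) p i) (≡.cong₂ ℤ._+_ (ℤₚ.*-identityˡ (coeff p (suc i))) (ℤₚ.*-identityˡ (coeff p i)))

-- The constant coefficient of y is 1, so the coefficients of p can be recovered from those of y p
-- from the lowest upwards.
y-cancel : ∀ p q → (y *ₚ p) ≋ (y *ₚ q) → p ≋ q
y-cancel p q e = mk go
  where
  go : p ≈ₚ q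
  go zero    = ≡.trans (≡.sym (coeff-y*-zero p)) (≡.trans (at e 0) (coeff-y*-zero q))
  go (suc i) = ℤ-group.∙-cancelʳ (coeff q i) _ _ (≡.trans (≡.cong (λ z → coeff p (suc i) ℤ.+ z) (≡.sym (go i)))
    (≡.trans (≡.sym (coeff-y*-suc p i)) (≡.trans (at e (suc i)) (coeff-y*-suc q i))))

y^-cancel : ∀ k p q → ((y ^ₚ k) *ₚ p) ≋ ((y ^ₚ k) *ₚ q) → p ≋ q
y^-cancel zero    p q e = P.trans (P.sym (P.*-identityˡ p)) (P.trans e (P.*-identityˡ q))
y^-cancel (suc k) p q e = y^-cancel k p q (y-cancel _ _
  (P.trans (P.sym (P.*-assoc y (y ^ₚ k) p)) (P.trans e (P.*-assoc y (y ^ₚ k) q))))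

∣ₚ-resp-≋ : ∀ p {q q′} → q ≋ q′ → p ∣ₚ q → p ∣ₚ q′
∣ₚ-resp-≋ p {q} e (r , d) = r , at (P.trans (P.sym e) (mk {q} {p *ₚ r} d))

open RingMorphisms (CommutativeRing.rawRing ℤ-ring) (CommutativeRing.rawRing polyRing)
  using () renaming (IsRingHomomorphism to IsConstHomomorphism)

constₚ : ℤ → Poly
constₚ a = a ∷ []

constₚ-isRingHomomorphism : IsConstHomomorphism constₚ
constₚ-isRingHomomorphism = record
  { isSemiringHomomorphism = record
    { isNearSemiringHomomorphism = record
      { +-isMonoidHomomorphism = record
        { isMagmaHomomorphism = record
          { isRelHomomorphism = record { cong = λ { ≡.refl → P.refl } }
          ; homo = λ a b → P.refl }
        ; ε-homo = mk λ { zero → ≡.refl ; (suc i) → ≡.refl } }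
      ; *-homo = λ a b → mk λ { zero → ≡.sym (ℤₚ.+-identityʳ (a ℤ.* b)) ; (suc i) → ≡.refl } }
    ; 1#-homo = P.refl }
  ; -‿homo = λ a → P.refl }

-- The substitution x ↦ -2 - x, that is y ↦ - y.
private module Reflection = Evaluation polyRing constₚ constₚ-isRingHomomorphism (ℤ.- (+ 2) ∷ ℤ.- (+ 1) ∷ [])

module ev₋₁ = Evaluation ℤ-ring id (Identity.isRingHomomorphism _ ≡.refl) (ℤ.- (+ 1))

reflect : Poly → Poly
reflect = Reflection.eval

module reflect-hom where
  open RingMorphisms (CommutativeRing.rawRing polyRing) (CommutativeRing.rawRing polyRing)
  open IsRingHomomorphism Reflection.eval-isRingHomomorphism public
  open RingHom polyRing polyRing
  open Properties Reflection.eval-isRingHomomorphism public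

ev : Poly → ℤ
ev = ev₋₁.eval

module ev-hom where
  open RingMorphisms (CommutativeRing.rawRing polyRing) (CommutativeRing.rawRing ℤ-ring)
  open IsRingHomomorphism ev₋₁.eval-isRingHomomorphism public
  open RingHom polyRing ℤ-ring
  open Properties ev₋₁.eval-isRingHomomorphism public

-- The point y = 0 is fixed by y ↦ - y. This is what turns a product of a reflected polynomial with
-- itself into a square after evaluation.
ev-reflect : ∀ p → ev (reflect p) ≡ ev p
ev-reflect []      = ≡.refl
ev-reflect (a ∷ p) = ≡.trans (ev₋₁.eval-+ (a ∷ []) (c *ₚ reflect p))
  (≡.cong₂ ℤ._+_ (ℤₚ.+-identityʳ a) (≡.trans (ev₋₁.eval-* c (reflect p)) (≡.cong (ℤ.- (+ 1) ℤ.*_) (ev-reflect p))))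
  where
  c : Poly
  c = ℤ.- (+ 2) ∷ ℤ.- (+ 1) ∷ []

module PolyIdentities where
  open AlmostCommutativeRing polySolverRing

  synthetic : ∀ a e y s → a + (y - 1#) * (e + y * s) ≈ (a - e) + y * (e + (y - 1#) * s)
  synthetic = solve-∀ polySolverRing

  regroup₂ : ∀ t z w Y h → (t * z) * (w * (Y * h)) ≈ (t * (Y * w)) * (z * h)
  regroup₂ = solve-∀ polySolverRing
  regroup₃ : ∀ t z y Y q → (t * z) * (y * (y * (Y * q))) ≈ (t * (Y * y)) * (y * (z * q))
  regroup₃ = solve-∀ polySolverRing
  regroup₄ : ∀ t r y Y h → (y * (y * (t * r))) * (Y * h) ≈ (t * (Y * y)) * (y * (r * h))
  regroup₄ = solve-∀ polySolverRing
  assoc₂ : ∀ y Y s → Y * (y * s) ≈ y * Y * s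
  assoc₂ = solve-∀ polySolverRing
  assoc₃ : ∀ y Y Z q → y * (y * (Y * Z)) * q ≈ y * (y * (Y * (Z * q)))
  assoc₃ = solve-∀ polySolverRing

  base : ∀ a b → a ≈ b + 1# * (a + - b)
  base = solve-∀ polySolverRing
  peel : ∀ y d e → (y + y) * e + - (y * (y * d)) ≈ y * e + (y * e + - (y * (y * d)))
  peel = solve-∀ polySolverRing
  difference : ∀ y d t Δ → y * (y * d + t * Δ) + - (y * (y * d)) ≈ y * t * Δ
  difference = solve-∀ polySolverRing
  collect : ∀ y t a m Δ → y * (t * (a + m * Δ)) + y * t * Δ ≈ y * t * (a + (1# + m) * Δ)
  collect = solve-∀ polySolverRing

  factor-y : ∀ Y y q m v → Y * (y * q + m * (y * v)) ≈ y * Y * (q + m * v)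
  factor-y = solve-∀ polySolverRing
  shift : ∀ a m l v → a + (m + l) * v ≈ (a + m * v) + l * v
  shift = solve-∀ polySolverRing

-- Horner's scheme at -1, with x written as y - 1: `y +ₚ negₚ 1ₚ` reduces to the list of x, so that
-- `cons-≋` applies as it stands.
synthetic-division : ∀ p → ∃ λ s → p ≋ ((ev p ∷ []) +ₚ (y *ₚ s))
synthetic-division []      = [] , mk λ { zero → ≡.refl ; (suc zero) → ≡.refl ; (suc (suc i)) → ≡.refl }
synthetic-division (a ∷ p) with synthetic-division p
... | s , e = s′ , (begin
  a ∷ p
    ≈⟨ cons-≋ a p ⟩
  (a ∷ []) +ₚ ((y +ₚ negₚ 1ₚ) *ₚ p)
    ≈⟨ P.+-congˡ {a ∷ []} (P.*-congˡ {y +ₚ negₚ 1ₚ} e) ⟩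
  (a ∷ []) +ₚ ((y +ₚ negₚ 1ₚ) *ₚ ((ev p ∷ []) +ₚ (y *ₚ s)))
    ≈⟨ PolyIdentities.synthetic (a ∷ []) (ev p ∷ []) y s ⟩
  ((a ∷ []) +ₚ negₚ (ev p ∷ [])) +ₚ (y *ₚ s′)
    ≈⟨ P.+-congʳ {y *ₚ s′} remainder ⟩
  (ev (a ∷ p) ∷ []) +ₚ (y *ₚ s′) ∎)
  where
  open ≋-Reasoning
  1ₚ s′ : Poly
  1ₚ = + 1 ∷ []
  s′ = (ev p ∷ []) +ₚ ((y +ₚ negₚ 1ₚ) *ₚ s)
  remainder : ((a ∷ []) +ₚ negₚ (ev p ∷ [])) ≋ (ev (a ∷ p) ∷ [])
  remainder = mk λ { zero → ≡.cong (λ z → a ℤ.+ z) (≡.sym (ℤₚ.-1*i≡-i (ev p))) ; (suc i) → ≡.refl }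

factor : ∀ p → ev p ≡ + 0 → ∃ λ s → p ≋ (y *ₚ s)
factor p e with synthetic-division p
... | s , d = s , P.trans d (P.trans (P.+-congʳ {y *ₚ s} remainder) (P.+-identityˡ (y *ₚ s)))
  where
  remainder : (ev p ∷ []) ≋ []
  remainder = mk λ { zero → e ; (suc i) → ≡.refl }

module Z where
  open import Algebra.Properties.Semiring.Sum (CommutativeRing.semiring ℤ-ring) public using (sum)

square : ∀ a → a ℤ.* a ≡ + (ℤ.∣ a ∣ ℕ.* ℤ.∣ a ∣)
square (+ n)      = ≡.sym (ℤₚ.pos-* n n)
square ℤ.-[1+ n ] = ≡.refl

sum-squares-zero : ∀ {n} (a : Fin n → ℤ) → Z.sum (λ i → a i ℤ.* a i) ≡ + 0 → ∀ i → a i ≡ + 0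
sum-squares-zero a e with asNat a
  where
  -- The sum is exhibited as a natural number, since there a vanishing sum has vanishing terms.
  asNat : ∀ {n} (a : Fin n → ℤ) → ∃ λ N → Z.sum (λ i → a i ℤ.* a i) ≡ + N × (N ≡ 0 → ∀ i → a i ≡ + 0)
  asNat {zero}  a = 0 , ≡.refl , λ _ ()
  asNat {suc n} a with asNat (a ∘ fs)
  ... | N , e , z = ℤ.∣ a fz ∣ ℕ.* ℤ.∣ a fz ∣ ℕ.+ N , ≡.cong₂ ℤ._+_ (square (a fz)) e , λ
    { s fz     → ℤₚ.∣i∣≡0⇒i≡0 (square-zero (ℕₚ.m+n≡0⇒m≡0 _ s))
    ; s (fs i) → z (ℕₚ.m+n≡0⇒n≡0 (ℤ.∣ a fz ∣ ℕ.* ℤ.∣ a fz ∣) s) i }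
    where
    square-zero : ∀ {m} → m ℕ.* m ≡ 0 → m ≡ 0
    square-zero {zero} _ = ≡.refl
... | N , s , z = z (ℤₚ.+-injective (≡.trans (≡.sym s) e))

-- Vanishing order of symmetric pencils

private
  reflect-y : reflect y ≋ negₚ y
  reflect-y = mk λ { zero → ≡.refl ; (suc zero) → ≡.refl ; (suc (suc zero)) → ≡.refl ; (suc (suc (suc i))) → ≡.refl }

-- Each factor of the reflected power is - y and is cancelled together with its sign, so the parity
-- of k never has to be tracked.
reflect-y^-cancel : ∀ k p q → (reflect (y ^ₚ k) *ₚ p) ≋ (reflect (y ^ₚ k) *ₚ q) → p ≋ q
reflect-y^-cancel zero    p q e = P.trans (P.sym (unit p)) (P.trans e (unit q))
  where
  unit : ∀ p → (reflect (+ 1 ∷ []) *ₚ p) ≋ p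
  unit p = P.trans (P.*-congʳ {p} reflect-hom.1#-homo) (P.*-identityˡ p)
reflect-y^-cancel (suc k) p q e = reflect-y^-cancel k p q (y-cancel _ _ (P.-‿injective (begin
  negₚ (y *ₚ (reflect (y ^ₚ k) *ₚ p))    ≈⟨ peel p ⟨
  reflect (y ^ₚ suc k) *ₚ p              ≈⟨ e ⟩
  reflect (y ^ₚ suc k) *ₚ q              ≈⟨ peel q ⟩
  negₚ (y *ₚ (reflect (y ^ₚ k) *ₚ q))    ∎)))
  where
  open ≋-Reasoning
  peel : ∀ p → (reflect (y ^ₚ suc k) *ₚ p) ≋ negₚ (y *ₚ (reflect (y ^ₚ k) *ₚ p))
  peel p = begin
    reflect (y ^ₚ suc k) *ₚ p               ≈⟨ P.*-congʳ {p} (reflect-hom.*-homo y (y ^ₚ k)) ⟩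
    (reflect y *ₚ reflect (y ^ₚ k)) *ₚ p    ≈⟨ P.*-assoc (reflect y) (reflect (y ^ₚ k)) p ⟩
    reflect y *ₚ (reflect (y ^ₚ k) *ₚ p)    ≈⟨ P.*-congʳ {reflect (y ^ₚ k) *ₚ p} reflect-y ⟩
    negₚ y *ₚ (reflect (y ^ₚ k) *ₚ p)       ≈⟨ P.-‿distribˡ-* y (reflect (y ^ₚ k) *ₚ p) ⟨
    negₚ (y *ₚ (reflect (y ^ₚ k) *ₚ p))     ∎

neg-neg : ∀ p q → (negₚ p *ₚ negₚ q) ≋ (p *ₚ q)
neg-neg p q = begin
  negₚ p *ₚ negₚ q      ≈⟨ P.-‿distribˡ-* p (negₚ q) ⟨
  negₚ (p *ₚ negₚ q)    ≈⟨ P.-‿cong (P.-‿distribʳ-* p q) ⟨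
  negₚ (negₚ (p *ₚ q))  ≈⟨ P.-‿involutive (p *ₚ q) ⟩
  p *ₚ q                ∎
  where open ≋-Reasoning

sum-single : ∀ {n} (f : Fin n → Poly) u → (∀ v → v ≢ u → f v ≋ []) → P.sum f ≋ f u
sum-single {suc n} f fz     z = P.trans (P.+-congˡ {f fz} (Polyᴰ.sum-zero λ v → z (fs v) λ ())) (P.+-identityʳ (f fz))
sum-single {suc n} f (fs u) z = P.trans (P.+-congʳ {P.sum (f ∘ fs)} (z fz λ ()))
  (sum-single (f ∘ fs) u λ v v≢u → z (fs v) λ { ≡.refl → v≢u ≡.refl })

-- The matrices y I - B with B symmetric and constant.
record IsPencil {n} (M : Fin n → Fin n → Poly) : Set where
  field
    symmetric   : ∀ i j → M i j ≋ M j i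
    diagonal    : ∀ i → (M i i P.- reflect (M i i)) ≋ (y +ₚ y)
    offDiagonal : ∀ i j → i ≢ j → (M i j P.- reflect (M i j)) ≋ []

module Pencil {n} (M : Fin (suc n) → Fin (suc n) → Poly) (pencil : IsPencil M) where
  open IsPencil pencil
  open ≋-Reasoning

  f : Poly
  f = Polyᴰ.determinant (suc n) M

  g : Fin (suc n) → Poly
  g = Polyᴰ.cofactor M

  Mg : Fin (suc n) → Poly
  Mg u = P.sum λ v → M u v *ₚ g v

  Mg-zero : Mg fz ≋ f
  Mg-zero = Polyᴰ.det-cofactor n M

  Mg-suc : ∀ i → Mg (fs i) ≋ []
  Mg-suc = Polyᴰ.cofactor-orthogonal n M

  sum-head : (h : Fin (suc n) → Poly) → (∀ i → h (fs i) ≋ []) → P.sum h ≋ h fz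
  sum-head h z = sum-single h fz λ { fz n → contradiction ≡.refl n ; (fs i) _ → z i }

  row : ∀ u → P.sum (λ v → M u v *ₚ g v) P.- P.sum (λ v → reflect (M u v) *ₚ g v) P.≈ (y +ₚ y) *ₚ g u
  row u = begin
    P.sum (λ v → M u v *ₚ g v) P.- P.sum (λ v → reflect (M u v) *ₚ g v)
      ≈⟨ P.+-congˡ {P.sum (λ v → M u v *ₚ g v)} (Polyᴰ.sgn-sum 1 (λ v → reflect (M u v) *ₚ g v)) ⟩
    P.sum (λ v → M u v *ₚ g v) +ₚ P.sum (λ v → negₚ (reflect (M u v) *ₚ g v))
      ≈⟨ P.∑-distrib-+ (λ v → M u v *ₚ g v) (λ v → negₚ (reflect (M u v) *ₚ g v)) ⟨
    P.sum (λ v → (M u v *ₚ g v) P.- (reflect (M u v) *ₚ g v))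
      ≈⟨ Polyᴰ.sum-cong (λ v → P.sym (P.[y-z]x≈yx-zx (g v) (M u v) (reflect (M u v)))) ⟩
    P.sum (λ v → (M u v P.- reflect (M u v)) *ₚ g v)
      ≈⟨ sum-single (λ v → (M u v P.- reflect (M u v)) *ₚ g v) u
           (λ v v≢u → P.trans (P.*-congʳ {g v} (offDiagonal u v (v≢u ∘ ≡.sym))) P.refl) ⟩
    (M u u P.- reflect (M u u)) *ₚ g u
      ≈⟨ P.*-congʳ {g u} (diagonal u) ⟩
    (y +ₚ y) *ₚ g u ∎

  -- From M - reflect M = 2 y I and M g = f e₀; it replaces the derivative of the resolvent.
  resolvent : P.sum (λ u → reflect (g u) *ₚ ((y +ₚ y) *ₚ g u)) ≋ ((reflect (g fz) *ₚ f) P.- (reflect f *ₚ g fz))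
  resolvent = begin
    P.sum (λ u → ψ u *ₚ ((y +ₚ y) *ₚ g u))
      ≈⟨ Polyᴰ.sum-cong (λ u → P.*-congˡ {ψ u} (row u)) ⟨
    P.sum (λ u → ψ u *ₚ (Mg u P.- N u))
      ≈⟨ Polyᴰ.sum-cong (λ u → P.x[y-z]≈xy-xz (ψ u) (Mg u) (N u)) ⟩
    P.sum (λ u → (ψ u *ₚ Mg u) P.- (ψ u *ₚ N u))
      ≈⟨ P.∑-distrib-+ (λ u → ψ u *ₚ Mg u) (λ u → negₚ (ψ u *ₚ N u)) ⟩
    P.sum (λ u → ψ u *ₚ Mg u) +ₚ P.sum (λ u → negₚ (ψ u *ₚ N u))
      ≈⟨ P.+-cong first (P.trans (P.sym (Polyᴰ.sgn-sum 1 (λ u → ψ u *ₚ N u))) (P.-‿cong second)) ⟩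
    (ψ fz *ₚ f) P.- (reflect f *ₚ g fz) ∎
    where
    ψ N : Fin (suc n) → Poly
    ψ u = reflect (g u)
    N u = P.sum (λ v → reflect (M u v) *ₚ g v)

    first : P.sum (λ u → ψ u *ₚ Mg u) ≋ (ψ fz *ₚ f)
    first = P.trans (sum-head (λ u → ψ u *ₚ Mg u) λ i → P.trans (P.*-congˡ {ψ (fs i)} (Mg-suc i)) (P.zeroʳ (ψ (fs i))))
                    (P.*-congˡ {ψ fz} Mg-zero)

    reflect-Mg : ∀ v → P.sum (λ u → reflect (M v u) *ₚ ψ u) ≋ reflect (Mg v)
    reflect-Mg v = P.sym (P.trans (reflect-hom.sum-homo (λ u → M v u *ₚ g u))
      (Polyᴰ.sum-cong λ u → reflect-hom.*-homo (M v u) (g u)))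

    second : P.sum (λ u → ψ u *ₚ N u) ≋ (reflect f *ₚ g fz)
    second = begin
      P.sum (λ u → ψ u *ₚ N u)
        ≈⟨ Polyᴰ.sum-cong (λ u → P.*-distribˡ-sum (ψ u) (λ v → reflect (M u v) *ₚ g v)) ⟩
      P.sum (λ u → P.sum (λ v → ψ u *ₚ (reflect (M u v) *ₚ g v)))
        ≈⟨ P.∑-comm (λ u v → ψ u *ₚ (reflect (M u v) *ₚ g v)) ⟩
      P.sum (λ v → P.sum (λ u → ψ u *ₚ (reflect (M u v) *ₚ g v)))
        ≈⟨ Polyᴰ.sum-cong (λ v → Polyᴰ.sum-cong λ u → P.trans (P.sym (P.*-assoc (ψ u) (reflect (M u v)) (g v)))
             (P.*-congʳ {g v} (P.trans (P.*-comm (ψ u) (reflect (M u v))) (P.*-congʳ {ψ u} (reflect-hom.⟦⟧-cong (symmetric u v)))))) ⟩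
      P.sum (λ v → P.sum (λ u → (reflect (M v u) *ₚ ψ u) *ₚ g v))
        ≈⟨ Polyᴰ.sum-cong (λ v → P.trans (P.sym (P.*-distribʳ-sum (g v) (λ u → reflect (M v u) *ₚ ψ u)))
             (P.*-congʳ {g v} (reflect-Mg v))) ⟩
      P.sum (λ v → reflect (Mg v) *ₚ g v)
        ≈⟨ sum-head (λ v → reflect (Mg v) *ₚ g v)
             (λ i → P.*-congʳ {g (fs i)} (reflect-hom.⟦⟧-cong (Mg-suc i))) ⟩
      reflect (Mg fz) *ₚ g fz
        ≈⟨ P.*-congʳ {g fz} (reflect-hom.⟦⟧-cong Mg-zero) ⟩
      reflect f *ₚ g fz ∎

  -- Below order m, the lowest coefficient of the diagonal entry of the resolvent identity
  -- is twice a sum of squares, so it vanishes only if all the cofactors have higher order.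
  raise : ∀ j q (h : Fin (suc n) → Poly) → f ≋ (y *ₚ (y *ₚ ((y ^ₚ j) *ₚ q))) →
    (∀ u → g u ≋ ((y ^ₚ j) *ₚ h u)) → ∀ u → (y ^ₚ suc j) ∣ₚ g u
  raise j q h f≋ g≋ u = s , at (begin
    g u                  ≈⟨ g≋ u ⟩
    Y *ₚ h u             ≈⟨ P.*-congˡ {Y} e ⟩
    Y *ₚ (y *ₚ s)        ≈⟨ PolyIdentities.assoc₂ y Y s ⟩
    (y *ₚ Y) *ₚ s        ∎)
    where
    Y t r : Poly
    Y = y ^ₚ j
    t = reflect Y
    r = reflect q
    z : Fin (suc n) → Poly
    z u = reflect (h u)

    ψg : ∀ u → reflect (g u) ≋ (t *ₚ z u)
    ψg u = P.trans (reflect-hom.⟦⟧-cong (g≋ u)) (reflect-hom.*-homo Y (h u))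

    ψf : reflect f ≋ (y *ₚ (y *ₚ (t *ₚ r)))
    ψf = begin
      reflect f
        ≈⟨ reflect-hom.⟦⟧-cong f≋ ⟩
      reflect (y *ₚ (y *ₚ (Y *ₚ q)))
        ≈⟨ P.trans (reflect-hom.*-homo y (y *ₚ (Y *ₚ q))) (P.*-cong reflect-y
             (P.trans (reflect-hom.*-homo y (Y *ₚ q)) (P.*-cong reflect-y (reflect-hom.*-homo Y q)))) ⟩
      negₚ y *ₚ (negₚ y *ₚ (t *ₚ r))
        ≈⟨ P.trans (P.*-congˡ {negₚ y} (P.sym (P.-‿distribˡ-* y (t *ₚ r)))) (neg-neg y (y *ₚ (t *ₚ r))) ⟩
      y *ₚ (y *ₚ (t *ₚ r)) ∎

    S c : Poly
    S = P.sum λ u → z u *ₚ h u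
    c = t *ₚ (Y *ₚ y)

    left : P.sum (λ u → reflect (g u) *ₚ ((y +ₚ y) *ₚ g u)) ≋ (c *ₚ (S +ₚ S))
    left = begin
      P.sum (λ u → reflect (g u) *ₚ ((y +ₚ y) *ₚ g u))
        ≈⟨ Polyᴰ.sum-cong (λ u → P.trans (P.*-cong (ψg u) (P.*-congˡ {y +ₚ y} (g≋ u)))
             (PolyIdentities.regroup₂ t (z u) (y +ₚ y) Y (h u))) ⟩
      P.sum (λ u → (t *ₚ (Y *ₚ (y +ₚ y))) *ₚ (z u *ₚ h u))
        ≈⟨ P.*-distribˡ-sum (t *ₚ (Y *ₚ (y +ₚ y))) (λ u → z u *ₚ h u) ⟨
      (t *ₚ (Y *ₚ (y +ₚ y))) *ₚ S
        ≈⟨ P.*-congʳ {S} (P.trans (P.*-congˡ {t} (P.distribˡ Y y y)) (P.distribˡ t (Y *ₚ y) (Y *ₚ y))) ⟩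
      (c +ₚ c) *ₚ S
        ≈⟨ P.trans (P.distribʳ S c c) (P.sym (P.distribˡ c S S)) ⟩
      c *ₚ (S +ₚ S) ∎

    right : ((reflect (g fz) *ₚ f) P.- (reflect f *ₚ g fz)) ≋ (c *ₚ ((y *ₚ (z fz *ₚ q)) P.- (y *ₚ (r *ₚ h fz))))
    right = P.trans (P.+-cong
        (P.trans (P.*-cong (ψg fz) f≋) (PolyIdentities.regroup₃ t (z fz) y Y q))
        (P.-‿cong (P.trans (P.*-cong ψf (g≋ fz)) (PolyIdentities.regroup₄ t r y Y (h fz)))))
      (P.sym (P.x[y-z]≈xy-xz c (y *ₚ (z fz *ₚ q)) (y *ₚ (r *ₚ h fz))))

    c-cancel : ∀ p q → (c *ₚ p) ≋ (c *ₚ q) → p ≋ q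
    c-cancel p q e = y-cancel p q (y^-cancel j (y *ₚ p) (y *ₚ q) (reflect-y^-cancel j (Y *ₚ (y *ₚ p)) (Y *ₚ (y *ₚ q))
      (P.trans (P.sym (assoc p)) (P.trans e (assoc q)))))
      where
      assoc : ∀ p → (c *ₚ p) ≋ (t *ₚ (Y *ₚ (y *ₚ p)))
      assoc p = P.trans (P.*-assoc t (Y *ₚ y) p) (P.*-congˡ {t} (P.*-assoc Y y p))

    -- After `c` is cancelled the right side still has a factor y, because `f` carries y ^ (j + 2)
    -- while the cofactors carry y ^ j. At y = 0 it vanishes.
    2S : (S +ₚ S) ≋ ((y *ₚ (z fz *ₚ q)) P.- (y *ₚ (r *ₚ h fz)))
    2S = c-cancel _ _ (P.trans (P.sym left) (P.trans resolvent right))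

    ev-y* : ∀ p → ev (y *ₚ p) ≡ + 0
    ev-y* p = ≡.trans (ev-hom.*-homo y p) (ℤₚ.*-zeroˡ (ev p))

    ev-2S : ev S ℤ.+ ev S ≡ + 0
    ev-2S = ≡.trans (≡.sym (ev-hom.+-homo S S)) (≡.trans (ev-hom.⟦⟧-cong 2S)
      (≡.trans (ev-hom.+-homo (y *ₚ (z fz *ₚ q)) (negₚ (y *ₚ (r *ₚ h fz))))
        (≡.cong₂ ℤ._+_ (ev-y* (z fz *ₚ q)) (≡.trans (ev-hom.-‿homo (y *ₚ (r *ₚ h fz))) (≡.cong ℤ.-_ (ev-y* (r *ₚ h fz)))))))

    ev-S : ev S ≡ + 0
    ev-S = halve (ev S) ev-2S
      where
      halve : ∀ a → a ℤ.+ a ≡ + 0 → a ≡ + 0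
      halve (+ zero) _ = ≡.refl

    squares : Z.sum (λ u → ev (h u) ℤ.* ev (h u)) ≡ + 0
    squares = ≡.trans (≡.sym (≡.trans (ev-hom.sum-homo (λ u → z u *ₚ h u))
      (ℤᴰ.sum-cong λ u → ≡.trans (ev-hom.*-homo (z u) (h u)) (≡.cong (ℤ._* ev (h u)) (ev-reflect (h u)))))) ev-S

    s : Poly
    s = proj₁ (factor (h u) (sum-squares-zero (λ u → ev (h u)) squares u))
    e : h u ≋ (y *ₚ s)
    e = proj₂ (factor (h u) (sum-squares-zero (λ u → ev (h u)) squares u))

  -- One application of `raise` consumes two more factors of y in `f` than are already known in the
  -- cofactors. The induction can therefore climb up to m and stops one short of the order of `f`.
  cofactor-order : ∀ m → (y ^ₚ suc m) ∣ₚ f → ∀ j → j ≤ m → ∀ u → (y ^ₚ j) ∣ₚ g u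
  cofactor-order m d       zero    _   u = g u , at (P.sym (P.*-identityˡ (g u)))
  cofactor-order m (q , d) (suc j) j<m =
    raise j ((y ^ₚ (m ∸ suc j)) *ₚ q) (λ u → proj₁ (ih u)) f≋ (λ u → mk {g u} {(y ^ₚ j) *ₚ proj₁ (ih u)} (proj₂ (ih u)))
    where
    ih : ∀ u → (y ^ₚ j) ∣ₚ g u
    ih = cofactor-order m (q , d) j (ℕₚ.<⇒≤ j<m)
    f≋ : f ≋ (y *ₚ (y *ₚ ((y ^ₚ j) *ₚ ((y ^ₚ (m ∸ suc j)) *ₚ q))))
    f≋ = begin
      f                                                          ≈⟨ mk {f} {(y ^ₚ suc m) *ₚ q} d ⟩
      (y ^ₚ suc m) *ₚ q                                          ≡⟨ ≡.cong (λ k → (y ^ₚ suc k) *ₚ q) (ℕₚ.m+[n∸m]≡n j<m) ⟨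
      (y ^ₚ suc (suc j ℕ.+ (m ∸ suc j))) *ₚ q                    ≈⟨ P.*-congʳ {q} (P.*-congˡ {y} (P.*-congˡ {y} (^ₚ-+ y j (m ∸ suc j)))) ⟩
      (y *ₚ (y *ₚ ((y ^ₚ j) *ₚ (y ^ₚ (m ∸ suc j))))) *ₚ q        ≈⟨ PolyIdentities.assoc₃ y (y ^ₚ j) (y ^ₚ (m ∸ suc j)) q ⟩
      y *ₚ (y *ₚ ((y ^ₚ j) *ₚ ((y ^ₚ (m ∸ suc j)) *ₚ q)))        ∎

  minor-order : ∀ m → (y ^ₚ suc m) ∣ₚ f → (y ^ₚ m) ∣ₚ Polyᴰ.determinant n (Polyᴰ.minor M fz)
  minor-order m d = cofactor-order m d m ℕₚ.≤-refl fz

open IsPencil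

pencil-∘ : ∀ {m n} {M : Fin n → Fin n → Poly} → IsPencil M → (σ : Fin m → Fin n) → Injective _≡_ _≡_ σ →
  IsPencil (λ i j → M (σ i) (σ j))
pencil-∘ p σ inj = record
  { symmetric   = λ i j → symmetric p (σ i) (σ j)
  ; diagonal    = λ i → diagonal p (σ i)
  ; offDiagonal = λ i j i≢j → offDiagonal p (σ i) (σ j) (i≢j ∘ inj) }

toFront-injective : ∀ {n} (v : Fin (suc n)) → Injective _≡_ _≡_ (Polyᴰ.toFront v)
toFront-injective v {fz}   {fz}   _ = ≡.refl
toFront-injective v {fz}   {fs j} e = contradiction (≡.sym e) (punchInᵢ≢i v j)
toFront-injective v {fs i} {fz}   e = contradiction e (punchInᵢ≢i v i)
toFront-injective v {fs i} {fs j} e = ≡.cong fs (punchIn-injective v i j e)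

-- Rows and columns undergo the same cycle bringing v to the front, which preserves the determinant
-- and the pencil property; the vertex deleted is then the first one.
delete-order : ∀ n m (M : Fin (suc n) → Fin (suc n) → Poly) → IsPencil M → ∀ v →
  (y ^ₚ suc m) ∣ₚ Polyᴰ.determinant (suc n) M →
  (y ^ₚ m) ∣ₚ Polyᴰ.determinant n (λ i j → M (punchIn v i) (punchIn v j))
delete-order n m M p v d = Pencil.minor-order (λ i j → M (front i) (front j)) (pencil-∘ p front (toFront-injective v)) m
  (∣ₚ-resp-≋ (y ^ₚ suc m) (P.sym (Polyᴰ.det-conjugate (suc n) {front} {toℕ v} (Polyᴰ.det-toFront n v) M)) d)
  where
  front : Fin (suc n) → Fin (suc n)
  front = Polyᴰ.toFront v

injective⇒permutation : ∀ {n} (σ : Fin n → Fin n) → Injective _≡_ _≡_ σ → Σ[ π ∈ Permutation n n ] (∀ i → π ⟨$⟩ʳ i ≡ σ i)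
injective⇒permutation {n} σ inj with all? (λ v → any? (λ i → σ i Fin.≟ v))
... | yes surj = Perm.permutation σ (proj₁ ∘ surj) (λ v → proj₂ (surj v)) (λ i → inj (proj₂ (surj (σ i)))) , λ i → ≡.refl
... | no ¬surj with ¬∀⟶∃¬ n _ (λ v → any? (λ i → σ i Fin.≟ v)) ¬surj
injective⇒permutation {suc n} σ inj | no ¬surj | v , missed = contradiction
  (injective⇒≤ {f = λ i → punchOut {i = v} {σ i} (λ e → missed (i , ≡.sym e))} λ {i} {j} e → inj (punchOut-injective {i = v} _ _ e))
  ℕₚ.1+n≰n

missed-vertex : ∀ {s n} → s < n → (σ : Fin s → Fin n) → Σ[ v ∈ Fin n ] (∀ i → σ i ≢ v)
missed-vertex {s} {n} s<n σ with all? (λ v → any? (λ i → σ i Fin.≟ v))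
... | yes surj = contradiction
  (injective⇒≤ {f = proj₁ ∘ surj} λ {v} {w} e → ≡.trans (≡.sym (proj₂ (surj v))) (≡.trans (≡.cong σ e) (proj₂ (surj w))))
  (ℕₚ.<⇒≱ s<n)
... | no ¬surj with ¬∀⟶∃¬ n _ (λ v → any? (λ i → σ i Fin.≟ v)) ¬surj
... | v , missed = v , λ i e → missed (i , e)

-- While d is positive some vertex is missed by σ, and deleting it costs at most one factor of y.
-- When d reaches 0, σ is a permutation and merely relabels.
restrict-order : ∀ d s e (M : Fin (d ℕ.+ s) → Fin (d ℕ.+ s) → Poly) → IsPencil M →
  (σ : Fin s → Fin (d ℕ.+ s)) → Injective _≡_ _≡_ σ →
  (y ^ₚ (d ℕ.+ e)) ∣ₚ Polyᴰ.determinant (d ℕ.+ s) M → (y ^ₚ e) ∣ₚ Polyᴰ.determinant s (λ i j → M (σ i) (σ j))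
restrict-order zero s e M p σ inj d with injective⇒permutation σ inj
... | π , π≗σ = ∣ₚ-resp-≋ (y ^ₚ e) (P.trans (P.sym (Polyᴰ.det-permute s π M))
  (Polyᴰ.det-cong s λ i j → P.reflexive (≡.cong₂ M (π≗σ i) (π≗σ j)))) d
restrict-order (suc d) s e M p σ inj div with missed-vertex (s≤s (ℕₚ.m≤n+m s d)) σ
... | v , missed = ∣ₚ-resp-≋ (y ^ₚ e)
  (Polyᴰ.det-cong s λ i j → P.reflexive (≡.cong₂ M (punchIn-punchOut (v≢σ i)) (punchIn-punchOut (v≢σ j))))
  (restrict-order d s e (λ i j → M (punchIn v i) (punchIn v j)) (pencil-∘ p (punchIn v) (punchIn-injective v _ _))
    (λ i → punchOut (v≢σ i)) (λ {i} {j} e → inj (punchOut-injective (v≢σ i) (v≢σ j) e))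
    (delete-order (d ℕ.+ s) (d ℕ.+ e) M p v div))
  where
  v≢σ : ∀ i → v ≢ σ i
  v≢σ i = missed i ∘ ≡.sym

-- Characteristic matrices as pencils

charMatrix : ∀ {n} → (Fin n → Fin n → ℕ) → Fin n → Fin n → Poly
charMatrix A i j = if i == j then (ℤ.- (+ A i j)) ∷ + 1 ∷ [] else (ℤ.- (+ A i j)) ∷ []

charPoly≡ : ∀ {n} (A : Fin n → Fin n → ℕ) → charPoly A ≡ Polyᴰ.determinant n (charMatrix A)
charPoly≡ {n} A = det≡determinant n (charMatrix A)

==-refl : ∀ {n} (i : Fin n) → (i == i) ≡ true
==-refl i with i Fin.≟ i
... | yes _ = ≡.refl
... | no ¬p = contradiction ≡.refl ¬p

==-≢ : ∀ {n} {i j : Fin n} → i ≢ j → (i == j) ≡ false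
==-≢ {i = i} {j} i≢j with i Fin.≟ j
... | yes p = contradiction p i≢j
... | no _  = ≡.refl

charMatrix-diagonal : ∀ {n} (A : Fin n → Fin n → ℕ) i → charMatrix A i i ≡ (ℤ.- (+ A i i)) ∷ + 1 ∷ []
charMatrix-diagonal A i rewrite ==-refl i = ≡.refl

charMatrix-offDiagonal : ∀ {n} (A : Fin n → Fin n → ℕ) {i j} → i ≢ j → charMatrix A i j ≡ (ℤ.- (+ A i j)) ∷ []
charMatrix-offDiagonal A i≢j rewrite ==-≢ i≢j = ≡.refl

-- A diagonal entry x - a equals y - (a + 1), so the constant matrix behind this pencil is A + I.
charMatrix-pencil : ∀ {n} (A : Fin n → Fin n → ℕ) → (∀ i j → A i j ≡ A j i) → IsPencil (charMatrix A)
charMatrix-pencil A A-sym = record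
  { symmetric   = sym′
  ; diagonal    = λ i → ≡.subst (λ p → (p P.- reflect p) ≋ (y +ₚ y)) (≡.sym (charMatrix-diagonal A i)) (diag (ℤ.- (+ A i i)))
  ; offDiagonal = λ i j i≢j → ≡.subst (λ p → (p P.- reflect p) ≋ []) (≡.sym (charMatrix-offDiagonal A i≢j)) (off (ℤ.- (+ A i j)))
  }
  where
  open import Data.Integer.Solver using (module +-*-Solver)
  open +-*-Solver
  sym′ : ∀ i j → charMatrix A i j ≋ charMatrix A j i
  sym′ i j with i Fin.≟ j
  ... | yes ≡.refl = P.reflexive (≡.sym (charMatrix-diagonal A i))
  ... | no i≢j     = P.reflexive (≡.sym (≡.trans (charMatrix-offDiagonal A (i≢j ∘ ≡.sym)) (≡.cong (λ a → (ℤ.- (+ a)) ∷ []) (A-sym j i))))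
  diag : ∀ a → ((a ∷ + 1 ∷ []) P.- reflect (a ∷ + 1 ∷ [])) ≋ (y +ₚ y)
  diag a = mk λ
    { zero                → solve 1 (λ a → a :+ :- (a :+ con (ℤ.- (+ 2))) := con (+ 2)) ≡.refl a
    ; (suc zero)          → ≡.refl
    ; (suc (suc zero))    → ≡.refl
    ; (suc (suc (suc i))) → ≡.refl }
  off : ∀ a → ((a ∷ []) P.- reflect (a ∷ [])) ≋ []
  off a = mk λ
    { zero             → solve 1 (λ a → a :+ :- (a :+ con (+ 0)) := con (+ 0)) ≡.refl a
    ; (suc zero)       → ≡.refl
    ; (suc (suc i))    → ≡.refl }

ev-y^ : ∀ e {p} → (y ^ₚ suc e) ∣ₚ p → ev p ≡ + 0
ev-y^ e {p} (r , d) = ≡.trans (ev-hom.⟦⟧-cong (mk {p} {(y ^ₚ suc e) *ₚ r} d))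
  (≡.trans (ev-hom.*-homo (y ^ₚ suc e) r) (≡.trans (≡.cong (ℤ._* ev r)
    (≡.trans (ev-hom.*-homo y (y ^ₚ e)) (ℤₚ.*-zeroˡ (ev (y ^ₚ e))))) (ℤₚ.*-zeroˡ (ev r))))

shiftedMatrix : ∀ {n} → (Fin n → Fin n → ℕ) → Fin n → Fin n → ℤ
shiftedMatrix A i j = ev (charMatrix A i j)

-- The entries of shiftedMatrix A are those of - (A + I).
principal-minor-zero : ∀ {n s k} (A : Fin n → Fin n → ℕ) → (∀ i j → A i j ≡ A j i) →
  (σ : Fin s → Fin n) → Injective _≡_ _≡_ σ → n < s ℕ.+ k → (y ^ₚ k) ∣ₚ charPoly A →
  ℤᴰ.determinant s (λ i j → shiftedMatrix A (σ i) (σ j)) ≡ + 0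
principal-minor-zero {n} {s} {k} A A-sym σ inj n<s+k y^k∣χ with n ∸ s | ℕₚ.m∸n+n≡m (injective⇒≤ inj)
... | d | ≡.refl = ≡.trans (≡.sym (ev-hom.det-homo s λ i j → charMatrix A (σ i) (σ j))) (ev-y^ (k ∸ suc d) {Polyᴰ.determinant s λ i j → charMatrix A (σ i) (σ j)}
  -- The d = n - s deletions leave at least k - d factors of y. This number is positive and is
  -- written as a successor, so that `ev-y^` applies.
  (restrict-order d s (suc (k ∸ suc d)) (charMatrix A) (charMatrix-pencil A A-sym) σ inj
    (≡.subst (λ k → (y ^ₚ k) ∣ₚ Polyᴰ.determinant (d ℕ.+ s) (charMatrix A)) (≡.sym k≡)
      (≡.subst ((y ^ₚ k) ∣ₚ_) (charPoly≡ A) y^k∣χ))))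
  where
  d<k : d < k
  d<k = ℕₚ.+-cancelʳ-< s d k (≡.subst (d ℕ.+ s <_) (ℕₚ.+-comm s k) n<s+k)
  k≡ : d ℕ.+ suc (k ∸ suc d) ≡ k
  k≡ = ≡.trans (ℕₚ.+-suc d _) (ℕₚ.m+[n∸m]≡n d<k)

-- Distance and eccentricity

any-allFin⁻ : ∀ {m n} (p : Fin n → Bool) (f : Fin m → Fin n) → any p (tabulate f) ≡ true → ∃ λ i → p (f i) ≡ true
any-allFin⁻ {suc m} p f e with p (f fz) in eq
... | true  = fz , eq
... | false with any-allFin⁻ p (f ∘ fs) e
... | i , q = fs i , q

any-allFin⁺ : ∀ {m n} (p : Fin n → Bool) (f : Fin m → Fin n) i → p (f i) ≡ true → any p (tabulate f) ≡ true
any-allFin⁺ p f fz     e rewrite e = ≡.refl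
any-allFin⁺ p f (fs i) e rewrite any-allFin⁺ p (f ∘ fs) i e = ∨-zeroʳ (p (f fz))

least-≤ : ∀ fuel (f : ℕ → Bool) j → f j ≡ true → least fuel f ≤ j
least-≤ zero       f j       e = z≤n
least-≤ (suc fuel) f j       e with f zero in eq
least-≤ (suc fuel) f j       e | true  = z≤n
least-≤ (suc fuel) f zero    e | false = contradiction (≡.trans (≡.sym eq) e) λ ()
least-≤ (suc fuel) f (suc j) e | false = s≤s (least-≤ fuel (f ∘ suc) j e)

least-true : ∀ fuel (f : ℕ → Bool) j → f j ≡ true → j < fuel → f (least fuel f) ≡ true
least-true (suc fuel) f j       e j<fuel with f zero in eq
least-true (suc fuel) f j       e j<fuel       | true  = eq
least-true (suc fuel) f zero    e j<fuel       | false = contradiction (≡.trans (≡.sym eq) e) λ ()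
least-true (suc fuel) f (suc j) e (s≤s j<fuel) | false = least-true fuel (f ∘ suc) j e j<fuel

if-yes : ∀ {P : Set} (P? : Dec P) {A : Set} {a b : A} → P → (if ⌊ P? ⌋ then a else b) ≡ a
if-yes (yes _) p = ≡.refl
if-yes (no ¬p) p = contradiction p ¬p

if-no : ∀ {P : Set} (P? : Dec P) {A : Set} {a b : A} → ¬ P → (if ⌊ P? ⌋ then a else b) ≡ b
if-no (yes p) ¬p = contradiction p ¬p
if-no (no _)  ¬p = ≡.refl

module Metric {n} (G : Adj n) (simple : IsSimple G) (connected : Connected G) where

  -- An inductive form of `walkLe`, extended at the far end like it, so that walks can be
  -- concatenated, reversed and split by pattern matching.
  data Reach : ℕ → Fin n → Fin n → Set where
    here : ∀ {u} → Reach zero u u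
    stay : ∀ {k u v} → Reach k u v → Reach (suc k) u v
    step : ∀ {k u w v} → Reach k u w → G w v ≡ true → Reach (suc k) u v

  reach⁻ : ∀ k {u v} → walkLe G k u v ≡ true → Reach k u v
  reach⁻ zero {u} {v} e with u Fin.≟ v
  ... | yes ≡.refl = here
  reach⁻ (suc k) {u} {v} e with walkLe G k u v in eq
  ... | true  = stay (reach⁻ k eq)
  ... | false with any-allFin⁻ (λ w → walkLe G k u w ∧ G w v) id e
  ... | w , q with walkLe G k u w in eq′
  ... | true = step (reach⁻ k eq′) q

  reach⁺ : ∀ {k u v} → Reach k u v → walkLe G k u v ≡ true
  reach⁺ {u = u} here = ==-refl u
  reach⁺ (stay r) rewrite reach⁺ r = ≡.refl
  reach⁺ {suc k} {u} {v} (step {w = w} r e) rewrite any-allFin⁺ (λ w → walkLe G k u w ∧ G w v) id w (≡.cong₂ _∧_ (reach⁺ r) e) =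
    ∨-zeroʳ (walkLe G k u v)

  reach-trans : ∀ {j k u v w} → Reach j u v → Reach k v w → Reach (k ℕ.+ j) u w
  reach-trans r here       = r
  reach-trans r (stay s)   = stay (reach-trans r s)
  reach-trans r (step s e) = step (reach-trans r s) e

  reach-sym : ∀ {k u v} → Reach k u v → Reach k v u
  reach-sym here = here
  reach-sym (stay r) = stay (reach-sym r)
  reach-sym {suc k} {u} {v} (step {w = w} r e) =
    ≡.subst (λ k → Reach k v u) (ℕₚ.+-comm k 1) (reach-trans (step here (≡.trans (proj₁ simple v w) e)) (reach-sym r))

  d : Fin n → Fin n → ℕ
  d = dist G

  d-≤ : ∀ {k u v} → Reach k u v → d u v ≤ k
  d-≤ {k} {u} {v} r = least-≤ (suc n) (λ k → walkLe G k u v) k (reach⁺ r)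

  -- Connectedness provides a walk of length at most n, below the fuel suc n of `dist`, so the
  -- search stops at a success and not at its default value.
  reach-d : ∀ u v → Reach (d u v) u v
  reach-d u v = reach⁻ (d u v) (least-true (suc n) (λ k → walkLe G k u v) n (connected u v) (ℕₚ.n<1+n n))

  d-sym : ∀ u v → d u v ≡ d v u
  d-sym u v = ℕₚ.≤-antisym (d-≤ (reach-sym (reach-d v u))) (d-≤ (reach-sym (reach-d u v)))

  d-refl : ∀ u → d u u ≡ 0
  d-refl u = ℕₚ.n≤0⇒n≡0 (d-≤ here)

  triangle : ∀ u w v → d u v ≤ d u w ℕ.+ d w v
  triangle u w v = ≡.subst (d u v ≤_) (ℕₚ.+-comm (d w v) (d u w)) (d-≤ (reach-trans (reach-d u w) (reach-d w v)))

  d-edge : ∀ {u v} → G u v ≡ true → d u v ≤ 1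
  d-edge e = d-≤ (step here e)

  d≤0⇒≡ : ∀ {u v} → d u v ≤ 0 → u ≡ v
  d≤0⇒≡ {u} {v} d≤0 with d u v | reach-d u v
  d≤0⇒≡ _ | zero | here = ≡.refl

  d≤1⇒edge : ∀ {u v} → u ≢ v → d u v ≤ 1 → G u v ≡ true
  d≤1⇒edge {u} {v} u≢v d≤1 with d u v | reach-d u v
  d≤1⇒edge u≢v d≤1       | zero  | here = contradiction ≡.refl u≢v
  d≤1⇒edge u≢v (s≤s z≤n) | suc _ | stay here = contradiction ≡.refl u≢v
  d≤1⇒edge u≢v (s≤s z≤n) | suc _ | step here e = e

  ε : Fin n → ℕ
  ε = ecc G

  private
    max : ∀ {m} → (Fin m → Fin n) → Fin n → ℕ
    max f u = foldr _⊔_ 0 (map (d u) (tabulate f))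

    max-≥ : ∀ {m} (f : Fin m → Fin n) u i → d u (f i) ≤ max f u
    max-≥ f u fz     = ℕₚ.m≤m⊔n _ _
    max-≥ f u (fs i) = ℕₚ.≤-trans (max-≥ (f ∘ fs) u i) (ℕₚ.m≤n⊔m (d u (f fz)) _)

    max-attained : ∀ {m} (f : Fin m → Fin n) u → max f u ≡ 0 ⊎ (∃ λ i → d u (f i) ≡ max f u)
    max-attained {zero}  f u = inj₁ ≡.refl
    max-attained {suc m} f u with ℕₚ.⊔-sel (d u (f fz)) (max (f ∘ fs) u)
    ... | inj₁ e = inj₂ (fz , ≡.sym e)
    ... | inj₂ e with max-attained (f ∘ fs) u
    ... | inj₁ z       = inj₁ (≡.trans e z)
    ... | inj₂ (i , q) = inj₂ (fs i , ≡.trans q (≡.sym e))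

  d≤ε : ∀ u v → d u v ≤ ε u
  d≤ε u = max-≥ id u

  ε-attained : ∀ u → ∃ λ v → d u v ≡ ε u
  ε-attained u with max-attained id u
  ... | inj₁ z = u , ≡.trans (d-refl u) (≡.sym z)
  ... | inj₂ p = p

  ε-least : ∀ u {k} → (∀ v → d u v ≤ k) → ε u ≤ k
  ε-least u b with ε-attained u
  ... | v , e = ≡.subst (_≤ _) e (b v)

  A : Fin n → Fin n → ℕ
  A = eccMatrix G

  A-sym : ∀ u v → A u v ≡ A v u
  A-sym u v rewrite d-sym u v | ℕₚ.⊓-comm (ε u) (ε v) = ≡.refl

  A-hit : ∀ {u v} → d u v ≡ ε u ⊓ ε v → A u v ≡ d u v
  A-hit {u} {v} e = if-yes (d u v ℕ.≟ (ε u ⊓ ε v)) e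

  A-miss : ∀ {u v} → d u v ≢ ε u ⊓ ε v → A u v ≡ 0
  A-miss {u} {v} e = if-no (d u v ℕ.≟ (ε u ⊓ ε v)) e

  A-cases : ∀ u v → A u v ≡ 0 ⊎ (A u v ≡ d u v × d u v ≡ ε u ⊓ ε v)
  A-cases u v = go (d u v ℕ.≟ (ε u ⊓ ε v))
    where
    go : Dec (d u v ≡ ε u ⊓ ε v) → A u v ≡ 0 ⊎ (A u v ≡ d u v × d u v ≡ ε u ⊓ ε v)
    go (yes e) = inj₂ (A-hit e , e)
    go (no ¬e) = inj₁ (A-miss ¬e)

  A-diagonal : ∀ u → A u u ≡ 0
  A-diagonal u with A-cases u u
  ... | inj₁ e       = e
  ... | inj₂ (e , _) = ≡.trans e (d-refl u)

  -- The path is read from v back towards u and followed for k steps only. The depth condition is a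
  -- sum, which avoids truncated subtraction.
  Geodesic : Fin n → Fin n → ℕ → (ℕ → Fin n) → Set
  Geodesic u v k p = (∀ i → i < k → d (p i) (p (suc i)) ≤ 1) × (∀ i → i ≤ k → d u (p i) ℕ.+ i ≡ d u v) × p 0 ≡ v

  predecessor : ∀ {u v k} → d u v ≡ suc k → ∃ λ w → d u w ≡ k × d w v ≤ 1
  predecessor {u} {v} {k} e = go (≡.subst (λ m → Reach m u v) e (reach-d u v))
    where
    go : Reach (suc k) u v → ∃ λ w → d u w ≡ k × d w v ≤ 1
    go (stay r) = contradiction (≡.subst (_≤ k) e (d-≤ r)) ℕₚ.1+n≰n
    go (step {w = w} r q) = w , ℕₚ.≤-antisym (d-≤ r) (ℕₚ.+-cancelʳ-≤ 1 k (d u w) (begin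
      k ℕ.+ 1           ≡⟨ ℕₚ.+-comm k 1 ⟩
      suc k             ≡⟨ e ⟨
      d u v             ≤⟨ triangle u w v ⟩
      d u w ℕ.+ d w v   ≤⟨ ℕₚ.+-monoʳ-≤ (d u w) (d-edge q) ⟩
      d u w ℕ.+ 1       ∎)) , d-edge q
      where open ℕₚ.≤-Reasoning

  geodesic : ∀ k u v → k ≤ d u v → ∃ (Geodesic u v k)
  geodesic zero    u v k≤d = (λ _ → v) , (λ _ ()) , (λ { zero z≤n → ℕₚ.+-identityʳ _ }) , ≡.refl
  geodesic (suc k) u v k<d = cons (ℕ.pred (d u v)) (suc-pred′ k<d)
    where
    suc-pred′ : ∀ {k m} → suc k ≤ m → m ≡ suc (ℕ.pred m)
    suc-pred′ (s≤s _) = ≡.refl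
    cons : ∀ m → d u v ≡ suc m → ∃ (Geodesic u v (suc k))
    cons m e with predecessor e
    ... | w , dw , edge with geodesic k u w (≡.subst (k ≤_) (≡.sym dw) (ℕ.s≤s⁻¹ (≡.subst (suc k ≤_) e k<d)))
    ... | p , adj , dep , start = q , adj′ , dep′ , ≡.refl
      where
      q : ℕ → Fin n
      q zero    = v
      q (suc i) = p i
      adj′ : ∀ i → i < suc k → d (q i) (q (suc i)) ≤ 1
      adj′ zero    _         = ≡.subst (_≤ 1) (≡.trans (d-sym w v) (≡.cong (d v) (≡.sym start))) edge
      adj′ (suc i) (s≤s i<k) = adj i i<k
      dep′ : ∀ i → i ≤ suc k → d u (q i) ℕ.+ i ≡ d u v
      dep′ zero    _         = ℕₚ.+-identityʳ _
      dep′ (suc i) (s≤s i≤k) = ≡.trans (ℕₚ.+-suc _ i) (≡.trans (≡.cong suc (≡.trans (dep i i≤k) dw)) (≡.sym e))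

  -- Walking along the path bounds the distance from above. A shorter connection would bring p i
  -- closer to u than its depth allows, by the triangle inequality.
  geodesic-d : ∀ {u v k p} → Geodesic u v k p → ∀ i j → i ≤ j → j ≤ k → d (p i) (p j) ≡ j ∸ i
  geodesic-d {u} {v} {k} {p} (adj , dep , _) i j i≤j j≤k = ℕₚ.≤-antisym
    (≡.subst (λ l → d (p i) (p l) ≤ j ∸ i) (ℕₚ.m∸n+n≡m i≤j) (upper (j ∸ i) (≡.subst (_≤ k) (≡.sym (ℕₚ.m∸n+n≡m i≤j)) j≤k)))
    (ℕₚ.+-cancelˡ-≤ (d u (p j)) _ _ (ℕₚ.+-cancelʳ-≤ i _ _ (begin
      d u (p j) ℕ.+ (j ∸ i) ℕ.+ i       ≡⟨ ℕₚ.+-assoc (d u (p j)) (j ∸ i) i ⟩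
      d u (p j) ℕ.+ (j ∸ i ℕ.+ i)       ≡⟨ ≡.cong (d u (p j) ℕ.+_) (ℕₚ.m∸n+n≡m i≤j) ⟩
      d u (p j) ℕ.+ j                   ≡⟨ dep j j≤k ⟩
      d u v                             ≡⟨ dep i (ℕₚ.≤-trans i≤j j≤k) ⟨
      d u (p i) ℕ.+ i                   ≤⟨ ℕₚ.+-monoˡ-≤ i (triangle u (p j) (p i)) ⟩
      d u (p j) ℕ.+ d (p j) (p i) ℕ.+ i ≡⟨ ≡.cong (λ x → d u (p j) ℕ.+ x ℕ.+ i) (d-sym (p j) (p i)) ⟩
      d u (p j) ℕ.+ d (p i) (p j) ℕ.+ i ∎)))
    where
    open ℕₚ.≤-Reasoning
    upper : ∀ l → l ℕ.+ i ≤ k → d (p i) (p (l ℕ.+ i)) ≤ l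
    upper zero    _ = ℕₚ.≤-reflexive (d-refl (p i))
    upper (suc l) q = begin
      d (p i) (p (suc l ℕ.+ i))                                      ≤⟨ triangle (p i) (p (l ℕ.+ i)) (p (suc l ℕ.+ i)) ⟩
      d (p i) (p (l ℕ.+ i)) ℕ.+ d (p (l ℕ.+ i)) (p (suc l ℕ.+ i))    ≤⟨ ℕₚ.+-mono-≤ (upper l (ℕₚ.<⇒≤ q)) (adj (l ℕ.+ i) q) ⟩
      l ℕ.+ 1                                                        ≡⟨ ℕₚ.+-comm l 1 ⟩
      suc l                                                          ∎

  Universal : Fin n → Set
  Universal u = ∀ v → u ≢ v → G u v ≡ true

  NonUniversal : Fin n → Set
  NonUniversal u = ∃ λ v → u ≢ v × G u v ≡ false

  1≤d : ∀ {u v} → u ≢ v → 1 ≤ d u v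
  1≤d u≢v = ℕₚ.≰⇒> (u≢v ∘ d≤0⇒≡)

  ε≤1⇒universal : ∀ {u} → ε u ≤ 1 → Universal u
  ε≤1⇒universal {u} ε≤1 v u≢v = d≤1⇒edge u≢v (ℕₚ.≤-trans (d≤ε u v) ε≤1)

  ε≰1⇒nonUniversal : ∀ {u} → ¬ ε u ≤ 1 → NonUniversal u
  ε≰1⇒nonUniversal {u} ε≰1 with ε-attained u
  ... | v , far = v , (λ u≡v → ε≰1 (≡.subst (_≤ 1) (≡.trans (≡.sym (d-refl u)) (≡.trans (≡.cong (d u) u≡v) far)) z≤n))
                    , ¬-not λ edge → ε≰1 (≡.subst (_≤ 1) far (d-edge edge))

  d-universal : ∀ {u} → Universal u → ∀ v → d u v ≤ 1
  d-universal {u} univ v = go (u Fin.≟ v)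
    where
    go : Dec (u ≡ v) → d u v ≤ 1
    go (yes ≡.refl) = ≡.subst (_≤ 1) (≡.sym (d-refl u)) z≤n
    go (no u≢v)     = d-edge (univ v u≢v)

  -- A dominating vertex has eccentricity 1, not 0, because a second vertex exists. The minimum of
  -- the eccentricities is then 1 whatever the other one is.
  A-universal : ∀ {u v} → Universal u → u ≢ v → A u v ≡ 1
  A-universal {u} {v} univ u≢v = ≡.trans (A-hit (≡.trans d≡1 (≡.sym min≡1))) d≡1
    where
    d≡1 : d u v ≡ 1
    d≡1 = ℕₚ.≤-antisym (d-universal univ v) (1≤d u≢v)
    min≡1 : ε u ⊓ ε v ≡ 1
    min≡1 = ℕₚ.≤-antisym (ℕₚ.≤-trans (ℕₚ.m⊓n≤m (ε u) (ε v)) (ε-least u (d-universal univ)))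
      (ℕₚ.⊓-glb (ℕₚ.≤-trans (1≤d u≢v) (d≤ε u v)) (ℕₚ.≤-trans (1≤d (u≢v ∘ ≡.sym)) (d≤ε v u)))

  ε-nonUniversal : ∀ {u w} → Universal w → NonUniversal u → ε u ≡ 2
  ε-nonUniversal {u} {w} univ (v , u≢v , e) = ℕₚ.≤-antisym
    (ε-least u λ x → ℕₚ.≤-trans (triangle u w x) (ℕₚ.+-mono-≤ (≡.subst (_≤ 1) (d-sym w u) (d-universal univ u)) (d-universal univ x)))
    (ℕₚ.≤-trans (ℕₚ.≰⇒> λ d≤1 → contradiction (≡.trans (≡.sym (d≤1⇒edge u≢v d≤1)) e) λ ()) (d≤ε u v))

  -- Going through w shows that both eccentricities are 2, so an entry survives exactly at distance
  -- 2, that is, between distinct non-adjacent vertices.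
  A-nonUniversal : ∀ {u v w} → Universal w → NonUniversal u → NonUniversal v → u ≢ v → A u v ≡ (if G u v then 0 else 2)
  A-nonUniversal {u} {v} univ nu nv u≢v with G u v in eq
  ... | true  = A-miss λ e → ℕₚ.<⇒≢ (s≤s (d-edge eq)) (≡.trans e min≡2)
    where
    min≡2 : ε u ⊓ ε v ≡ 2
    min≡2 = ≡.cong₂ _⊓_ (ε-nonUniversal univ nu) (ε-nonUniversal univ nv)
  ... | false = ≡.trans (A-hit (≡.trans d≡2 (≡.sym min≡2))) d≡2
    where
    min≡2 : ε u ⊓ ε v ≡ 2
    min≡2 = ≡.cong₂ _⊓_ (ε-nonUniversal univ nu) (ε-nonUniversal univ nv)
    d≡2 : d u v ≡ 2
    d≡2 = ℕₚ.≤-antisym (≡.subst (d u v ≤_) (ε-nonUniversal univ nu) (d≤ε u v))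
      (ℕₚ.≰⇒> λ d≤1 → contradiction (≡.trans (≡.sym (d≤1⇒edge u≢v d≤1)) eq) λ ())

-- Splitting the vertex set and the pigeonhole principle

record Partition {n} (p : Fin n → Bool) : Set where
  field
    {k r}     : ℕ
    to        : Fin n → Fin k ⊎ Fin r
    from      : Fin k ⊎ Fin r → Fin n
    to-from   : ∀ x → to (from x) ≡ x
    from-to   : ∀ u → from (to u) ≡ u
    from-inj₁ : ∀ a → p (from (inj₁ a)) ≡ true
    from-inj₂ : ∀ b → p (from (inj₂ b)) ≡ false
    size      : k ℕ.+ r ≡ n

  from-injective : Injective _≡_ _≡_ from
  from-injective {x} {x′} e = ≡.trans (≡.sym (to-from x)) (≡.trans (≡.cong to e) (to-from x′))

partition : ∀ {n} (p : Fin n → Bool) → Partition p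
partition {zero}  p = record
  { k = 0 ; r = 0 ; to = λ () ; from = λ { (inj₁ ()) ; (inj₂ ()) } ; to-from = λ { (inj₁ ()) ; (inj₂ ()) }
  ; from-to = λ () ; from-inj₁ = λ () ; from-inj₂ = λ () ; size = ≡.refl }
partition {suc n} p with p fz in eq | partition (p ∘ fs)
... | true | π = record
  { k = suc k ; r = r ; to = to′ ; from = from′
  ; to-from = λ { (inj₁ fz) → ≡.refl ; (inj₁ (fs a)) → ≡.cong (Sum.map₁ fs) (to-from (inj₁ a)) ; (inj₂ b) → ≡.cong (Sum.map₁ fs) (to-from (inj₂ b)) }
  ; from-to = λ { fz → ≡.refl ; (fs u) → ≡.trans (from-map (to u)) (≡.cong fs (from-to u)) }
  ; from-inj₁ = λ { fz → eq ; (fs a) → from-inj₁ a } ; from-inj₂ = from-inj₂ ; size = ≡.cong suc size }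
  where
  open Partition π
  to′ : Fin (suc n) → Fin (suc k) ⊎ Fin r
  to′ fz     = inj₁ fz
  to′ (fs u) = Sum.map₁ fs (to u)
  from′ : Fin (suc k) ⊎ Fin r → Fin (suc n)
  from′ (inj₁ fz)     = fz
  from′ (inj₁ (fs a)) = fs (from (inj₁ a))
  from′ (inj₂ b)      = fs (from (inj₂ b))
  from-map : ∀ x → from′ (Sum.map₁ fs x) ≡ fs (from x)
  from-map (inj₁ a) = ≡.refl
  from-map (inj₂ b) = ≡.refl
... | false | π = record
  { k = k ; r = suc r ; to = to′ ; from = from′
  ; to-from = λ { (inj₂ fz) → ≡.refl ; (inj₂ (fs b)) → ≡.cong (Sum.map₂ fs) (to-from (inj₂ b)) ; (inj₁ a) → ≡.cong (Sum.map₂ fs) (to-from (inj₁ a)) }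
  ; from-to = λ { fz → ≡.refl ; (fs u) → ≡.trans (from-map (to u)) (≡.cong fs (from-to u)) }
  ; from-inj₁ = from-inj₁ ; from-inj₂ = λ { fz → eq ; (fs b) → from-inj₂ b } ; size = ≡.trans (ℕₚ.+-suc k r) (≡.cong suc size) }
  where
  open Partition π
  to′ : Fin (suc n) → Fin k ⊎ Fin (suc r)
  to′ fz     = inj₂ fz
  to′ (fs u) = Sum.map₂ fs (to u)
  from′ : Fin k ⊎ Fin (suc r) → Fin (suc n)
  from′ (inj₂ fz)     = fz
  from′ (inj₂ (fs b)) = fs (from (inj₂ b))
  from′ (inj₁ a)      = fs (from (inj₁ a))
  from-map : ∀ x → from′ (Sum.map₂ fs x) ≡ fs (from x)
  from-map (inj₁ a) = ≡.refl
  from-map (inj₂ b) = ≡.refl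

record Embedding {n} (s : ℕ) (p : Fin n → Set) : Set where
  field
    σ         : Fin s → Fin n
    injective : Injective _≡_ _≡_ σ
    holds     : ∀ i → p (σ i)

inject≤-injective′ : ∀ {m n} (m≤n : m ≤ n) → Injective _≡_ _≡_ (λ i → Fin.inject≤ {m} {n} i m≤n)
inject≤-injective′ m≤n {i} {j} e = inject≤-injective m≤n m≤n i j e

-- Three classes with at most five vertices each hold at most 15. The hypothesis on c is phrased by
-- exclusion to fit two nested partitions, the second taken on the complement of the first class.
sixAlike : ∀ {n} → 16 ≤ n → (c : Fin n → ℕ) (c₁ c₂ c₃ : ℕ) →
  (∀ u → c u ≢ c₁ → c u ≢ c₂ → c u ≡ c₃) →
  Embedding 6 (λ u → c u ≡ c₁) ⊎ Embedding 6 (λ u → c u ≡ c₂) ⊎ Embedding 6 (λ u → c u ≡ c₃)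
sixAlike {n} 16≤n c c₁ c₂ c₃ only = choose₁ (6 ℕ.≤? P₁.k)
  where
  π₁ : Partition (λ u → ⌊ c u ℕ.≟ c₁ ⌋)
  π₁ = partition _
  module P₁ = Partition π₁
  π₂ : Partition (λ i → ⌊ c (P₁.from (inj₂ i)) ℕ.≟ c₂ ⌋)
  π₂ = partition _
  module P₂ = Partition π₂

  true⁻ : ∀ {P : Set} (P? : Dec P) → ⌊ P? ⌋ ≡ true → P
  true⁻ (yes p) _ = p
  false⁻ : ∀ {P : Set} (P? : Dec P) → ⌊ P? ⌋ ≡ false → ¬ P
  false⁻ (no ¬p) _ = ¬p

  inj₁-injective′ : ∀ {m l} → Injective _≡_ _≡_ (inj₁ {A = Fin m} {B = Fin l})
  inj₁-injective′ ≡.refl = ≡.refl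
  inj₂-injective′ : ∀ {m l} → Injective _≡_ _≡_ (inj₂ {A = Fin m} {B = Fin l})
  inj₂-injective′ ≡.refl = ≡.refl

  16≰10 : ∀ {m} → m ≤ 15 → n ≡ m → ⊥
  16≰10 m≤15 ≡.refl = ℕₚ.<⇒≱ 16≤n m≤15

  choose₂ : ¬ 6 ≤ P₁.k → Dec (6 ≤ P₂.k) → Dec (6 ≤ P₂.r) →
    Embedding 6 (λ u → c u ≡ c₁) ⊎ Embedding 6 (λ u → c u ≡ c₂) ⊎ Embedding 6 (λ u → c u ≡ c₃)
  choose₂ _ (yes q) _ = inj₂ (inj₁ record
    { σ = λ i → P₁.from (inj₂ (P₂.from (inj₁ (Fin.inject≤ i q))))
    ; injective = λ e → inject≤-injective′ q (inj₁-injective′ (P₂.from-injective (inj₂-injective′ (P₁.from-injective e))))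
    ; holds = λ i → true⁻ (_ ℕ.≟ _) (P₂.from-inj₁ (Fin.inject≤ i q)) })
  choose₂ _ (no _) (yes q) = inj₂ (inj₂ record
    { σ = λ i → P₁.from (inj₂ (P₂.from (inj₂ (Fin.inject≤ i q))))
    ; injective = λ e → inject≤-injective′ q (inj₂-injective′ (P₂.from-injective (inj₂-injective′ (P₁.from-injective e))))
    ; holds = λ i → only _ (false⁻ (_ ℕ.≟ _) (P₁.from-inj₂ (P₂.from (inj₂ (Fin.inject≤ i q)))))
                           (false⁻ (_ ℕ.≟ _) (P₂.from-inj₂ (Fin.inject≤ i q))) })
  choose₂ ¬k₁ (no ¬k₂) (no ¬r₂) = ⊥-elim (16≰10
    (ℕₚ.+-mono-≤ (ℕ.s≤s⁻¹ (ℕₚ.≰⇒> ¬k₁)) (ℕₚ.+-mono-≤ (ℕ.s≤s⁻¹ (ℕₚ.≰⇒> ¬k₂)) (ℕ.s≤s⁻¹ (ℕₚ.≰⇒> ¬r₂))))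
    (≡.sym (≡.trans (≡.cong (P₁.k ℕ.+_) P₂.size) P₁.size)))

  choose₁ : Dec (6 ≤ P₁.k) →
    Embedding 6 (λ u → c u ≡ c₁) ⊎ Embedding 6 (λ u → c u ≡ c₂) ⊎ Embedding 6 (λ u → c u ≡ c₃)
  choose₁ (yes q) = inj₁ record
    { σ = λ i → P₁.from (inj₁ (Fin.inject≤ i q))
    ; injective = λ e → inject≤-injective′ q (inj₁-injective′ (P₁.from-injective e))
    ; holds = λ i → true⁻ (_ ℕ.≟ _) (P₁.from-inj₁ (Fin.inject≤ i q)) }
  choose₁ (no ¬q) = choose₂ ¬q (6 ℕ.≤? P₂.k) (6 ℕ.≤? P₂.r)

-- Congruences of determinants and nonsingular patterns

module Congruence (m : ℕ) where
  open import Data.Integer.Solver using (module +-*-Solver)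
  open +-*-Solver

  record Cong (a b : ℤ) : Set where
    constructor _by_
    field
      quotient : ℤ
      equality : a ≡ b ℤ.+ quotient ℤ.* + m
  infix 1 _by_

  cong-≡ : ∀ {a b} → a ≡ b → Cong a b
  cong-≡ {a} ≡.refl = + 0 by ≡.sym (≡.trans (≡.cong (λ z → a ℤ.+ z) (ℤₚ.*-zeroˡ (+ m))) (ℤₚ.+-identityʳ a))

  cong-+ : ∀ {a b c d} → Cong a b → Cong c d → Cong (a ℤ.+ c) (b ℤ.+ d)
  cong-+ {b = b} {d = d} (k by ≡.refl) (l by ≡.refl) = k ℤ.+ l by
    solve 5 (λ b d k l m → (b :+ k :* m) :+ (d :+ l :* m) := (b :+ d) :+ (k :+ l) :* m) ≡.refl b d k l (+ m)

  cong-* : ∀ {a b c d} → Cong a b → Cong c d → Cong (a ℤ.* c) (b ℤ.* d)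
  cong-* {b = b} {d = d} (k by ≡.refl) (l by ≡.refl) = b ℤ.* l ℤ.+ k ℤ.* d ℤ.+ k ℤ.* + m ℤ.* l by
    solve 5 (λ b d k l m → (b :+ k :* m) :* (d :+ l :* m) := b :* d :+ (b :* l :+ k :* d :+ k :* m :* l) :* m) ≡.refl b d k l (+ m)

  cong-neg : ∀ {a b} → Cong a b → Cong (ℤ.- a) (ℤ.- b)
  cong-neg {b = b} (k by ≡.refl) = ℤ.- k by solve 3 (λ b k m → :- (b :+ k :* m) := :- b :+ (:- k) :* m) ≡.refl b k (+ m)

  cong-sgn : ∀ k {a b} → Cong a b → Cong (ℤᴰ.sgn k a) (ℤᴰ.sgn k b)
  cong-sgn zero    c = c
  cong-sgn (suc k) c = cong-neg (cong-sgn k c)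

  cong-sum : ∀ {n} {f g : Fin n → ℤ} → (∀ i → Cong (f i) (g i)) → Cong (Z.sum f) (Z.sum g)
  cong-sum {zero}  c = cong-≡ ≡.refl
  cong-sum {suc n} c = cong-+ (c fz) (cong-sum (c ∘ fs))

  cong-det : ∀ n {M N : Fin n → Fin n → ℤ} → (∀ i j → Cong (M i j) (N i j)) →
    Cong (ℤᴰ.determinant n M) (ℤᴰ.determinant n N)
  cong-det zero    c = cong-≡ ≡.refl
  cong-det (suc n) {M} {N} c = cong-sum λ j → cong-sgn (toℕ j) (cong-* (c fz j)
    (cong-det n {ℤᴰ.minor M j} {ℤᴰ.minor N j} λ i k → c (fs i) (punchIn j k)))

  nonzero : ∀ {a b} → Cong a b → ¬ (m ∣ ℤ.∣ b ∣) → a ≢ + 0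
  nonzero {b = b} (k by e) ¬m∣b ≡.refl = ¬m∣b (divides ℤ.∣ ℤ.- k ∣ (≡.trans (≡.cong ℤ.∣_∣ b≡) (ℤₚ.abs-* (ℤ.- k) (+ m))))
    where
    b≡ : b ≡ ℤ.- k ℤ.* + m
    b≡ = ≡.trans (solve 3 (λ b k m → b := (b :+ k :* m) :+ (:- k) :* m) ≡.refl b k (+ m))
      (≡.trans (≡.cong (ℤ._+ ℤ.- k ℤ.* + m) (≡.sym e)) (ℤₚ.+-identityˡ _))

-- Injectivity keeps distinct indices distinct, so restricting along σ commutes with adding the
-- identity.
shifted-∘ : ∀ {m n} (A : Fin n → Fin n → ℕ) (B : Fin m → Fin m → ℕ) (σ : Fin m → Fin n) → Injective _≡_ _≡_ σ →
  (∀ i j → A (σ i) (σ j) ≡ B i j) → ∀ i j → shiftedMatrix A (σ i) (σ j) ≡ shiftedMatrix B i j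
shifted-∘ A B σ inj e i j with i Fin.≟ j
... | yes ≡.refl rewrite ==-refl (σ i) | e i i = ≡.refl
... | no i≢j     rewrite ==-≢ (i≢j ∘ inj) | e i j = ≡.refl

arrow : ∀ {n} → (Fin n → ℕ) → Fin (suc n) → Fin (suc n) → ℕ
arrow w fz     fz     = 0
arrow w fz     (fs j) = w j
arrow w (fs i) fz     = w i
arrow w (fs i) (fs j) = 0

-- The weights join the end of a geodesic to its next five vertices; the first two of these are so
-- near that their entries always vanish.
weights : ℕ → ℕ → ℕ → Fin 5 → ℕ
weights a b c fz                     = 0
weights a b c (fs fz)                = 0
weights a b c (fs (fs fz))           = a
weights a b c (fs (fs (fs fz)))      = b
weights a b c (fs (fs (fs (fs _))))  = c

-- A record, so that comparing types never unfolds the determinant of an open matrix.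
record Singular {s} (B : Fin s → Fin s → ℕ) : Set where
  constructor singular
  field det≡0 : ℤᴰ.determinant s (shiftedMatrix B) ≡ + 0

-- In each of the eight cases the determinant 1 - a² - b² - c² evaluates to a literal, which is 1
-- when all three vanish and at most -8 otherwise.
arrow-nonsingular : ∀ {a b c} → a ≡ 0 ⊎ a ≡ 3 → b ≡ 0 ⊎ b ≡ 4 → c ≡ 0 ⊎ c ≡ 5 → ¬ Singular (arrow (weights a b c))
arrow-nonsingular (inj₁ ≡.refl) (inj₁ ≡.refl) (inj₁ ≡.refl) (singular ())
arrow-nonsingular (inj₁ ≡.refl) (inj₁ ≡.refl) (inj₂ ≡.refl) (singular ())
arrow-nonsingular (inj₁ ≡.refl) (inj₂ ≡.refl) (inj₁ ≡.refl) (singular ())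
arrow-nonsingular (inj₁ ≡.refl) (inj₂ ≡.refl) (inj₂ ≡.refl) (singular ())
arrow-nonsingular (inj₂ ≡.refl) (inj₁ ≡.refl) (inj₁ ≡.refl) (singular ())
arrow-nonsingular (inj₂ ≡.refl) (inj₁ ≡.refl) (inj₂ ≡.refl) (singular ())
arrow-nonsingular (inj₂ ≡.refl) (inj₂ ≡.refl) (inj₁ ≡.refl) (singular ())
arrow-nonsingular (inj₂ ≡.refl) (inj₂ ≡.refl) (inj₂ ≡.refl) (singular ())

-- Radius at least two

module LowRank {n} (16≤n : 16 ≤ n) (G : Adj n) (simple : IsSimple G) (connected : Connected G)
  (order : (y ^ₚ (n ∸ 5)) ∣ₚ charPoly (eccMatrix G)) where
  open Metric G simple connected

  minor-zero : ∀ {s} → 6 ≤ s → (B : Fin s → Fin s → ℕ) (σ : Fin s → Fin n) → Injective _≡_ _≡_ σ →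
    (∀ i j → A (σ i) (σ j) ≡ B i j) → Singular B
  minor-zero {s} 6≤s B σ inj e = singular (≡.trans
    (ℤᴰ.det-cong s λ i j → ≡.sym (shifted-∘ A B σ inj e i j))
    (principal-minor-zero {k = n ∸ 5} A A-sym σ inj n<s+k order))
    where
    n<s+k : n < s ℕ.+ (n ∸ 5)
    n<s+k = begin
      suc n                  ≡⟨ ≡.cong suc (ℕₚ.m+[n∸m]≡n (ℕₚ.≤-trans (ℕₚ.m≤m+n 5 11) 16≤n)) ⟨
      6 ℕ.+ (n ∸ 5)          ≤⟨ ℕₚ.+-monoˡ-≤ (n ∸ 5) 6≤s ⟩
      s ℕ.+ (n ∸ 5)          ∎
      where open ℕₚ.≤-Reasoning

  -- Between vertices of eccentricity e the entries are 0 or e, so A + I is the identity modulo e.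
  no-six-alike : ∀ e → 2 ≤ e → ¬ Embedding 6 (λ u → ε u ≡ e)
  no-six-alike e 2≤e emb = nonzero
    (cong-det 6 {shiftedMatrix B} {shiftedMatrix (λ _ _ → 0)} entry)
    -- The comparison matrix is minus the identity of even order 6, with determinant 1, which no e ≥
    -- 2 divides.
    (λ e∣1 → ℕₚ.<⇒≱ 2≤e (ℕₚ.≤-reflexive (∣1⇒≡1 e∣1)))
    (Singular.det≡0 (minor-zero ℕₚ.≤-refl B σ injective λ i j → ≡.refl))
    where
    open Embedding emb
    open Congruence e
    B : Fin 6 → Fin 6 → ℕ
    B i j = A (σ i) (σ j)
    entry : ∀ i j → Cong (shiftedMatrix B i j) (shiftedMatrix (λ _ _ → 0) i j)
    entry i j with i Fin.≟ j
    ... | yes ≡.refl = cong-≡ (≡.cong (λ a → ev ((ℤ.- (+ a)) ∷ + 1 ∷ [])) (A-diagonal (σ i)))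
    ... | no i≢j with A-cases (σ i) (σ j)
    ... | inj₁ z = cong-≡ (≡.cong (λ a → ev ((ℤ.- (+ a)) ∷ [])) z)
    ... | inj₂ (a≡d , d≡) = ℤ.- (+ 1) by (≡.trans (≡.cong (λ a → ev ((ℤ.- (+ a)) ∷ []))
          (≡.trans a≡d (≡.trans d≡ (≡.trans (≡.cong₂ _⊓_ (holds i) (holds j)) (ℕₚ.⊓-idem e)))))
          (≡.trans (ℤₚ.+-identityʳ (ℤ.- (+ e))) (≡.trans (≡.sym (ℤₚ.-1*i≡-i (+ e))) (≡.sym (ℤₚ.+-identityˡ _)))))

  -- Take the first six vertices p 0, ..., p 5 of a geodesic from v to u. The eccentricity of p i is
  -- at least i, because of p 0, and at least 6 - i, because of u. Among p 1, ..., p 5 every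
  -- distance is smaller than both eccentricities, so these entries vanish. From p 0 the distance j
  -- lies below both bounds for j ≤ 2, and for j = 3, 4, 5 the entry is 0 or j. What is left is the
  -- arrow pattern.
  no-long-geodesic : ∀ u v → ¬ 6 ≤ d u v
  no-long-geodesic u v 6≤d = contradict (geodesic 5 u v (ℕₚ.≤-trans (ℕₚ.n≤1+n 5) 6≤d))
    where
    contradict : ∃ (Geodesic u v 5) → ⊥
    contradict (p , geo@(adj , dep , start)) = arrow-nonsingular (far 3 (s≤s (s≤s (s≤s z≤n)))) (far 4 (s≤s (s≤s (s≤s (s≤s z≤n))))) (far 5 ℕₚ.≤-refl)
      (minor-zero ℕₚ.≤-refl (arrow W) σ σ-injective entry)
      where
      σ : Fin 6 → Fin n
      σ i = p (toℕ i)

      i≤5 : ∀ (i : Fin 6) → toℕ i ≤ 5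
      i≤5 i = ℕ.s≤s⁻¹ (toℕ<n i)

      σ-injective : Injective _≡_ _≡_ σ
      σ-injective {i} {j} e = toℕ-injective (ℕₚ.+-cancelˡ-≡ (d u (σ i)) _ _ (≡.trans (dep (toℕ i) (i≤5 i))
        (≡.sym (≡.trans (≡.cong (λ x → d u x ℕ.+ toℕ j) e) (dep (toℕ j) (i≤5 j))))))

      W : Fin 5 → ℕ
      W = weights (A (p 0) (p 3)) (A (p 0) (p 4)) (A (p 0) (p 5))

      back : ∀ i → i ≤ 5 → 6 ≤ ε (p i) ℕ.+ i
      back i i≤5 = begin
        6                     ≤⟨ 6≤d ⟩
        d u v                 ≡⟨ dep i i≤5 ⟨
        d u (p i) ℕ.+ i       ≡⟨ ≡.cong (ℕ._+ i) (d-sym u (p i)) ⟩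
        d (p i) u ℕ.+ i       ≤⟨ ℕₚ.+-monoˡ-≤ i (d≤ε (p i) u) ⟩
        ε (p i) ℕ.+ i         ∎
        where open ℕₚ.≤-Reasoning

      front : ∀ i → i ≤ 5 → i ≤ ε (p i)
      front i i≤5 = ≡.subst (_≤ ε (p i)) (≡.trans (d-sym (p i) (p 0)) (geodesic-d geo 0 i z≤n i≤5)) (d≤ε (p i) (p 0))

      inner : ∀ i j → suc i < j → j ≤ 5 → A (p (suc i)) (p j) ≡ 0
      inner i j i<j j≤5 = A-miss λ e → ℕₚ.<⇒≢ (less e) e
        where
        dist≡ : d (p (suc i)) (p j) ≡ j ∸ suc i
        dist≡ = geodesic-d geo (suc i) j (ℕₚ.<⇒≤ i<j) j≤5
        less : d (p (suc i)) (p j) ≡ ε (p (suc i)) ⊓ ε (p j) → d (p (suc i)) (p j) < ε (p (suc i)) ⊓ ε (p j)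
        less _ = ≡.subst (_< ε (p (suc i)) ⊓ ε (p j)) (≡.sym dist≡) (ℕₚ.⊓-glb
          (ℕₚ.+-cancelʳ-≤ (suc i) _ _ (begin
            suc (j ∸ suc i) ℕ.+ suc i    ≡⟨ ≡.cong suc (ℕₚ.m∸n+n≡m (ℕₚ.<⇒≤ i<j)) ⟩
            suc j                        ≤⟨ s≤s j≤5 ⟩
            6                            ≤⟨ back (suc i) (ℕₚ.≤-trans (ℕₚ.<⇒≤ i<j) j≤5) ⟩
            ε (p (suc i)) ℕ.+ suc i      ∎))
          (ℕₚ.≤-trans (ℕₚ.∸-monoʳ-< {j} {suc i} {0} (s≤s z≤n) (ℕₚ.<⇒≤ i<j)) (front j j≤5)))
          where open ℕₚ.≤-Reasoning

      near : ∀ j → j ≤ 2 → A (p 0) (p j) ≡ 0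
      near zero j≤2 = A-diagonal (p 0)
      near (suc j) j≤2 = A-miss λ e → ℕₚ.<⇒≢ less e
        where
        j≤5 : suc j ≤ 5
        j≤5 = ℕₚ.≤-trans j≤2 (ℕₚ.m≤m+n 2 3)
        less : d (p 0) (p (suc j)) < ε (p 0) ⊓ ε (p (suc j))
        less = ≡.subst (_< ε (p 0) ⊓ ε (p (suc j))) (≡.sym (geodesic-d geo 0 (suc j) z≤n j≤5)) (ℕₚ.⊓-glb
          (ℕₚ.≤-trans (s≤s j≤5) (≡.subst (6 ≤_) (ℕₚ.+-identityʳ _) (back 0 z≤n)))
          (ℕₚ.+-cancelʳ-≤ (suc j) _ _ (ℕₚ.≤-trans (ℕₚ.+-mono-≤ (s≤s j≤2) j≤2) (ℕₚ.≤-trans (ℕₚ.n≤1+n 5) (back (suc j) j≤5)))))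

      far : ∀ j → j ≤ 5 → A (p 0) (p j) ≡ 0 ⊎ A (p 0) (p j) ≡ j
      far j j≤5 with A-cases (p 0) (p j)
      ... | inj₁ z       = inj₁ z
      ... | inj₂ (e , _) = inj₂ (≡.trans e (geodesic-d geo 0 j z≤n j≤5))

      head : ∀ j → A (p 0) (p (suc (toℕ j))) ≡ W j
      head fz                          = near 1 (s≤s z≤n)
      head (fs fz)                     = near 2 ℕₚ.≤-refl
      head (fs (fs fz))                = ≡.refl
      head (fs (fs (fs fz)))           = ≡.refl
      head (fs (fs (fs (fs fz))))      = ≡.refl

      entry : ∀ i j → A (σ i) (σ j) ≡ arrow W i j
      entry fz     fz     = A-diagonal (p 0)
      entry fz     (fs j) = head j
      entry (fs i) fz     = ≡.trans (A-sym (σ (fs i)) (p 0)) (head i)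
      entry (fs i) (fs j) with ℕₚ.<-cmp (toℕ i) (toℕ j)
      ... | tri< i<j _ _ = inner (toℕ i) (toℕ (fs j)) (s≤s i<j) (i≤5 (fs j))
      ... | tri≈ _ e _   = ≡.subst (λ k → A (σ (fs i)) (p (suc k)) ≡ 0) e (A-diagonal (σ (fs i)))
      ... | tri> _ _ j<i = ≡.trans (A-sym (σ (fs i)) (σ (fs j))) (inner (toℕ j) (toℕ (fs i)) (s≤s j<i) (i≤5 (fs i)))

  radius≤1 : ∃ λ w → ε w ≤ 1
  radius≤1 = decidable-stable (any? (λ w → ε w ℕ.≤? 1)) λ ¬p → large ¬p (any? (λ w → ε w ℕ.≟ 5))
    where
    module _ (¬p : ¬ ∃ λ w → ε w ≤ 1) where
      2≤ε : ∀ u → 2 ≤ ε u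
      2≤ε u = ℕₚ.≰⇒> λ e → ¬p (u , e)

      ε≤5 : ∀ u → ε u ≤ 5
      ε≤5 u = ε-least u λ v → ℕ.s≤s⁻¹ (ℕₚ.≰⇒> (no-long-geodesic u v))

      between : ∀ {k} → 2 ≤ k → k ≤ 5 → k ≡ 2 ⊎ k ≡ 3 ⊎ k ≡ 4 ⊎ k ≡ 5
      between {2} _ _ = inj₁ ≡.refl
      between {3} _ _ = inj₂ (inj₁ ≡.refl)
      between {4} _ _ = inj₂ (inj₂ (inj₁ ≡.refl))
      between {5} _ _ = inj₂ (inj₂ (inj₂ ≡.refl))
      between {suc (suc (suc (suc (suc (suc _)))))} _ (s≤s (s≤s (s≤s (s≤s (s≤s ())))))
      between {1} (s≤s ()) _

      absurd : ∀ {a b c} → 2 ≤ a → 2 ≤ b → 2 ≤ c →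
        ¬ (Embedding 6 (λ u → ε u ≡ a) ⊎ Embedding 6 (λ u → ε u ≡ b) ⊎ Embedding 6 (λ u → ε u ≡ c))
      absurd 2≤a 2≤b 2≤c (inj₁ e)        = no-six-alike _ 2≤a e
      absurd 2≤a 2≤b 2≤c (inj₂ (inj₁ e)) = no-six-alike _ 2≤b e
      absurd 2≤a 2≤b 2≤c (inj₂ (inj₂ e)) = no-six-alike _ 2≤c e

      large : ¬ Dec (∃ λ w → ε w ≡ 5)
      large (no ¬5) = absurd (s≤s (s≤s z≤n)) (s≤s (s≤s z≤n)) (s≤s (s≤s z≤n)) (sixAlike 16≤n ε 2 3 4 λ u ≢2 ≢3 →
        Sum.[ (λ e → contradiction e ≢2) , Sum.[ (λ e → contradiction e ≢3) , Sum.[ id , (λ e → contradiction (u , e) ¬5) ] ] ] (between (2≤ε u) (ε≤5 u)))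
      large (yes (w , w5)) = absurd (s≤s (s≤s z≤n)) (s≤s (s≤s z≤n)) (s≤s (s≤s z≤n)) (sixAlike 16≤n ε 3 4 5 λ u ≢3 ≢4 →
        Sum.[ (λ e → contradiction e (≢2 u)) , Sum.[ (λ e → contradiction e ≢3) , Sum.[ (λ e → contradiction e ≢4) , id ] ] ] (between (2≤ε u) (ε≤5 u)))
        where
        -- Passing through a vertex of eccentricity 2 connects any two vertices within distance 4.
        ≢2 : ∀ u → ε u ≢ 2
        ≢2 u e with ε-attained w
        ... | v , far = ℕₚ.<⇒≱ (ℕₚ.n<1+n 4) (begin
          5                      ≡⟨ ≡.trans far w5 ⟨
          d w v                  ≤⟨ triangle w u v ⟩
          d w u ℕ.+ d u v        ≤⟨ ℕₚ.+-mono-≤ (≡.subst (_≤ ε u) (d-sym u w) (d≤ε u w)) (d≤ε u v) ⟩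
          ε u ℕ.+ ε u            ≡⟨ ≡.cong₂ ℕ._+_ e e ⟩
          4                      ∎)
          where open ℕₚ.≤-Reasoning

-- Joins with complete graphs

-- Recursion on k, instead of `splitAt`, peels off one dominating vertex at a time, so the
-- hypotheses of `det-twins` hold by reduction.
joinEcc : ∀ {r} k → (Fin r → Fin r → ℕ) → Fin (k ℕ.+ r) → Fin (k ℕ.+ r) → ℕ
joinEcc zero    C i      j      = C i j
joinEcc (suc k) C fz     fz     = 0
joinEcc (suc k) C fz     (fs j) = 1
joinEcc (suc k) C (fs i) fz     = 1
joinEcc (suc k) C (fs i) (fs j) = joinEcc k C i j

joinEcc-diagonal : ∀ {r} k {C : Fin r → Fin r → ℕ} → (∀ a → C a a ≡ 0) → ∀ i → joinEcc k C i i ≡ 0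
joinEcc-diagonal zero    z i      = z i
joinEcc-diagonal (suc k) z fz     = ≡.refl
joinEcc-diagonal (suc k) z (fs i) = joinEcc-diagonal k z i

joinEcc-↑ˡ : ∀ {r} k {C : Fin r → Fin r → ℕ} a j → a Fin.↑ˡ r ≢ j → joinEcc k C (a Fin.↑ˡ r) j ≡ 1 × joinEcc k C j (a Fin.↑ˡ r) ≡ 1
joinEcc-↑ˡ (suc k) fz     fz     i≢j = contradiction ≡.refl i≢j
joinEcc-↑ˡ (suc k) fz     (fs j) i≢j = ≡.refl , ≡.refl
joinEcc-↑ˡ (suc k) (fs a) fz     i≢j = ≡.refl , ≡.refl
joinEcc-↑ˡ (suc k) (fs a) (fs j) i≢j = joinEcc-↑ˡ k a j (i≢j ∘ ≡.cong fs)

joinEcc-↑ʳ : ∀ {r} k {C : Fin r → Fin r → ℕ} a b → joinEcc k C (k Fin.↑ʳ a) (k Fin.↑ʳ b) ≡ C a b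
joinEcc-↑ʳ zero    a b = ≡.refl
joinEcc-↑ʳ (suc k) a b = joinEcc-↑ʳ k a b

==-fs : ∀ {n} (i j : Fin n) → (fs i == fs j) ≡ (i == j)
==-fs i j with i Fin.≟ j
... | yes _ = ≡.refl
... | no _  = ≡.refl

charMatrix-suc : ∀ {r} k (C : Fin r → Fin r → ℕ) i j →
  charMatrix (joinEcc (suc k) C) (fs i) (fs j) ≡ charMatrix (joinEcc k C) i j
charMatrix-suc k C i j rewrite ==-fs i j = ≡.refl

-- Opaque, since the determinant of a core of given order would unfold.
opaque
  joinChar : ∀ {r} → ℕ → (Fin r → Fin r → ℕ) → Poly
  joinChar {r} k C = Polyᴰ.determinant (k ℕ.+ r) (charMatrix (joinEcc k C))

  joinChar≡ : ∀ {r} k (C : Fin r → Fin r → ℕ) → Polyᴰ.determinant (k ℕ.+ r) (charMatrix (joinEcc k C)) ≡ joinChar k C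
  joinChar≡ k C = ≡.refl

  joinChar-singular : ∀ {r} k (C : Fin r → Fin r → ℕ) → ev (joinChar k C) ≡ + 0 → Singular (joinEcc k C)
  joinChar-singular {r} k C e = singular (≡.trans (≡.sym (ev-hom.det-homo (k ℕ.+ r) (charMatrix (joinEcc k C)))) e)

  -- The first two dominating vertices are twins: their rows agree outside the corner, where they
  -- differ by x - (-1) = y up to sign. This is the t of `det-twins`.
  joinChar-recurrence : ∀ {r} k (C : Fin r → Fin r → ℕ) →
    joinChar (suc (suc k)) C ≋ (((y +ₚ y) *ₚ joinChar (suc k) C) P.- (y *ₚ (y *ₚ joinChar k C)))
  joinChar-recurrence {r} k C = P.trans
    (Polyᴰ.det-twins (k ℕ.+ r) (charMatrix (joinEcc (suc (suc k)) C)) y P.refl P.refl (λ _ → P.refl) (λ _ → P.refl) P.refl)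
    (P.+-cong (P.*-congˡ {y +ₚ y} (Polyᴰ.det-cong (suc (k ℕ.+ r)) λ i j → P.reflexive (charMatrix-suc (suc k) C i j)))
      (P.-‿cong (P.*-congˡ {y} (P.*-congˡ {y} (Polyᴰ.det-cong (k ℕ.+ r) λ i j →
        P.reflexive (≡.trans (charMatrix-suc (suc k) C (fs i) (fs j)) (charMatrix-suc k C i j)))))))

twinDifference : ∀ {r} → (Fin r → Fin r → ℕ) → Poly
twinDifference C = joinChar 1 C P.- (y *ₚ joinChar 0 C)

-- The recurrence has the characteristic equation (z - y)² = 0. The defect between
-- `joinChar (suc k) C` and y times `joinChar k C` is thus multiplied by y at each step, and the
-- double root y is what makes the closed formula affine in k up to a power of y.
joinChar-step : ∀ {r} k (C : Fin r → Fin r → ℕ) →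
  joinChar (suc k) C ≋ ((y *ₚ joinChar k C) +ₚ ((y ^ₚ k) *ₚ twinDifference C))
joinChar-step zero    C = PolyIdentities.base (joinChar 1 C) (y *ₚ joinChar 0 C)
joinChar-step (suc k) C = begin
  joinChar (suc (suc k)) C                                         ≈⟨ joinChar-recurrence k C ⟩
  ((y +ₚ y) *ₚ e) P.- (y *ₚ (y *ₚ d))                              ≈⟨ PolyIdentities.peel y d e ⟩
  (y *ₚ e) +ₚ ((y *ₚ e) P.- (y *ₚ (y *ₚ d)))                       ≈⟨ P.+-congˡ {y *ₚ e} (P.+-congʳ {negₚ (y *ₚ (y *ₚ d))} (P.*-congˡ {y} (joinChar-step k C))) ⟩
  (y *ₚ e) +ₚ ((y *ₚ ((y *ₚ d) +ₚ ((y ^ₚ k) *ₚ Δ))) P.- (y *ₚ (y *ₚ d)))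
                                                                   ≈⟨ P.+-congˡ {y *ₚ e} (PolyIdentities.difference y d (y ^ₚ k) Δ) ⟩
  (y *ₚ e) +ₚ ((y ^ₚ suc k) *ₚ Δ)                                  ∎
  where
  open ≋-Reasoning
  d e Δ : Poly
  d = joinChar k C
  e = joinChar (suc k) C
  Δ = twinDifference C

joinChar-formula : ∀ {r} k (C : Fin r → Fin r → ℕ) →
  joinChar (suc k) C ≋ ((y ^ₚ k) *ₚ (joinChar 1 C +ₚ ((+ k ∷ []) *ₚ twinDifference C)))
joinChar-formula zero    C = P.sym (P.trans (P.*-identityˡ (joinChar 1 C +ₚ ((+ 0 ∷ []) *ₚ twinDifference C)))
  (P.trans (P.+-congˡ {joinChar 1 C} (P.*-congʳ {twinDifference C} {+ 0 ∷ []} {[]} (mk λ { zero → ≡.refl ; (suc i) → ≡.refl })))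
           (P.+-identityʳ (joinChar 1 C))))
joinChar-formula (suc k) C = begin
  joinChar (suc (suc k)) C
    ≈⟨ joinChar-step (suc k) C ⟩
  (y *ₚ joinChar (suc k) C) +ₚ ((y ^ₚ suc k) *ₚ Δ)
    ≈⟨ P.+-congʳ {(y ^ₚ suc k) *ₚ Δ} (P.*-congˡ {y} (joinChar-formula k C)) ⟩
  (y *ₚ ((y ^ₚ k) *ₚ (joinChar 1 C +ₚ ((+ k ∷ []) *ₚ Δ)))) +ₚ ((y ^ₚ suc k) *ₚ Δ)
    ≈⟨ PolyIdentities.collect y (y ^ₚ k) (joinChar 1 C) (+ k ∷ []) Δ ⟩
  (y ^ₚ suc k) *ₚ (joinChar 1 C +ₚ ((+ suc k ∷ []) *ₚ Δ)) ∎
  where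
  open ≋-Reasoning
  Δ : Poly
  Δ = twinDifference C

det-relabel : ∀ {n m} (π : Permutation n m) (A : Fin n → Fin n → ℕ) (B : Fin m → Fin m → ℕ) →
  (∀ u v → A u v ≡ B (π ⟨$⟩ʳ u) (π ⟨$⟩ʳ v)) →
  Polyᴰ.determinant n (charMatrix A) ≋ Polyᴰ.determinant m (charMatrix B)
det-relabel {n} {m} π A B e with Perm.↔⇒≡ π
... | ≡.refl = P.trans (Polyᴰ.det-cong n λ u v → P.reflexive (entry u v)) (Polyᴰ.det-permute n π (charMatrix B))
  where
  π-injective : Injective _≡_ _≡_ (π ⟨$⟩ʳ_)
  π-injective {u} {v} q = ≡.trans (≡.sym (Perm.inverseˡ π)) (≡.trans (≡.cong (π ⟨$⟩ˡ_) q) (Perm.inverseˡ π))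
  entry : ∀ u v → charMatrix A u v ≡ charMatrix B (π ⟨$⟩ʳ u) (π ⟨$⟩ʳ v)
  entry u v with u Fin.≟ v
  ... | yes ≡.refl rewrite ==-refl (π ⟨$⟩ʳ u) | e u u = ≡.refl
  ... | no u≢v     rewrite ==-≢ (u≢v ∘ π-injective) | e u v = ≡.refl

-- The block that a core contributes to the matrix of the whole join, where eccentricities and
-- distances are taken through a dominating vertex; it is in general not `eccMatrix H`.
coreEcc : ∀ {r} → Adj r → Fin r → Fin r → ℕ
coreEcc H a b = if a == b then 0 else if H a b then 0 else 2

NoUniversal : ∀ {r} → Adj r → Set
NoUniversal H = ∀ a → ∃ λ b → a ≢ b × H a b ≡ false

joinK-↑ˡ : ∀ {r} k {H : Adj r} a j → a Fin.↑ˡ r ≢ j → joinK k H (a Fin.↑ˡ r) j ≡ true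
joinK-↑ˡ {r} k a j a≢j rewrite splitAt-↑ˡ k a r with Fin.splitAt k j in eq
... | inj₁ b = ≡.cong not (==-≢ λ { ≡.refl → a≢j (splitAt⁻¹-↑ˡ eq) })
... | inj₂ b = ≡.refl

joinK-↑ʳ : ∀ {r} k {H : Adj r} a b → joinK k H (k Fin.↑ʳ a) (k Fin.↑ʳ b) ≡ H a b
joinK-↑ʳ {r} k a b rewrite splitAt-↑ʳ k r a | splitAt-↑ʳ k r b = ≡.refl

module JoinSpectrum {n k r} (G : Adj n) (simple : IsSimple G) (connected : Connected G)
  (H : Adj r) (noUniversal : NoUniversal H) (iso : Iso G (joinK (suc k) H)) where
  open Metric G simple connected

  f : Permutation n (suc k ℕ.+ r)
  f = proj₁ iso

  f-injective : ∀ {u v} → f ⟨$⟩ʳ u ≡ f ⟨$⟩ʳ v → u ≡ v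
  f-injective q = ≡.trans (≡.sym (Perm.inverseˡ f)) (≡.trans (≡.cong (f ⟨$⟩ˡ_) q) (Perm.inverseˡ f))

  data Side (u : Fin n) : Set where
    dominating : ∀ a → a Fin.↑ˡ r ≡ f ⟨$⟩ʳ u → Side u
    core       : ∀ a → suc k Fin.↑ʳ a ≡ f ⟨$⟩ʳ u → Side u

  side : ∀ u → Side u
  side u with Fin.splitAt (suc k) (f ⟨$⟩ʳ u) in eq
  ... | inj₁ a = dominating a (splitAt⁻¹-↑ˡ eq)
  ... | inj₂ a = core a (splitAt⁻¹-↑ʳ eq)

  universal : ∀ {u} a → a Fin.↑ˡ r ≡ f ⟨$⟩ʳ u → Universal u
  universal {u} a e v u≢v = ≡.trans (≡.sym (proj₂ iso u v))
    (≡.subst (λ i → joinK (suc k) H i (f ⟨$⟩ʳ v) ≡ true) e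
      (joinK-↑ˡ (suc k) a (f ⟨$⟩ʳ v) λ q → u≢v (f-injective (≡.trans (≡.sym e) q))))

  core-adjacent : ∀ {u v} a b → suc k Fin.↑ʳ a ≡ f ⟨$⟩ʳ u → suc k Fin.↑ʳ b ≡ f ⟨$⟩ʳ v → G u v ≡ H a b
  core-adjacent {u} {v} a b e e′ = ≡.trans (≡.sym (proj₂ iso u v))
    (≡.trans (≡.cong₂ (joinK (suc k) H) (≡.sym e) (≡.sym e′)) (joinK-↑ʳ (suc k) {H} a b))

  nonUniversal : ∀ {u} a → suc k Fin.↑ʳ a ≡ f ⟨$⟩ʳ u → NonUniversal u
  nonUniversal {u} a e with noUniversal a
  ... | b , a≢b , h = f ⟨$⟩ˡ (suc k Fin.↑ʳ b)
    , (λ { ≡.refl → a≢b (↑ʳ-injective (suc k) a b (≡.trans e (Perm.inverseʳ f))) })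
    , ≡.trans (core-adjacent a b e (≡.sym (Perm.inverseʳ f))) h

  A-join : ∀ u v → A u v ≡ joinEcc (suc k) (coreEcc H) (f ⟨$⟩ʳ u) (f ⟨$⟩ʳ v)
  A-join u v = go (u Fin.≟ v) (side u) (side v)
    where
    go : Dec (u ≡ v) → Side u → Side v → A u v ≡ joinEcc (suc k) (coreEcc H) (f ⟨$⟩ʳ u) (f ⟨$⟩ʳ v)
    go (yes ≡.refl) _ _ = ≡.trans (A-diagonal u) (≡.sym (joinEcc-diagonal (suc k) core-diagonal (f ⟨$⟩ʳ u)))
      where
      core-diagonal : ∀ a → coreEcc H a a ≡ 0
      core-diagonal a rewrite ==-refl a = ≡.refl
    go (no u≢v) (dominating a e) _ = ≡.trans (A-universal (universal a e) u≢v)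
      (≡.sym (≡.subst (λ i → joinEcc (suc k) (coreEcc H) i (f ⟨$⟩ʳ v) ≡ 1) e
        (proj₁ (joinEcc-↑ˡ (suc k) a (f ⟨$⟩ʳ v) λ q → u≢v (f-injective (≡.trans (≡.sym e) q))))))
    go (no u≢v) (core a e) (dominating b e′) = ≡.trans (≡.trans (A-sym u v) (A-universal (universal b e′) (u≢v ∘ ≡.sym)))
      (≡.sym (≡.subst (λ i → joinEcc (suc k) (coreEcc H) (f ⟨$⟩ʳ u) i ≡ 1) e′
        (proj₂ (joinEcc-↑ˡ (suc k) b (f ⟨$⟩ʳ u) λ q → u≢v (f-injective (≡.trans (≡.sym q) (≡.sym (≡.sym e′))))))))
    go (no u≢v) (core a e) (core b e′) = ≡.trans
      -- The complete part has `suc k` vertices, so index 0 supplies the dominating vertex.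
      (A-nonUniversal (universal {f ⟨$⟩ˡ (fz Fin.↑ˡ r)} fz (≡.sym (Perm.inverseʳ f))) (nonUniversal a e) (nonUniversal b e′) u≢v)
      (≡.trans (core-entry (core-adjacent a b e e′))
        (≡.trans (≡.sym (joinEcc-↑ʳ (suc k) {coreEcc H} a b)) (≡.cong₂ (joinEcc (suc k) (coreEcc H)) e e′)))
      where
      a≢b : a ≢ b
      a≢b ≡.refl = u≢v (f-injective (≡.trans (≡.sym e) e′))
      core-entry : ∀ {g} → g ≡ H a b → (if g then 0 else 2) ≡ coreEcc H a b
      core-entry ≡.refl rewrite ==-≢ a≢b = ≡.refl

  eccCharPoly-join : eccCharPoly G ≋ joinChar (suc k) (coreEcc H)
  eccCharPoly-join = P.trans (P.reflexive (charPoly≡ A)) (P.trans (det-relabel f A (joinEcc (suc k) (coreEcc H)) A-join) (P.reflexive (joinChar≡ (suc k) (coreEcc H))))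

  eccCharPoly-formula : eccCharPoly G ≋ ((y ^ₚ k) *ₚ (joinChar 1 (coreEcc H) +ₚ ((+ k ∷ []) *ₚ twinDifference (coreEcc H))))
  eccCharPoly-formula = P.trans eccCharPoly-join (joinChar-formula k (coreEcc H))

-- Cores on at most five vertices

_*ˢ_ : ℤ → ℤ → ℤ
(+ 0) *ˢ b = + 0
a     *ˢ b = a ℤ.* b

*ˢ≡* : ∀ a b → a *ˢ b ≡ a ℤ.* b
*ˢ≡* (+ 0)         b = ≡.sym (ℤₚ.*-zeroˡ b)
*ˢ≡* (+ suc n)     b = ≡.refl
*ˢ≡* (ℤ.-[1+ n ]) b = ≡.refl

sumˢ : ∀ n → (Fin n → ℤ) → ℤ
sumˢ zero    f = + 0
sumˢ (suc n) f = f fz ℤ.+ sumˢ n (f ∘ fs)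

-- Skipping the zero entries makes the exhaustive check over the graphs on five vertices feasible.
detˢ : ∀ n → (Fin n → Fin n → ℤ) → ℤ
detˢ zero    M = + 1
detˢ (suc n) M = sumˢ (suc n) λ j → ℤᴰ.sgn (toℕ j) (M fz j *ˢ detˢ n (λ i k → M (fs i) (punchIn j k)))

detˢ≡determinant : ∀ n M → detˢ n M ≡ ℤᴰ.determinant n M
detˢ≡determinant zero    M = ≡.refl
detˢ≡determinant (suc n) M = sumˢ-cong (suc n) λ j → ≡.cong (ℤᴰ.sgn (toℕ j))
  (≡.trans (*ˢ≡* (M fz j) _) (≡.cong (M fz j ℤ.*_) (detˢ≡determinant n (ℤᴰ.minor M j))))
  where
  sumˢ-cong : ∀ n {f g : Fin n → ℤ} → (∀ i → f i ≡ g i) → sumˢ n f ≡ Z.sum g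
  sumˢ-cong zero    e = ≡.refl
  sumˢ-cong (suc n) e = ≡.cong₂ ℤ._+_ (e fz) (sumˢ-cong n (e ∘ fs))

iso-trans : ∀ {l m n} {G : Adj l} {H : Adj m} {F : Adj n} → Iso G H → Iso H F → Iso G F
iso-trans (f , p) (g , q) = f Perm.∘ₚ g , λ u v → ≡.trans (q _ _) (p u v)

iso-sym : ∀ {m n} {G : Adj m} {H : Adj n} → Iso G H → Iso H G
iso-sym {H = H} (f , p) = Perm.flip f , λ u v → ≡.trans (≡.sym (p _ _)) (≡.cong₂ H (Perm.inverseʳ f) (Perm.inverseʳ f))

joinK-fs : ∀ {r} k (H : Adj r) i j → joinK (suc k) H (fs i) (fs j) ≡ joinK k H i j
joinK-fs k H i j with Fin.splitAt k i | Fin.splitAt k j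
... | inj₁ a | inj₁ b = ≡.cong not (==-fs a b)
... | inj₁ _ | inj₂ _ = ≡.refl
... | inj₂ _ | inj₁ _ = ≡.refl
... | inj₂ _ | inj₂ _ = ≡.refl

joinK-cong : ∀ {r} k {H F : Adj r} → Iso H F → Iso (joinK k H) (joinK k F)
joinK-cong zero    iso = iso
joinK-cong {r} (suc k) {H} {F} iso with joinK-cong k iso
... | f , p = Perm.lift₀ f , edge
  where
  fz-fs : ∀ (H : Adj r) j → joinK (suc k) H fz (fs j) ≡ true
  fz-fs H j with Fin.splitAt k j
  ... | inj₁ _ = ≡.refl
  ... | inj₂ _ = ≡.refl
  fs-fz : ∀ (H : Adj r) i → joinK (suc k) H (fs i) fz ≡ true
  fs-fz H i with Fin.splitAt k i
  ... | inj₁ _ = ≡.refl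
  ... | inj₂ _ = ≡.refl
  edge : ∀ u v → joinK (suc k) F (Perm.lift₀ f ⟨$⟩ʳ u) (Perm.lift₀ f ⟨$⟩ʳ v) ≡ joinK (suc k) H u v
  edge fz     fz     = ≡.refl
  edge fz     (fs v) = ≡.trans (fz-fs F _) (≡.sym (fz-fs H v))
  edge (fs u) fz     = ≡.trans (fs-fz F _) (≡.sym (fs-fz H u))
  edge (fs u) (fs v) = ≡.trans (joinK-fs k F _ _) (≡.trans (p u v) (≡.sym (joinK-fs k H u v)))

record Decomposition {n} (G : Adj n) : Set where
  field
    {k r}       : ℕ
    H           : Adj r
    simple      : IsSimple H
    noUniversal : NoUniversal H
    iso         : Iso G (joinK k H)
    size        : k ℕ.+ r ≡ n
    positive    : 1 ≤ k

module Decompose {n} (G : Adj n) (simple : IsSimple G) (connected : Connected G) where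
  open Metric G simple connected

  decompose : (∃ λ w → ε w ≤ 1) → Decomposition G
  decompose (w , εw≤1) = record
    { H = H ; simple = (λ a b → proj₁ simple _ _) , (λ a → proj₂ simple _)
    ; noUniversal = noUniversal ; iso = f , edge ; size = size ; positive = positive (to w) ≡.refl }
    where
    π : Partition (λ u → ⌊ ε u ℕ.≤? 1 ⌋)
    π = partition _
    open Partition π

    true⁻ : ∀ {u} → ⌊ ε u ℕ.≤? 1 ⌋ ≡ true → ε u ≤ 1
    true⁻ {u} e with yes p ← ε u ℕ.≤? 1 = p

    false⁻ : ∀ {u} → ⌊ ε u ℕ.≤? 1 ⌋ ≡ false → ¬ ε u ≤ 1
    false⁻ {u} e with no ¬p ← ε u ℕ.≤? 1 = ¬p

    H : Adj r
    H a b = G (from (inj₂ a)) (from (inj₂ b))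

    universal : ∀ a → Universal (from (inj₁ a))
    universal a = ε≤1⇒universal (true⁻ (from-inj₁ a))

    positive : ∀ x → to w ≡ x → 1 ≤ k
    positive (inj₁ a) _ = ℕₚ.≤-trans (s≤s z≤n) (toℕ<n a)
    positive (inj₂ b) e = contradiction εw≤1
      (≡.subst (λ u → ¬ ε u ≤ 1) (≡.trans (≡.cong from (≡.sym e)) (from-to w)) (false⁻ (from-inj₂ b)))

    f : Permutation n (k ℕ.+ r)
    f = Perm.permutation (λ u → Fin.join k r (to u)) (λ i → from (Fin.splitAt k i))
      (λ i → ≡.trans (≡.cong (Fin.join k r) (to-from (Fin.splitAt k i))) (join-splitAt k r i))
      (λ u → ≡.trans (≡.cong from (splitAt-join k r (to u))) (from-to u))

    joined : ∀ x x′ → joinK k H (Fin.join k r x) (Fin.join k r x′) ≡ G (from x) (from x′)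
    joined x x′ rewrite splitAt-join k r x | splitAt-join k r x′ with x | x′
    ... | inj₂ a | inj₂ b = ≡.refl
    ... | inj₁ a | inj₂ b = ≡.sym (universal a _ λ e → contradiction (from-injective e) λ ())
    ... | inj₂ a | inj₁ b = ≡.sym (≡.trans (proj₁ simple _ _) (universal b _ λ e → contradiction (from-injective e) λ ()))
    ... | inj₁ a | inj₁ b with a Fin.≟ b
    ... | yes ≡.refl = ≡.sym (proj₂ simple _)
    ... | no a≢b     = ≡.sym (universal a _ λ e → a≢b (inj₁-injective (from-injective e)))

    edge : ∀ u v → joinK k H (f ⟨$⟩ʳ u) (f ⟨$⟩ʳ v) ≡ G u v
    edge u v = ≡.trans (joined (to u) (to v)) (≡.cong₂ G (from-to u) (from-to v))

    noUniversal : NoUniversal H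
    noUniversal a = go (ε≰1⇒nonUniversal (false⁻ (from-inj₂ a)))
      where
      go : NonUniversal (from (inj₂ a)) → ∃ λ b → a ≢ b × H a b ≡ false
      go (v , a≢v , e) = at-side (to v) (from-to v)
        where
        at-side : ∀ x → from x ≡ v → ∃ λ b → a ≢ b × H a b ≡ false
        -- A vertex not adjacent to a core vertex cannot be dominating, so the witness lies in the
        -- core itself.
        at-side (inj₁ b) ≡.refl = contradiction (≡.trans (≡.sym (≡.trans (proj₁ simple _ _) (universal b _ (a≢v ∘ ≡.sym)))) e) λ ()
        at-side (inj₂ b) ≡.refl = b , (λ { ≡.refl → a≢v ≡.refl }) , e

module _ (C : Fin 6 → Fin 6 → ℕ) (diag : ∀ a → C a a ≡ 0) (even : ∀ a b → C a b ≡ 0 ⊎ C a b ≡ 2) where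
  open Congruence 2

  private
    I₆ : Fin 7 → Fin 7 → ℕ
    I₆ = joinEcc {6} 1 (λ _ _ → 0)

    entry : ∀ i j → Cong (shiftedMatrix (joinEcc 1 C) i j) (shiftedMatrix I₆ i j)
    entry fz     fz     = cong-≡ ≡.refl
    entry fz     (fs j) = cong-≡ ≡.refl
    entry (fs i) fz     = cong-≡ ≡.refl
    entry (fs i) (fs j) with i Fin.≟ j
    ... | yes ≡.refl = cong-≡ (≡.cong (λ c → ev ((ℤ.- (+ c)) ∷ + 1 ∷ [])) (diag i))
    ... | no _ with even i j
    ... | inj₁ e = cong-≡ (≡.cong (λ c → ev ((ℤ.- (+ c)) ∷ [])) e)
    ... | inj₂ e = ℤ.- (+ 1) by ≡.cong (λ c → ev ((ℤ.- (+ c)) ∷ [])) e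

    -- `shiftedMatrix` is minus A + I and the order 7 is odd, so 1 - 6 appears as 5.
    evaluated : detˢ 7 (shiftedMatrix I₆) ≡ + 5
    evaluated = ≡.refl

    determinant≡5 : ℤᴰ.determinant 7 (shiftedMatrix I₆) ≡ + 5
    determinant≡5 = ≡.trans (≡.sym (detˢ≡determinant 7 (shiftedMatrix I₆))) evaluated

  -- Modulo 2 the matrix is an arrow with determinant 1 - 6.
  seven-nonsingular : ¬ Singular (joinEcc 1 C)
  seven-nonsingular s = nonzero (≡.subst (Cong (ℤᴰ.determinant 7 (shiftedMatrix (joinEcc 1 C)))) determinant≡5
    (cong-det 7 {shiftedMatrix (joinEcc 1 C)} {shiftedMatrix I₆} entry)) (from-no (2 ∣? 5)) (Singular.det≡0 s)

coreEcc-diagonal : ∀ {r} (H : Adj r) a → coreEcc H a a ≡ 0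
coreEcc-diagonal H a rewrite ==-refl a = ≡.refl

coreEcc-even : ∀ {r} (H : Adj r) a b → coreEcc H a b ≡ 0 ⊎ coreEcc H a b ≡ 2
coreEcc-even H a b with a == b | H a b
... | true  | _     = inj₁ ≡.refl
... | false | true  = inj₁ ≡.refl
... | false | false = inj₂ ≡.refl

-- Six core vertices and one dominating vertex would span the block of `seven-nonsingular`, whereas
-- a principal minor of order 7 has to vanish.
core≤5 : ∀ {n k r} (16≤n : 16 ≤ n) (G : Adj n) (simple : IsSimple G) (connected : Connected G) →
  (y ^ₚ (n ∸ 5)) ∣ₚ charPoly (eccMatrix G) → (H : Adj r) → NoUniversal H → Iso G (joinK (suc k) H) → r ≤ 5
core≤5 {n} {k} {r} 16≤n G simple connected order H noUniversal iso = ℕ.s≤s⁻¹ (ℕₚ.≰⇒> λ 6≤r →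
  seven-nonsingular (λ a b → coreEcc H (inj 6≤r a) (inj 6≤r b)) (λ a → coreEcc-diagonal H (inj 6≤r a)) (λ a b → coreEcc-even H (inj 6≤r a) (inj 6≤r b))
    (minor-zero (ℕₚ.n≤1+n 6) _ (σ 6≤r) (σ-injective 6≤r) (entry 6≤r)))
  where
  open LowRank 16≤n G simple connected order
  open JoinSpectrum G simple connected H noUniversal iso
  inj : 6 ≤ r → Fin 6 → Fin r
  inj 6≤r a = Fin.inject≤ a 6≤r
  image : 6 ≤ r → Fin 7 → Fin (suc k ℕ.+ r)
  image 6≤r fz     = fz
  image 6≤r (fs a) = suc k Fin.↑ʳ inj 6≤r a
  image-injective : ∀ 6≤r → Injective _≡_ _≡_ (image 6≤r)
  image-injective 6≤r {fz}   {fz}   e = ≡.refl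
  image-injective 6≤r {fs a} {fs b} e = ≡.cong fs (inject≤-injective′ 6≤r (↑ʳ-injective (suc k) _ _ e))
  σ : 6 ≤ r → Fin 7 → Fin n
  σ 6≤r i = f ⟨$⟩ˡ image 6≤r i
  σ-injective : ∀ 6≤r → Injective _≡_ _≡_ (σ 6≤r)
  σ-injective 6≤r e = image-injective 6≤r (≡.trans (≡.sym (Perm.inverseʳ f)) (≡.trans (≡.cong (f ⟨$⟩ʳ_) e) (Perm.inverseʳ f)))
  block : ∀ 6≤r i j → joinEcc (suc k) (coreEcc H) (image 6≤r i) (image 6≤r j) ≡ joinEcc 1 (λ a b → coreEcc H (inj 6≤r a) (inj 6≤r b)) i j
  block 6≤r fz     fz     = ≡.refl
  block 6≤r fz     (fs b) = ≡.refl
  block 6≤r (fs a) fz     = ≡.refl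
  block 6≤r (fs a) (fs b) = joinEcc-↑ʳ k {coreEcc H} (inj 6≤r a) (inj 6≤r b)
  entry : ∀ 6≤r i j → eccMatrix G (σ 6≤r i) (σ 6≤r j) ≡ joinEcc 1 (λ a b → coreEcc H (inj 6≤r a) (inj 6≤r b)) i j
  entry 6≤r i j = ≡.trans (A-join (σ 6≤r i) (σ 6≤r j))
    (≡.trans (≡.cong₂ (joinEcc (suc k) (coreEcc H)) (Perm.inverseʳ f) (Perm.inverseʳ f)) (block 6≤r i j))

-- Exhaustive enumeration of small graphs

Table : ℕ → Set
Table zero    = ⊤
Table (suc r) = Vec Bool r × Table r

toAdj : ∀ {r} → Table r → Adj r
toAdj {suc r} (v , t) fz     fz     = false
toAdj {suc r} (v , t) fz     (fs j) = Vec.lookup v j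
toAdj {suc r} (v , t) (fs i) fz     = Vec.lookup v i
toAdj {suc r} (v , t) (fs i) (fs j) = toAdj t i j

fromAdj : ∀ {r} → Adj r → Table r
fromAdj {zero}  H = tt
fromAdj {suc r} H = Vec.tabulate (λ j → H fz (fs j)) , fromAdj (λ i j → H (fs i) (fs j))

toAdj-fromAdj : ∀ {r} {H : Adj r} → IsSimple H → ∀ i j → toAdj (fromAdj H) i j ≡ H i j
toAdj-fromAdj (_ , irr) fz     fz     = ≡.sym (irr fz)
toAdj-fromAdj (_ , irr) fz     (fs j) = lookup∘tabulate _ j
toAdj-fromAdj (sym , _) (fs i) fz     = ≡.trans (lookup∘tabulate _ i) (sym fz (fs i))
toAdj-fromAdj (sym , irr) (fs i) (fs j) = toAdj-fromAdj ((λ u v → sym (fs u) (fs v)) , (irr ∘ fs)) i j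

allVec : ∀ n → (Vec Bool n → Bool) → Bool
allVec zero    p = p []ᵥ
allVec (suc n) p = allVec n (λ v → p (true ∷ᵥ v)) ∧ allVec n (λ v → p (false ∷ᵥ v))

∧-true : ∀ {a b} → a ∧ b ≡ true → a ≡ true × b ≡ true
∧-true {true} e = ≡.refl , e

allVec-sound : ∀ n {p} → allVec n p ≡ true → ∀ v → p v ≡ true
allVec-sound zero    e []ᵥ           = e
allVec-sound (suc n) e (true  ∷ᵥ v) = allVec-sound n (proj₁ (∧-true e)) v
allVec-sound (suc n) {p} e (false ∷ᵥ v) = allVec-sound n (proj₂ (∧-true {allVec n (λ v → p (true ∷ᵥ v))} e)) v

-- A table stores only the adjacencies above the diagonal, so the check runs through 2^6 tables for
-- four vertices and 2^10 for five.
allTable : ∀ r → (Table r → Bool) → Bool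
allTable zero    p = p tt
allTable (suc r) p = allVec r λ v → allTable r λ t → p (v , t)

allTable-sound : ∀ r {p} → allTable r p ≡ true → ∀ t → p t ≡ true
allTable-sound zero    e t       = e
allTable-sound (suc r) e (v , t) = allTable-sound r (allVec-sound r e v) t

allᶠ : ∀ n → (Fin n → Bool) → Bool
allᶠ zero    p = true
allᶠ (suc n) p = p fz ∧ allᶠ n (p ∘ fs)

allᶠ-sound : ∀ n {p} → allᶠ n p ≡ true → ∀ i → p i ≡ true
allᶠ-sound (suc n) e fz     = proj₁ (∧-true e)
allᶠ-sound (suc n) {p} e (fs i) = allᶠ-sound n (proj₂ (∧-true {p fz} e)) i

anyᶠ : ∀ n → (Fin n → Bool) → Bool
anyᶠ zero    p = false
anyᶠ (suc n) p = p fz ∨ anyᶠ n (p ∘ fs)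

∨-true : ∀ a {b} → a ∨ b ≡ true → a ≡ true ⊎ b ≡ true
∨-true true  e = inj₁ e
∨-true false e = inj₂ e

anyᶠ-sound : ∀ n {p} → anyᶠ n p ≡ true → ∃ λ i → p i ≡ true
anyᶠ-sound (suc n) {p} e with ∨-true (p fz) e
... | inj₁ q = fz , q
... | inj₂ q with anyᶠ-sound n q
... | i , q′ = fs i , q′

anyᴸ-sound : ∀ {A : Set} {p : A → Bool} (xs : List A) → any p xs ≡ true → ∃ λ x → p x ≡ true
anyᴸ-sound {p = p} (x ∷ xs) e with ∨-true (p x) e
... | inj₁ q = x , q
... | inj₂ q = anyᴸ-sound xs q

_⇔ᵇ_ : Bool → Bool → Bool
true  ⇔ᵇ b = b
false ⇔ᵇ b = not b

⇔ᵇ-sound : ∀ a {b} → (a ⇔ᵇ b) ≡ true → b ≡ a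
⇔ᵇ-sound true  e = e
⇔ᵇ-sound false {false} e = ≡.refl

isIso : ∀ {r} → Adj r → Adj r → Vec (Fin r) r → Bool
isIso {r} H F v = allᶠ r λ i → allᶠ r λ j → (H i j ⇔ᵇ F (Vec.lookup v i) (Vec.lookup v j)) ∧ ((i == j) ∨ not (Vec.lookup v i == Vec.lookup v j))

isIso-sound : ∀ {r} (H F : Adj r) v → isIso H F v ≡ true → Iso H F
isIso-sound {r} H F v e = proj₁ π , λ i j → ≡.trans (≡.cong₂ F (proj₂ π i) (proj₂ π j)) (⇔ᵇ-sound (H i j) (proj₁ (check i j)))
  where
  check : ∀ i j → (H i j ⇔ᵇ F (Vec.lookup v i) (Vec.lookup v j)) ≡ true × ((i == j) ∨ not (Vec.lookup v i == Vec.lookup v j)) ≡ true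
  check i j = ∧-true (allᶠ-sound r (allᶠ-sound r e i) j)
  lookup-injective : Injective _≡_ _≡_ (Vec.lookup v)
  lookup-injective {i} {j} q with i Fin.≟ j | proj₂ (check i j)
  ... | yes p | _ = p
  ... | no _  | c rewrite q | ==-refl (Vec.lookup v j) = contradiction c λ ()
  π : Σ[ π ∈ Permutation r r ] (∀ i → π ⟨$⟩ʳ i ≡ Vec.lookup v i)
  π = injective⇒permutation (Vec.lookup v) lookup-injective

-- A supply of candidates for an isomorphism: `isIso` tests injectivity itself, and soundness is
-- read off the candidate that was found.
arrangements : ∀ n → List (Vec (Fin n) n)
arrangements zero    = []ᵥ ∷ []
arrangements (suc n) = concatMap (λ v → map (λ j → j ∷ᵥ Vec.map (punchIn j) v) (allFin (suc n))) (arrangements n)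

nonzeroᵇ : ℤ → Bool
nonzeroᵇ (+ 0) = false
nonzeroᵇ _     = true

-- Opaque, so that outside the two exhaustive checks these tests are never unfolded on a variable graph.
opaque
  hasUniversal : ∀ {r} → Adj r → Bool
  hasUniversal {r} H = anyᶠ r λ a → allᶠ r λ b → (a == b) ∨ H a b

  hasUniversal-sound : ∀ {r} (H : Adj r) → hasUniversal H ≡ true → ¬ NoUniversal H
  hasUniversal-sound {r} H e noUniversal with anyᶠ-sound r e
  ... | a , q with noUniversal a
  ... | b , a≢b , h with allᶠ-sound r q b
  ... | q′ rewrite ==-≢ a≢b | h = contradiction q′ λ ()

  someIso : ∀ {r} → List (Vec (Fin r) r) → Adj r → Adj r → Bool
  someIso vs H F = any (isIso H F) vs

  someIso-sound : ∀ {r} vs (H F : Adj r) → someIso vs H F ≡ true → Iso H F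
  someIso-sound vs H F e with anyᴸ-sound vs e
  ... | v , q = isIso-sound H F v q

  regular : ∀ {r} → Adj r → Bool
  regular {r} H = nonzeroᵇ (detˢ (suc r) (shiftedMatrix (joinEcc 1 (coreEcc H))))

  regular-sound : ∀ {r} (H : Adj r) → regular H ≡ true → ¬ Singular (joinEcc 1 (coreEcc H))
  regular-sound {r} H e (singular z) = nonzeroᵇ-sound e (≡.trans (detˢ≡determinant (suc r) (shiftedMatrix (joinEcc 1 (coreEcc H)))) z)
    where
    nonzeroᵇ-sound : ∀ {a} → nonzeroᵇ a ≡ true → a ≢ + 0
    nonzeroᵇ-sound q ≡.refl = contradiction q λ ()

-- The order of the disjuncts matters for evaluation: `∨` stops at the first success, so
-- isomorphisms are searched only for graphs that the cheaper tests leave over.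
classified : ∀ {r s} → List (Vec (Fin r) r) → (Adj r → Bool) → (Fin s → Adj r) → Table r → Bool
classified vs test F t = hasUniversal (toAdj t) ∨ (test (toAdj t) ∨ anyᶠ _ λ i → someIso vs (toAdj t) (F i))

classified-sound : ∀ {r s} vs test (F : Fin s → Adj r) → allTable r (classified vs test F) ≡ true →
  (H : Adj r) → IsSimple H → NoUniversal H → test (toAdj (fromAdj H)) ≡ true ⊎ (∃ λ i → Iso H (F i))
classified-sound {r} {s} vs test F all H simple noUniversal =
  first (∨-true (hasUniversal H′) {test H′ ∨ isos} (allTable-sound r {classified vs test F} all (fromAdj H)))
  where
  H′ : Adj r
  H′ = toAdj (fromAdj H)
  isos : Bool
  isos = anyᶠ s λ i → someIso vs H′ (F i)
  noUniversal′ : NoUniversal H′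
  noUniversal′ a with noUniversal a
  ... | b , a≢b , h = b , a≢b , ≡.trans (toAdj-fromAdj simple a b) h
  third : isos ≡ true → ∃ λ i → Iso H (F i)
  third q with anyᶠ-sound s {λ i → someIso vs H′ (F i)} q
  ... | i , q′ with someIso-sound vs H′ (F i) q′
  ... | f , p = i , f , λ u v → ≡.trans (p u v) (toAdj-fromAdj simple u v)
  second : test H′ ≡ true ⊎ isos ≡ true → test H′ ≡ true ⊎ (∃ λ i → Iso H (F i))
  second (inj₁ q) = inj₁ q
  second (inj₂ q) = inj₂ (third q)
  first : hasUniversal H′ ≡ true ⊎ test H′ ∨ isos ≡ true → test H′ ≡ true ⊎ (∃ λ i → Iso H (F i))
  first (inj₁ q) = ⊥-elim (hasUniversal-sound H′ q noUniversal′)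
  first (inj₂ q) = second (∨-true (test H′) {isos} q)

family₄ : Fin 7 → Adj 4
family₄ = Vec.lookup (fourK1 ∷ᵥ twoK1K2 ∷ᵥ P3K1 ∷ᵥ twoK2 ∷ᵥ P4 ∷ᵥ K3K1 ∷ᵥ C4 ∷ᵥ []ᵥ)

family₅ : Fin 3 → Adj 5
family₅ = Vec.lookup (C5 ∷ᵥ K1P4 ∷ᵥ bull ∷ᵥ []ᵥ)

opaque
  unfolding hasUniversal someIso regular

  classified₄ : allTable 4 (classified (arrangements 4) (λ _ → false) family₄) ≡ true
  classified₄ = ≡.refl

  classified₅ : allTable 5 (classified (arrangements 5) regular family₅) ≡ true
  classified₅ = ≡.refl

singular-cong : ∀ {s} {B B′ : Fin s → Fin s → ℕ} → (∀ i j → B i j ≡ B′ i j) → Singular B → Singular B′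
singular-cong {s} {B} {B′} e (singular z) = singular (≡.trans (ℤᴰ.det-cong s {shiftedMatrix B′} {shiftedMatrix B} λ i j →
  ≡.cong (λ a → ev (if i == j then (ℤ.- (+ a)) ∷ + 1 ∷ [] else (ℤ.- (+ a)) ∷ [])) (≡.sym (e i j))) z)

joinEcc-cong : ∀ {r} {H H′ : Adj r} → (∀ i j → H i j ≡ H′ i j) → ∀ i j → joinEcc 1 (coreEcc H) i j ≡ joinEcc 1 (coreEcc H′) i j
joinEcc-cong e fz     fz     = ≡.refl
joinEcc-cong e fz     (fs j) = ≡.refl
joinEcc-cong e (fs i) fz     = ≡.refl
joinEcc-cong e (fs i) (fs j) rewrite e i j = ≡.refl

-- With four core vertices the factor y ^ (n - 5) comes from the twins alone, so there is no
-- spectral condition to test: the seven graphs are all those without a dominating vertex.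
classify₄ : (H : Adj 4) → IsSimple H → NoUniversal H → ∃ λ i → Iso H (family₄ i)
classify₄ H simple noUniversal =
  Sum.[ (λ ()) , id ] (classified-sound (arrangements 4) (λ _ → false) family₄ classified₄ H simple noUniversal)

-- With five core vertices the twins give one factor too few. The condition that results is
-- singularity of the core with a single dominating vertex, a matrix of order six that no longer
-- involves n.
classify₅ : (H : Adj 5) → IsSimple H → NoUniversal H → ¬ Singular (joinEcc 1 (coreEcc H)) ⊎ (∃ λ i → Iso H (family₅ i))
classify₅ H simple noUniversal = Sum.map₁
  (λ q s → regular-sound (toAdj (fromAdj H)) q (singular-cong (λ i j → ≡.sym (joinEcc-cong {H = toAdj (fromAdj H)} {H} (toAdj-fromAdj simple) i j)) s))
  (classified-sound (arrangements 5) regular family₅ classified₅ H simple noUniversal)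

-- The order is read off the characteristic polynomial

coeff-sum : ∀ {n} (f : Fin n → Poly) i → coeff (P.sum f) i ≡ Z.sum (λ j → coeff (f j) i)
coeff-sum {zero}  f i = ≡.refl
coeff-sum {suc n} f i = ≡.trans (coeff-+ (f fz) (P.sum (f ∘ fs)) i) (≡.cong (λ z → coeff (f fz) i ℤ.+ z) (coeff-sum (f ∘ fs) i))

coeff-sgn : ∀ k p i → coeff (Polyᴰ.sgn k p) i ≡ ℤᴰ.sgn k (coeff p i)
coeff-sgn zero    p i = ≡.refl
coeff-sgn (suc k) p i = ≡.trans (coeff-neg (Polyᴰ.sgn k p) i) (≡.cong ℤ.-_ (coeff-sgn k p i))

module LinearEntries where
  Linear : ∀ {n} → (Fin n → Fin n → Poly) → (Fin n → Fin n → ℤ) → (Fin n → Fin n → ℤ) → Set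
  Linear M a b = ∀ i j → M i j ≋ (a i j ∷ b i j ∷ [])

  coeff-beyond : ∀ n {M a b} → Linear M a b → ∀ i → n < i → coeff (Polyᴰ.determinant n M) i ≡ + 0
  coeff-beyond zero    lin (suc i) _ = ≡.refl
  coeff-beyond (suc n) {M} {a} {b} lin (suc i) (s≤s n<i) = ≡.trans (coeff-sum (λ j → Polyᴰ.sgn (toℕ j) (M fz j *ₚ D j)) (suc i))
    (ℤᴰ.sum-zero λ j → ≡.trans (coeff-sgn (toℕ j) (M fz j *ₚ D j) (suc i)) (≡.trans (ℤᴰ.sgn-cong (toℕ j)
      (≡.trans (at (P.*-congʳ {D j} (lin fz j)) (suc i)) (≡.trans (coeff-linear* (a fz j) (b fz j) (D j) i)
        (≡.cong₂ ℤ._+_ (vanish (a fz j) j (suc i) (ℕₚ.<-trans n<i (ℕₚ.n<1+n i))) (vanish (b fz j) j i n<i))))) (ℤᴰ.sgn-0 (toℕ j))))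
    where
    D : Fin (suc n) → Poly
    D j = Polyᴰ.determinant n (Polyᴰ.minor M j)
    vanish : ∀ c j i → n < i → c ℤ.* coeff (D j) i ≡ + 0
    vanish c j i n<i = ≡.trans (≡.cong (c ℤ.*_) (coeff-beyond n (λ k l → lin (fs k) (punchIn j l)) i n<i)) (ℤₚ.*-zeroʳ c)

  -- In the expansion, the constant part of an entry meets a coefficient of the minor beyond its
  -- degree, and only the product of leading parts survives.
  coeff-leading : ∀ n {M a b} → Linear M a b → coeff (Polyᴰ.determinant n M) n ≡ ℤᴰ.determinant n b
  coeff-leading zero    lin = ≡.refl
  coeff-leading (suc n) {M} {a} {b} lin = ≡.trans (coeff-sum (λ j → Polyᴰ.sgn (toℕ j) (M fz j *ₚ D j)) (suc n))
    (ℤᴰ.sum-cong λ j → ≡.trans (coeff-sgn (toℕ j) (M fz j *ₚ D j) (suc n)) (ℤᴰ.sgn-cong (toℕ j)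
      (≡.trans (at (P.*-congʳ {D j} (lin fz j)) (suc n)) (≡.trans (coeff-linear* (a fz j) (b fz j) (D j) n)
        (≡.trans (≡.cong₂ ℤ._+_
          (≡.trans (≡.cong (a fz j ℤ.*_) (coeff-beyond n (lin′ j) (suc n) (ℕₚ.n<1+n n))) (ℤₚ.*-zeroʳ (a fz j)))
          (≡.cong (b fz j ℤ.*_) (coeff-leading n (lin′ j)))) (ℤₚ.+-identityˡ (b fz j ℤ.* ℤᴰ.determinant n (ℤᴰ.minor b j))))))))
    where
    D : Fin (suc n) → Poly
    D j = Polyᴰ.determinant n (Polyᴰ.minor M j)
    lin′ : ∀ j → Linear (Polyᴰ.minor M j) (ℤᴰ.minor a j) (ℤᴰ.minor b j)
    lin′ j k l = lin (fs k) (punchIn j l)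

open LinearEntries

identity : ∀ {n} → Fin n → Fin n → ℤ
identity i j = if i == j then + 1 else + 0

det-identity : ∀ n → ℤᴰ.determinant n identity ≡ + 1
det-identity zero    = ≡.refl
det-identity (suc n) = ≡.trans (ℤᴰ.det-oneTerm n identity λ j → ≡.refl) (≡.trans (ℤₚ.*-identityˡ (ℤᴰ.determinant n (ℤᴰ.minor identity fz)))
  (≡.trans (ℤᴰ.det-cong n {ℤᴰ.minor identity fz} {identity} λ i j → ≡.cong (λ b → if b then + 1 else + 0) (==-fs i j)) (det-identity n)))

charMatrix-linear : ∀ {n} (A : Fin n → Fin n → ℕ) → Linear (charMatrix A) (λ i j → ℤ.- (+ A i j)) identity
charMatrix-linear A i j with i == j
... | true  = P.refl
... | false = mk λ { zero → ≡.refl ; (suc zero) → ≡.refl ; (suc (suc i)) → ≡.refl }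

-- Characteristic polynomials are monic of degree equal to the order: for m < n the coefficient at n
-- would be both 1 and 0. Used in both directions, this recovers the number of vertices.
charPoly-degree : ∀ {m n} (A : Fin m → Fin m → ℕ) (B : Fin n → Fin n → ℕ) → charPoly A ≈ₚ charPoly B → n ≤ m
charPoly-degree {m} {n} A B e = ℕₚ.≮⇒≥ λ m<n → contradiction (begin
  + 1                                              ≡⟨ det-identity n ⟨
  ℤᴰ.determinant n identity                        ≡⟨ coeff-leading n (charMatrix-linear B) ⟨
  coeff (Polyᴰ.determinant n (charMatrix B)) n     ≡⟨ ≡.cong (λ p → coeff p n) (charPoly≡ B) ⟨
  coeff (charPoly B) n                             ≡⟨ e n ⟨
  coeff (charPoly A) n                             ≡⟨ ≡.cong (λ p → coeff p n) (charPoly≡ A) ⟩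
  coeff (Polyᴰ.determinant m (charMatrix A)) n     ≡⟨ coeff-beyond m (charMatrix-linear A) n m<n ⟩
  + 0                                              ∎) λ ()
  where open ≡.≡-Reasoning

-- The ten members

isZeroₚ : Poly → Bool
isZeroₚ []      = true
isZeroₚ (a ∷ p) = ⌊ a ℤ.≟ + 0 ⌋ ∧ isZeroₚ p

⌊⌋-sound : ∀ {P : Set} {P? : Dec P} → ⌊ P? ⌋ ≡ true → P
⌊⌋-sound {P? = yes p} _ = p

isZeroₚ-sound : ∀ p → isZeroₚ p ≡ true → p ≋ []
isZeroₚ-sound []      _ = P.refl
isZeroₚ-sound (a ∷ p) e = mk λ { zero → ⌊⌋-sound {P? = a ℤ.≟ + 0} (proj₁ (∧-true {⌊ a ℤ.≟ + 0 ⌋} e)) ; (suc i) → at (isZeroₚ-sound p (proj₂ (∧-true {⌊ a ℤ.≟ + 0 ⌋} e))) i }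

opaque
  _≋ᵇ_ : Poly → Poly → Bool
  p ≋ᵇ q = isZeroₚ (p P.- q)

  ≋ᵇ-sound : ∀ p q → (p ≋ᵇ q) ≡ true → p ≋ q
  ≋ᵇ-sound p q e = P.x∙y⁻¹≈ε⇒x≈y p q (isZeroₚ-sound (p P.- q) e)

pointwise-≋ : ∀ {n} (p p′ q q′ : Fin n → Poly) → allᶠ n (λ i → (p i ≋ᵇ p′ i) ∧ (q i ≋ᵇ q′ i)) ≡ true →
  ∀ i → p i ≋ p′ i × q i ≋ q′ i
pointwise-≋ {n} p p′ q q′ e i with ∧-true {p i ≋ᵇ p′ i} (allᶠ-sound n {λ i → (p i ≋ᵇ p′ i) ∧ (q i ≋ᵇ q′ i)} e i)
... | a , b = ≋ᵇ-sound (p i) (p′ i) a , ≋ᵇ-sound (q i) (q′ i) b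

Index : Set
Index = Fin 7 ⊎ Fin 3

IsMember : ∀ n → Adj n → Index → Set
IsMember n G (inj₁ i) = Iso G (joinK (n ∸ 4) (family₄ i))
IsMember n G (inj₂ i) = Iso G (joinK (n ∸ 5) (family₅ i))

index : ∀ {n G} → InFamily n G → ∃ (IsMember n G)
index (inj₁ p)                                                                         = inj₁ (Fin.# 0) , p
index (inj₂ (inj₁ p))                                                                  = inj₁ (Fin.# 1) , p
index (inj₂ (inj₂ (inj₁ p)))                                                           = inj₁ (Fin.# 2) , p
index (inj₂ (inj₂ (inj₂ (inj₁ p))))                                                    = inj₁ (Fin.# 3) , p
index (inj₂ (inj₂ (inj₂ (inj₂ (inj₁ p)))))                                             = inj₁ (Fin.# 4) , p
index (inj₂ (inj₂ (inj₂ (inj₂ (inj₂ (inj₁ p))))))                                      = inj₁ (Fin.# 5) , p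
index (inj₂ (inj₂ (inj₂ (inj₂ (inj₂ (inj₂ (inj₁ p)))))))                               = inj₁ (Fin.# 6) , p
index (inj₂ (inj₂ (inj₂ (inj₂ (inj₂ (inj₂ (inj₂ (inj₁ p))))))))                        = inj₂ (Fin.# 0) , p
index (inj₂ (inj₂ (inj₂ (inj₂ (inj₂ (inj₂ (inj₂ (inj₂ (inj₁ p)))))))))                 = inj₂ (Fin.# 1) , p
index (inj₂ (inj₂ (inj₂ (inj₂ (inj₂ (inj₂ (inj₂ (inj₂ (inj₂ p)))))))))                 = inj₂ (Fin.# 2) , p

member : ∀ {n G} x → IsMember n G x → InFamily n G
member (inj₁ fz)                                    p = inj₁ p
member (inj₁ (fs fz))                               p = inj₂ (inj₁ p)
member (inj₁ (fs (fs fz)))                          p = inj₂ (inj₂ (inj₁ p))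
member (inj₁ (fs (fs (fs fz))))                     p = inj₂ (inj₂ (inj₂ (inj₁ p)))
member (inj₁ (fs (fs (fs (fs fz)))))                p = inj₂ (inj₂ (inj₂ (inj₂ (inj₁ p))))
member (inj₁ (fs (fs (fs (fs (fs fz))))))           p = inj₂ (inj₂ (inj₂ (inj₂ (inj₂ (inj₁ p)))))
member (inj₁ (fs (fs (fs (fs (fs (fs fz)))))))      p = inj₂ (inj₂ (inj₂ (inj₂ (inj₂ (inj₂ (inj₁ p))))))
member (inj₂ fz)                                    p = inj₂ (inj₂ (inj₂ (inj₂ (inj₂ (inj₂ (inj₂ (inj₁ p)))))))
member (inj₂ (fs fz))                               p = inj₂ (inj₂ (inj₂ (inj₂ (inj₂ (inj₂ (inj₂ (inj₂ (inj₁ p))))))))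
member (inj₂ (fs (fs fz)))                          p = inj₂ (inj₂ (inj₂ (inj₂ (inj₂ (inj₂ (inj₂ (inj₂ (inj₂ p))))))))

member-common : ∀ {n} {G H : Adj n} x → IsMember n G x → IsMember n H x → Iso G H
member-common {n} {G} {H} (inj₁ i) p q = iso-trans {G = G} {joinK (n ∸ 4) (family₄ i)} {H} p (iso-sym {G = H} {joinK (n ∸ 4) (family₄ i)} q)
member-common {n} {G} {H} (inj₂ i) p q = iso-trans {G = G} {joinK (n ∸ 5) (family₅ i)} {H} p (iso-sym {G = H} {joinK (n ∸ 5) (family₅ i)} q)

-- The values of joinChar 1 and joinChar 0 at the cores on four vertices ...
chars₄ : Fin 7 → Poly × Poly
chars₄ = Vec.lookup
  ( (ℤ.- (+ 32) ∷ ℤ.- (+ 96) ∷ ℤ.- (+ 88) ∷ ℤ.- (+ 28) ∷ + 0 ∷ + 1 ∷ [] , ℤ.- (+ 48) ∷ ℤ.- (+ 64) ∷ ℤ.- (+ 24) ∷ + 0 ∷ + 1 ∷ [])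
  ∷ᵥ (+ 0 ∷ ℤ.- (+ 24) ∷ ℤ.- (+ 52) ∷ ℤ.- (+ 24) ∷ + 0 ∷ + 1 ∷ [] , + 0 ∷ ℤ.- (+ 32) ∷ ℤ.- (+ 20) ∷ + 0 ∷ + 1 ∷ [])
  ∷ᵥ (+ 16 ∷ + 8 ∷ ℤ.- (+ 32) ∷ ℤ.- (+ 20) ∷ + 0 ∷ + 1 ∷ [] , + 16 ∷ ℤ.- (+ 16) ∷ ℤ.- (+ 16) ∷ + 0 ∷ + 1 ∷ [])
  ∷ᵥ (+ 0 ∷ + 0 ∷ ℤ.- (+ 16) ∷ ℤ.- (+ 20) ∷ + 0 ∷ + 1 ∷ [] , + 0 ∷ + 0 ∷ ℤ.- (+ 16) ∷ + 0 ∷ + 1 ∷ [])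
  ∷ᵥ (+ 16 ∷ + 24 ∷ ℤ.- (+ 12) ∷ ℤ.- (+ 16) ∷ + 0 ∷ + 1 ∷ [] , + 16 ∷ + 0 ∷ ℤ.- (+ 12) ∷ + 0 ∷ + 1 ∷ [])
  ∷ᵥ (+ 0 ∷ + 0 ∷ ℤ.- (+ 12) ∷ ℤ.- (+ 16) ∷ + 0 ∷ + 1 ∷ [] , + 0 ∷ + 0 ∷ ℤ.- (+ 12) ∷ + 0 ∷ + 1 ∷ [])
  ∷ᵥ (+ 32 ∷ + 32 ∷ ℤ.- (+ 8) ∷ ℤ.- (+ 12) ∷ + 0 ∷ + 1 ∷ [] , + 16 ∷ + 0 ∷ ℤ.- (+ 8) ∷ + 0 ∷ + 1 ∷ [])
  ∷ᵥ []ᵥ)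

-- ... and, for those on five vertices, of joinChar 1 divided by y and of joinChar 0.
chars₅ : Fin 3 → Poly × Poly
chars₅ = Vec.lookup
  ( (ℤ.- (+ 80) ∷ + 96 ∷ + 4 ∷ ℤ.- (+ 24) ∷ ℤ.- (+ 1) ∷ + 1 ∷ [] , ℤ.- (+ 64) ∷ + 80 ∷ + 0 ∷ ℤ.- (+ 20) ∷ + 0 ∷ + 1 ∷ [])
  ∷ᵥ (+ 48 ∷ + 64 ∷ ℤ.- (+ 44) ∷ ℤ.- (+ 32) ∷ ℤ.- (+ 1) ∷ + 1 ∷ [] , + 64 ∷ + 48 ∷ ℤ.- (+ 48) ∷ ℤ.- (+ 28) ∷ + 0 ∷ + 1 ∷ [])
  ∷ᵥ (ℤ.- (+ 16) ∷ + 64 ∷ ℤ.- (+ 12) ∷ ℤ.- (+ 24) ∷ ℤ.- (+ 1) ∷ + 1 ∷ [] , + 0 ∷ + 48 ∷ ℤ.- (+ 16) ∷ ℤ.- (+ 20) ∷ + 0 ∷ + 1 ∷ [])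
  ∷ᵥ []ᵥ)

opaque
  unfolding _≋ᵇ_ joinChar

  evaluated₄ : allᶠ 7 (λ i → (joinChar 1 (coreEcc (family₄ i)) ≋ᵇ proj₁ (chars₄ i)) ∧ (joinChar 0 (coreEcc (family₄ i)) ≋ᵇ proj₂ (chars₄ i))) ≡ true
  evaluated₄ = ≡.refl

  evaluated₅ : allᶠ 3 (λ i → (joinChar 1 (coreEcc (family₅ i)) ≋ᵇ (y *ₚ proj₁ (chars₅ i))) ∧ (joinChar 0 (coreEcc (family₅ i)) ≋ᵇ proj₂ (chars₅ i))) ≡ true
  evaluated₅ = ≡.refl

char₄ : ∀ i → joinChar 1 (coreEcc (family₄ i)) ≋ proj₁ (chars₄ i) × joinChar 0 (coreEcc (family₄ i)) ≋ proj₂ (chars₄ i)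
char₄ = pointwise-≋ (λ i → joinChar 1 (coreEcc (family₄ i))) (λ i → proj₁ (chars₄ i))
                    (λ i → joinChar 0 (coreEcc (family₄ i))) (λ i → proj₂ (chars₄ i)) evaluated₄

char₅ : ∀ i → joinChar 1 (coreEcc (family₅ i)) ≋ (y *ₚ proj₁ (chars₅ i)) × joinChar 0 (coreEcc (family₅ i)) ≋ proj₂ (chars₅ i)
char₅ = pointwise-≋ (λ i → joinChar 1 (coreEcc (family₅ i))) (λ i → y *ₚ proj₁ (chars₅ i))
                    (λ i → joinChar 0 (coreEcc (family₅ i))) (λ i → proj₂ (chars₅ i)) evaluated₅

-- Put n = 16 + t. The twin difference enters the formula with factor n - 5 = 11 + t for a core on
-- four vertices and n - 6 = 10 + t for one on five; this is the source of 11 and 10. In the second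
-- case `joinChar 1` is y q, the twin difference is y times q minus `joinChar 0`, and the common y
-- has been moved into the power.
baseChar slopeChar : Index → Poly
slopeChar (inj₁ i) = proj₁ (chars₄ i) P.- (y *ₚ proj₂ (chars₄ i))
slopeChar (inj₂ i) = proj₁ (chars₅ i) P.- proj₂ (chars₅ i)
baseChar (inj₁ i) = proj₁ (chars₄ i) +ₚ ((+ 11 ∷ []) *ₚ slopeChar (inj₁ i))
baseChar (inj₂ i) = proj₁ (chars₅ i) +ₚ ((+ 10 ∷ []) *ₚ slopeChar (inj₂ i))

-- The characteristic polynomial of a member on 16 + t vertices, divided by y ^ (11 + t), is affine in t.
reducedChar : Index → ℕ → Poly
reducedChar x t = baseChar x +ₚ ((+ t ∷ []) *ₚ slopeChar x)

noUniversal₄ : ∀ i → NoUniversal (family₄ i)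
noUniversal₄ = toWitness {a? = all? λ i → all? λ a → any? λ b → ¬? (a Fin.≟ b) ×-dec (family₄ i a b Bool.≟ false)} tt

noUniversal₅ : ∀ i → NoUniversal (family₅ i)
noUniversal₅ = toWitness {a? = all? λ i → all? λ a → any? λ b → ¬? (a Fin.≟ b) ×-dec (family₅ i a b Bool.≟ false)} tt

-- The order n is kept a variable, since the determinant of a matrix of order 16 + t would unfold.
order-arithmetic : ∀ {n} → 16 ≤ n → n ∸ 4 ≡ suc (n ∸ 5) × n ∸ 5 ≡ suc (n ∸ 6) × n ∸ 6 ≡ 10 ℕ.+ (n ∸ 16)
order-arithmetic {n} 16≤n = ∸-suc 4 (ℕₚ.≤-trans (ℕₚ.m≤m+n 5 11) 16≤n) , ∸-suc 5 (ℕₚ.≤-trans (ℕₚ.m≤m+n 6 10) 16≤n) ,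
  ≡.trans (≡.sym (ℕₚ.m+[n∸m]≡n {10} {n ∸ 6} (ℕₚ.∸-monoˡ-≤ 6 16≤n))) (≡.cong (10 ℕ.+_) (ℕₚ.∸-+-assoc n 6 10))
  where
  ∸-suc : ∀ {n} k → k < n → n ∸ k ≡ suc (n ∸ suc k)
  ∸-suc zero    (s≤s _)   = ≡.refl
  ∸-suc (suc k) (s≤s k<n) = ∸-suc k k<n

member-char : ∀ {n} → 16 ≤ n → (G : Adj n) → IsSimple G → Connected G → ∀ x → IsMember n G x →
  eccCharPoly G ≋ ((y ^ₚ (n ∸ 5)) *ₚ reducedChar x (n ∸ 16))
member-char {n} 16≤n G simple connected (inj₁ i) iso = begin
  eccCharPoly G
    ≈⟨ JoinSpectrum.eccCharPoly-formula {k = n ∸ 5} G simple connected (family₄ i) (noUniversal₄ i)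
         (≡.subst (λ k → Iso G (joinK k (family₄ i))) e₄ iso) ⟩
  (y ^ₚ (n ∸ 5)) *ₚ (joinChar 1 (coreEcc (family₄ i)) +ₚ ((+ (n ∸ 5) ∷ []) *ₚ twinDifference (coreEcc (family₄ i))))
    ≈⟨ P.*-congˡ {y ^ₚ (n ∸ 5)} (P.+-cong (proj₁ (char₄ i)) (P.*-cong
         (P.reflexive (≡.cong (λ k → + k ∷ []) (≡.trans e₅ (≡.cong suc e₆))))
         (P.+-cong (proj₁ (char₄ i)) (P.-‿cong (P.*-congˡ {y} (proj₂ (char₄ i))))))) ⟩
  (y ^ₚ (n ∸ 5)) *ₚ (proj₁ (chars₄ i) +ₚ (((+ 11 ∷ []) +ₚ (+ t ∷ [])) *ₚ slopeChar (inj₁ i)))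
    ≈⟨ P.*-congˡ {y ^ₚ (n ∸ 5)} (PolyIdentities.shift (proj₁ (chars₄ i)) (+ 11 ∷ []) (+ t ∷ []) (slopeChar (inj₁ i))) ⟩
  (y ^ₚ (n ∸ 5)) *ₚ reducedChar (inj₁ i) t ∎
  where
  open ≋-Reasoning
  t : ℕ
  t = n ∸ 16
  e₄ : n ∸ 4 ≡ suc (n ∸ 5)
  e₄ = proj₁ (order-arithmetic 16≤n)
  e₅ : n ∸ 5 ≡ suc (n ∸ 6)
  e₅ = proj₁ (proj₂ (order-arithmetic 16≤n))
  e₆ : n ∸ 6 ≡ 10 ℕ.+ t
  e₆ = proj₂ (proj₂ (order-arithmetic 16≤n))
member-char {n} 16≤n G simple connected (inj₂ i) iso = begin
  eccCharPoly G
    ≈⟨ JoinSpectrum.eccCharPoly-formula {k = n ∸ 6} G simple connected (family₅ i) (noUniversal₅ i)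
         (≡.subst (λ k → Iso G (joinK k (family₅ i))) e₅ iso) ⟩
  (y ^ₚ (n ∸ 6)) *ₚ (joinChar 1 (coreEcc (family₅ i)) +ₚ ((+ (n ∸ 6) ∷ []) *ₚ twinDifference (coreEcc (family₅ i))))
    ≈⟨ P.*-congˡ {y ^ₚ (n ∸ 6)} (P.+-cong (proj₁ (char₅ i)) (P.*-congˡ {+ (n ∸ 6) ∷ []} difference)) ⟩
  (y ^ₚ (n ∸ 6)) *ₚ ((y *ₚ proj₁ (chars₅ i)) +ₚ ((+ (n ∸ 6) ∷ []) *ₚ (y *ₚ slopeChar (inj₂ i))))
    ≈⟨ PolyIdentities.factor-y (y ^ₚ (n ∸ 6)) y (proj₁ (chars₅ i)) (+ (n ∸ 6) ∷ []) (slopeChar (inj₂ i)) ⟩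
  (y ^ₚ suc (n ∸ 6)) *ₚ (proj₁ (chars₅ i) +ₚ ((+ (n ∸ 6) ∷ []) *ₚ slopeChar (inj₂ i)))
    ≈⟨ P.*-cong (P.reflexive (≡.cong (y ^ₚ_) (≡.sym e₅))) (P.+-congˡ {proj₁ (chars₅ i)} (P.*-congʳ {slopeChar (inj₂ i)}
         (P.reflexive (≡.cong (λ k → + k ∷ []) e₆)))) ⟩
  (y ^ₚ (n ∸ 5)) *ₚ (proj₁ (chars₅ i) +ₚ (((+ 10 ∷ []) +ₚ (+ t ∷ [])) *ₚ slopeChar (inj₂ i)))
    ≈⟨ P.*-congˡ {y ^ₚ (n ∸ 5)} (PolyIdentities.shift (proj₁ (chars₅ i)) (+ 10 ∷ []) (+ t ∷ []) (slopeChar (inj₂ i))) ⟩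
  (y ^ₚ (n ∸ 5)) *ₚ reducedChar (inj₂ i) t ∎
  where
  open ≋-Reasoning
  t : ℕ
  t = n ∸ 16
  e₅ : n ∸ 5 ≡ suc (n ∸ 6)
  e₅ = proj₁ (proj₂ (order-arithmetic 16≤n))
  e₆ : n ∸ 6 ≡ 10 ℕ.+ t
  e₆ = proj₂ (proj₂ (order-arithmetic 16≤n))
  difference : twinDifference (coreEcc (family₅ i)) ≋ (y *ₚ slopeChar (inj₂ i))
  difference = P.trans (P.+-cong (proj₁ (char₅ i)) (P.-‿cong (P.*-congˡ {y} (proj₂ (char₅ i)))))
    (P.sym (P.x[y-z]≈xy-xz y (proj₁ (chars₅ i)) (proj₂ (chars₅ i))))

-- A test that excludes a + t b = 0 for all natural t at once: a is nonzero and b is zero or of the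
-- same sign.
sameSign : ℤ → ℤ → Bool
sameSign (+ suc _)   (+ _)      = true
sameSign ℤ.-[1+ _ ] (+ 0)       = true
sameSign ℤ.-[1+ _ ] ℤ.-[1+ _ ]  = true
sameSign _           _          = false

sameSign-sound : ∀ a b t → sameSign a b ≡ true → a ℤ.+ + t ℤ.* b ≢ + 0
sameSign-sound (+ suc m) (+ k) t _ e = contradiction (≡.trans (≡.cong (λ z → + suc m ℤ.+ z) (ℤₚ.pos-* t k)) e) λ ()
sameSign-sound ℤ.-[1+ m ] (+ 0) t _ e = contradiction (≡.trans (≡.sym (≡.cong (λ z → ℤ.-[1+ m ] ℤ.+ z) (ℤₚ.*-zeroʳ (+ t)))) e) λ ()
sameSign-sound ℤ.-[1+ m ] ℤ.-[1+ k ] t _ e = sameSign-sound (+ suc m) (+ suc k) t ≡.refl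
  (≡.trans (≡.cong (λ z → + suc m ℤ.+ z) (≡.sym (ℤₚ.neg-distribʳ-* (+ t) ℤ.-[1+ k ])))
    (≡.trans (≡.sym (ℤₚ.neg-distrib-+ ℤ.-[1+ m ] (+ t ℤ.* ℤ.-[1+ k ]))) (≡.cong ℤ.-_ e)))

allIndex : (Index → Bool) → Bool
allIndex p = allᶠ 7 (p ∘ inj₁) ∧ allᶠ 3 (p ∘ inj₂)

allIndex-sound : ∀ p → allIndex p ≡ true → ∀ x → p x ≡ true
allIndex-sound p e (inj₁ i) = allᶠ-sound 7 {p ∘ inj₁} (proj₁ (∧-true {allᶠ 7 (p ∘ inj₁)} {allᶠ 3 (p ∘ inj₂)} e)) i
allIndex-sound p e (inj₂ i) = allᶠ-sound 3 {p ∘ inj₂} (proj₂ (∧-true {allᶠ 7 (p ∘ inj₁)} {allᶠ 3 (p ∘ inj₂)} e)) i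

_==ᴵ_ : Index → Index → Bool
inj₁ i ==ᴵ inj₁ j = i == j
inj₂ i ==ᴵ inj₂ j = i == j
_      ==ᴵ _      = false

==ᴵ-sound : ∀ x x′ → (x ==ᴵ x′) ≡ true → x ≡ x′
==ᴵ-sound (inj₁ i) (inj₁ j) e = ≡.cong inj₁ (⌊⌋-sound {P? = i Fin.≟ j} e)
==ᴵ-sound (inj₂ i) (inj₂ j) e = ≡.cong inj₂ (⌊⌋-sound {P? = i Fin.≟ j} e)

opaque
  nonvanishing : Index → Bool
  nonvanishing x = sameSign (ev (baseChar x)) (ev (slopeChar x))

  nonvanishing-sound : ∀ x → nonvanishing x ≡ true → ∀ t → ev (baseChar x) ℤ.+ + t ℤ.* ev (slopeChar x) ≢ + 0
  nonvanishing-sound x e t = sameSign-sound (ev (baseChar x)) (ev (slopeChar x)) t e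

  nonvanishing-all : allIndex nonvanishing ≡ true
  nonvanishing-all = ≡.refl

  -- The reduced polynomials have degree five, hence six coefficients. One position must tell two
  -- members apart for every t simultaneously.
  separated : Index → Index → Fin 6 → Bool
  separated x x′ c = sameSign (coeff (baseChar x) (toℕ c) ℤ.- coeff (baseChar x′) (toℕ c))
                              (coeff (slopeChar x) (toℕ c) ℤ.- coeff (slopeChar x′) (toℕ c))

  separated-sound : ∀ x x′ c → separated x x′ c ≡ true → ∀ t →
    (coeff (baseChar x) (toℕ c) ℤ.- coeff (baseChar x′) (toℕ c)) ℤ.+
    + t ℤ.* (coeff (slopeChar x) (toℕ c) ℤ.- coeff (slopeChar x′) (toℕ c)) ≢ + 0
  separated-sound x x′ c e t = sameSign-sound
    (coeff (baseChar x) (toℕ c) ℤ.- coeff (baseChar x′) (toℕ c))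
    (coeff (slopeChar x) (toℕ c) ℤ.- coeff (slopeChar x′) (toℕ c)) t e

  separated-all : allIndex (λ x → allIndex λ x′ → (x ==ᴵ x′) ∨ anyᶠ 6 (separated x x′)) ≡ true
  separated-all = ≡.refl

ev-const* : ∀ t p → ev ((+ t ∷ []) *ₚ p) ≡ + t ℤ.* ev p
ev-const* t p = ≡.trans (ev-hom.*-homo (+ t ∷ []) p) (≡.cong (ℤ._* ev p) (ℤₚ.+-identityʳ (+ t)))

-- This makes the multiplicity exact: no further factor y is hidden in the cofactor of y ^ (n - 5).
ev-reducedChar : ∀ x t → ev (reducedChar x t) ≢ + 0
ev-reducedChar x t e = nonvanishing-sound x (allIndex-sound nonvanishing nonvanishing-all x) t
  (≡.trans (≡.sym (≡.trans (ev-hom.+-homo (baseChar x) ((+ t ∷ []) *ₚ slopeChar x))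
    (≡.cong (λ z → ev (baseChar x) ℤ.+ z) (ev-const* t (slopeChar x))))) e)

reducedChar-injective : ∀ x x′ t → reducedChar x t ≋ reducedChar x′ t → x ≡ x′
reducedChar-injective x x′ t e = decide (∨-true (x ==ᴵ x′) {anyᶠ 6 (separated x x′)}
  (allIndex-sound (λ x′ → (x ==ᴵ x′) ∨ anyᶠ 6 (separated x x′))
    (allIndex-sound (λ x → allIndex λ x′ → (x ==ᴵ x′) ∨ anyᶠ 6 (separated x x′)) separated-all x) x′))
  where
  open import Data.Integer.Solver using (module +-*-Solver)
  open +-*-Solver
  coeff-reducedChar : ∀ x i → coeff (reducedChar x t) i ≡ coeff (baseChar x) i ℤ.+ + t ℤ.* coeff (slopeChar x) i
  coeff-reducedChar x i = ≡.trans (coeff-+ (baseChar x) ((+ t ∷ []) *ₚ slopeChar x) i) (≡.cong (λ z → coeff (baseChar x) i ℤ.+ z)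
    (≡.trans (coeff-+ (map (+ t ℤ.*_) (slopeChar x)) (+ 0 ∷ []) i)
      (≡.trans (≡.cong₂ ℤ._+_ (coeff-scale (+ t) (slopeChar x) i) (coeff-zero i)) (ℤₚ.+-identityʳ (+ t ℤ.* coeff (slopeChar x) i)))))
  regroup : ∀ a a′ b b′ → (a ℤ.- a′) ℤ.+ + t ℤ.* (b ℤ.- b′) ≡ (a ℤ.+ + t ℤ.* b) ℤ.- (a′ ℤ.+ + t ℤ.* b′)
  regroup a a′ b b′ = solve 5 (λ a a′ b b′ t → (a :- a′) :+ t :* (b :- b′) := (a :+ t :* b) :- (a′ :+ t :* b′)) ≡.refl a a′ b b′ (+ t)
  difference : ∀ {a b} → a ≡ b → a ℤ.- b ≡ + 0
  difference {a} ≡.refl = ℤₚ.+-inverseʳ a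
  decide : (x ==ᴵ x′) ≡ true ⊎ anyᶠ 6 (separated x x′) ≡ true → x ≡ x′
  decide (inj₁ q) = ==ᴵ-sound x x′ q
  decide (inj₂ q) with anyᶠ-sound 6 {separated x x′} q
  ... | c , s = contradiction
    (≡.trans (regroup (coeff (baseChar x) (toℕ c)) (coeff (baseChar x′) (toℕ c)) (coeff (slopeChar x) (toℕ c)) (coeff (slopeChar x′) (toℕ c)))
      (difference (≡.trans (≡.sym (coeff-reducedChar x (toℕ c))) (≡.trans (at e (toℕ c)) (coeff-reducedChar x′ (toℕ c))))))
    (separated-sound x x′ c s t)

-- The equivalence and determination by the spectrum

module Main {n} (16≤n : 16 ≤ n) (G : Adj n) (simple : IsSimple G) (connected : Connected G) where

  backward : ∀ x → IsMember n G x → MultMinusOne G (n ∸ 5)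
  backward x m = (reducedChar x (n ∸ 16) , at (member-char 16≤n G simple connected x m)) , excluded
    where
    excluded : ¬ ((y ^ₚ suc (n ∸ 5)) ∣ₚ eccCharPoly G)
    excluded (r , d) = ev-reducedChar x (n ∸ 16) (≡.trans (ev-hom.⟦⟧-cong cancelled) (≡.trans (ev-hom.*-homo y r) (ℤₚ.*-zeroˡ (ev r))))
      where
      cancelled : reducedChar x (n ∸ 16) ≋ (y *ₚ r)
      cancelled = y^-cancel (n ∸ 5) (reducedChar x (n ∸ 16)) (y *ₚ r)
        (P.trans (P.sym (member-char 16≤n G simple connected x m))
          (P.trans (mk {eccCharPoly G} {(y ^ₚ suc (n ∸ 5)) *ₚ r} d) (P.sym (PolyIdentities.assoc₂ y (y ^ₚ (n ∸ 5)) r))))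

  formula : ∀ {k r} (H : Adj r) → NoUniversal H → Iso G (joinK (suc k) H) →
    eccCharPoly G ≋ ((y ^ₚ k) *ₚ (joinChar 1 (coreEcc H) +ₚ ((+ k ∷ []) *ₚ twinDifference (coreEcc H))))
  formula {k} H noUniversal iso = JoinSpectrum.eccCharPoly-formula {k = k} G simple connected H noUniversal iso

  -- At most three core vertices leave k ≥ n - 4, so the twins alone exceed the prescribed
  -- multiplicity.
  small-core : ∀ {k r} (H : Adj r) → NoUniversal H → Iso G (joinK (suc k) H) → suc k ℕ.+ r ≡ n → r ≤ 3 →
    (y ^ₚ suc (n ∸ 5)) ∣ₚ eccCharPoly G
  small-core {k} {r} H noUniversal iso size r≤3 = (y ^ₚ (k ∸ suc (n ∸ 5))) *ₚ p , at (begin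
    eccCharPoly G                                                  ≈⟨ formula H noUniversal iso ⟩
    (y ^ₚ k) *ₚ p                                                  ≡⟨ ≡.cong (λ l → (y ^ₚ l) *ₚ p) (ℕₚ.m+[n∸m]≡n enough) ⟨
    (y ^ₚ (suc (n ∸ 5) ℕ.+ (k ∸ suc (n ∸ 5)))) *ₚ p                ≈⟨ P.*-congʳ {p} (^ₚ-+ y (suc (n ∸ 5)) (k ∸ suc (n ∸ 5))) ⟩
    ((y ^ₚ suc (n ∸ 5)) *ₚ (y ^ₚ (k ∸ suc (n ∸ 5)))) *ₚ p          ≈⟨ P.*-assoc (y ^ₚ suc (n ∸ 5)) (y ^ₚ (k ∸ suc (n ∸ 5))) p ⟩
    (y ^ₚ suc (n ∸ 5)) *ₚ ((y ^ₚ (k ∸ suc (n ∸ 5))) *ₚ p)          ∎)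
    where
    open ≋-Reasoning
    p : Poly
    p = joinChar 1 (coreEcc H) +ₚ ((+ k ∷ []) *ₚ twinDifference (coreEcc H))
    enough : suc (n ∸ 5) ≤ k
    enough = ≡.subst (_≤ k) (proj₁ (order-arithmetic 16≤n)) (ℕₚ.m≤n+o⇒m∸n≤o n 4 (ℕₚ.≤-trans (ℕₚ.≤-reflexive (≡.sym size))
      (s≤s (≡.subst (k ℕ.+ r ≤_) (ℕₚ.+-comm k 3) (ℕₚ.+-monoʳ-≤ k r≤3)))))

  four : ∀ {k} (H : Adj 4) → IsSimple H → NoUniversal H → Iso G (joinK (suc k) H) → suc k ≡ n ∸ 4 → ∃ (IsMember n G)
  four {k} H simpleH noUniversal iso e = choose (classify₄ H simpleH noUniversal)
    where
    choose : (∃ λ i → Iso H (family₄ i)) → ∃ (IsMember n G)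
    choose (i , h) = inj₁ i , ≡.subst (λ K → Iso G (joinK K (family₄ i))) e
      (iso-trans {G = G} {joinK (suc k) H} {joinK (suc k) (family₄ i)} iso (joinK-cong (suc k) {H} {family₄ i} h))

  -- Here k = n - 6, so the closed formula accounts for all but one of the n - 5 factors, and the
  -- last one must divide `J` plus k times `Δ`.
  five : (y ^ₚ (n ∸ 5)) ∣ₚ eccCharPoly G → ∀ {k} (H : Adj 5) → IsSimple H → NoUniversal H → Iso G (joinK (suc k) H) →
    suc k ≡ n ∸ 5 → ∃ (IsMember n G)
  five (q , d) {k} H simpleH noUniversal iso e = choose (classify₅ H simpleH noUniversal)
    where
    J Δ : Poly
    J = joinChar 1 (coreEcc H)
    Δ = twinDifference (coreEcc H)

    cancelled : (J +ₚ ((+ k ∷ []) *ₚ Δ)) ≋ (y *ₚ q)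
    cancelled = y^-cancel k (J +ₚ ((+ k ∷ []) *ₚ Δ)) (y *ₚ q)
      (P.trans (P.sym (formula H noUniversal iso))
        (P.trans (mk {eccCharPoly G} {(y ^ₚ (n ∸ 5)) *ₚ q} d)
          (P.trans (P.reflexive (≡.cong (λ l → (y ^ₚ l) *ₚ q) (≡.sym e))) (P.sym (PolyIdentities.assoc₂ y (y ^ₚ k) q)))))

    ev-Δ : ev Δ ≡ ev J
    ev-Δ = ≡.trans (ev-hom.+-homo J (negₚ (y *ₚ joinChar 0 (coreEcc H))))
      (≡.trans (≡.cong (λ z → ev J ℤ.+ z) (≡.trans (ev-hom.-‿homo (y *ₚ joinChar 0 (coreEcc H)))
        (≡.cong ℤ.-_ (≡.trans (ev-hom.*-homo y (joinChar 0 (coreEcc H))) (ℤₚ.*-zeroˡ (ev (joinChar 0 (coreEcc H))))))))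
        (ℤₚ.+-identityʳ (ev J)))

    -- At y = 0 the polynomials `Δ` and `J` agree, so the divisibility reads (k + 1) J = 0 there and
    -- the dependence on k drops out.
    ev-J : ev J ≡ + 0
    ev-J = Sum.[ (λ ()) , id ]′ (ℤₚ.i*j≡0⇒i≡0∨j≡0 (+ suc k) (≡.trans (ℤₚ.*-distribʳ-+ (ev J) (+ 1) (+ k))
      (≡.trans (≡.cong₂ ℤ._+_ (ℤₚ.*-identityˡ (ev J))
          (≡.trans (≡.cong (λ z → + k ℤ.* z) (≡.sym ev-Δ)) (≡.sym (ev-const* k Δ))))
        (≡.trans (≡.sym (ev-hom.+-homo J ((+ k ∷ []) *ₚ Δ)))
          (≡.trans (ev-hom.⟦⟧-cong cancelled) (≡.trans (ev-hom.*-homo y q) (ℤₚ.*-zeroˡ (ev q))))))))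

    choose : ¬ Singular (joinEcc 1 (coreEcc H)) ⊎ (∃ λ i → Iso H (family₅ i)) → ∃ (IsMember n G)
    choose (inj₁ regular) = ⊥-elim (regular (joinChar-singular 1 (coreEcc H) ev-J))
    choose (inj₂ (i , h)) = inj₂ i , ≡.subst (λ K → Iso G (joinK K (family₅ i))) e
      (iso-trans {G = G} {joinK (suc k) H} {joinK (suc k) (family₅ i)} iso (joinK-cong (suc k) {H} {family₅ i} h))

  classify : MultMinusOne G (n ∸ 5) → ∀ {k r} → r ≤ 5 → (H : Adj r) → IsSimple H → NoUniversal H →
    Iso G (joinK (suc k) H) → suc k ℕ.+ r ≡ n → ∃ (IsMember n G)
  classify (order , ¬more) {k} = go
    where
    remove : ∀ {m} c → m ℕ.+ c ≡ n → m ≡ n ∸ c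
    remove {m} c e = ≡.trans (≡.sym (ℕₚ.m+n∸n≡m m c)) (≡.cong (_∸ c) e)

    go : ∀ {r} → r ≤ 5 → (H : Adj r) → IsSimple H → NoUniversal H → Iso G (joinK (suc k) H) → suc k ℕ.+ r ≡ n → ∃ (IsMember n G)
    go {0} _ H simpleH nu iso size = ⊥-elim (¬more (small-core H nu iso size z≤n))
    go {1} _ H simpleH nu iso size = ⊥-elim (¬more (small-core H nu iso size (s≤s z≤n)))
    go {2} _ H simpleH nu iso size = ⊥-elim (¬more (small-core H nu iso size (s≤s (s≤s z≤n))))
    go {3} _ H simpleH nu iso size = ⊥-elim (¬more (small-core H nu iso size ℕₚ.≤-refl))
    go {4} _ H simpleH nu iso size = four H simpleH nu iso (remove 4 size)
    go {5} _ H simpleH nu iso size = five order H simpleH nu iso (remove 5 size)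
    go {suc (suc (suc (suc (suc (suc _)))))} (s≤s (s≤s (s≤s (s≤s (s≤s ()))))) H simpleH nu iso size

  forward : MultMinusOne G (n ∸ 5) → ∃ (IsMember n G)
  forward mult = go (Decompose.decompose G simple connected (LowRank.radius≤1 16≤n G simple connected (proj₁ mult)))
    where
    go : Decomposition G → ∃ (IsMember n G)
    go record { k = suc k ; H = H ; simple = simpleH ; noUniversal = nu ; iso = iso ; size = size } =
      classify mult (core≤5 16≤n G simple connected (proj₁ mult) H nu iso) H simpleH nu iso size

MultMinusOne-resp : ∀ {m n} {G : Adj m} {H : Adj n} k → eccCharPoly G ≋ eccCharPoly H → MultMinusOne G k → MultMinusOne H k
MultMinusOne-resp k e (d , ¬d) = ∣ₚ-resp-≋ (y ^ₚ k) e d , λ d′ → ¬d (∣ₚ-resp-≋ (y ^ₚ suc k) (P.sym e) d′)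

-- Equal polynomials force equal orders and hence equal multiplicities, so the classification
-- applies to H as well; the reduced polynomial then tells which of the ten graphs it is.
member-determined : ∀ {n} → 16 ≤ n → (G : Adj n) → IsSimple G → Connected G → ∀ x → IsMember n G x → DeterminedBySpectrum G
member-determined {n} 16≤n G simple connected x p m H simpleH connectedH e = sameOrder
  (ℕₚ.≤-antisym (charPoly-degree (eccMatrix G) (eccMatrix H) (λ i → ≡.sym (e i))) (charPoly-degree (eccMatrix H) (eccMatrix G) e))
  H simpleH connectedH (mk e)
  where
  sameOrder : ∀ {m} → m ≡ n → (H : Adj m) → IsSimple H → Connected H → eccCharPoly H ≋ eccCharPoly G → Iso H G
  sameOrder ≡.refl H simpleH connectedH e = sameIndex (Main.forward 16≤n H simpleH connectedH
    (MultMinusOne-resp {G = G} {H} (n ∸ 5) (P.sym e) (Main.backward 16≤n G simple connected x p)))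
    where
    sameIndex : ∃ (IsMember n H) → Iso H G
    sameIndex (x′ , p′) = member-common {G = H} {G} x (≡.subst (IsMember n H) (≡.sym x≡x′) p′) p
      where
      x≡x′ : x ≡ x′
      x≡x′ = reducedChar-injective x x′ (n ∸ 16) (y^-cancel (n ∸ 5) (reducedChar x (n ∸ 16)) (reducedChar x′ (n ∸ 16))
        (P.trans (P.sym (member-char 16≤n G simple connected x p)) (P.trans (P.sym e) (member-char 16≤n H simpleH connectedH x′ p′))))

theorem3p5 : ∀ n → 16 ≤ n → (G : Adj n) → IsSimple G → Connected G →
    (MultMinusOne G (n ∸ 5) ⇔ InFamily n G) × (InFamily n G → DeterminedBySpectrum G)
theorem3p5 n 16≤n G simple connected =
  mk⇔ (λ mult → uncurry member (Main.forward 16≤n G simple connected mult))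
      (λ f → uncurry (Main.backward 16≤n G simple connected) (index f))
  , λ f → uncurry (member-determined 16≤n G simple connected) (index f)
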